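{- Let $n\ge 3$ and consider the affine Weyl group $W_{\mathrm{aff}}$ of type $A_{n-1}^{(1)}$, with $c=\alpha_0+\alpha_1+\dots+\alpha_{n-1}$ and $\Pi$ the finite root system of type $A_{n-1}$. Let $m\ge 2$ be an integer. Then: (1) $\Gamma_{mc}(id)=\{t_{m\gamma}:\gamma\in\Pi\}$; (2) $|\Gamma_{mc}(id)|=n(n-1)$; (3) $\ell(w)=2m(n-1)$ for all $w\in\Gamma_{mc}(id)$.
   Context: Roots. Let $n\ge 3$. Let $\alpha_0,\dots,\alpha_{n-1}$ (indices mod $n$) be the affine simple roots of type $A_{n-1}^{(1)}$, $Q_{\mathrm{aff}}=\bigoplus_{i=0}^{n-1}\mathbb Z\alpha_i$, with symmetric form $\langle\alpha_i,\alpha_i\rangle=2$, $\langle\alpha_i,\alpha_{i\pm1}\rangle=-1$, all other $\langle\alpha_i,\alpha_j\rangle=0$. Put $c=\sum_{i=0}^{n-1}\alpha_i$ (identified with the imaginary root $\delta$). Let $\Pi=\Pi^+\sqcup\Pi^-$ be the finite root system of type $A_{n-1}$ with simple roots $\alpha_1,\dots,\alpha_{n-1}$. The affine real roots are $\alpha+mc$ with $\alpha\in\Pi$, $m\in\mathbb Z$; such a root is positive if $m>0$, or $m=0$ and $\alpha\in\Pi^+$. The set of positive real roots is $\Pi_{\mathrm{aff}}^{\mathrm{re},+}$. Weyl group. For a real root $\alpha$, $s_\alpha(\mu)=\mu-\langle\mu,\alpha\rangle\alpha$. $W_{\mathrm{aff}}$ is the group generated by $s_i=s_{\alpha_i}$,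 $0\le i\le n-1$ (a Coxeter group with these generators), with length $\ell$ and Bruhat order $\le$. One has $W_{\mathrm{aff}}=W\ltimes Q$, where $W=\langle s_1,\dots,s_{n-1}\rangle$ and $Q=\bigoplus_{i=1}^{n-1}\mathbb Z\alpha_i$ (root and coroot lattices identified); $t_\mu$ denotes the image of $\mu\in Q$, with $s_{\alpha+mc}=s_\alpha t_{m\alpha}$ for $\alpha\in\Pi$, $m\in\mathbb Z$ (so $t_\mu(\nu)=\nu-\langle\mu,\nu\rangle c$). Curve neighborhoods. The moment graph has vertex set $W_{\mathrm{aff}}$ and an edge $u\stackrel{\alpha}{\longrightarrow}us_\alpha$ of degree $\alpha$ for each $u\in W_{\mathrm{aff}}$, $\alpha\in\Pi_{\mathrm{aff}}^{\mathrm{re},+}$. The degree of a chain (a succession of adjacent edges, possibly empty) is the sum of the degrees of its edges. A degree is a tuple $\mathbf d=(d_0,\dots,d_{n-1})\in\mathbb Z_{\ge0}^n$, identified with $\sum d_i\alpha_i$; degrees are ordered componentwise. For $u\in W_{\mathrm{aff}}$, $\Gamma_{\mathbf d}(u)$ is the set of Bruhat-maximal elements of the set of all $v\in W_{\mathrm{aff}}$ that can be joined to some $u'\le u$ by a chain of degree $\le\mathbf d$. -}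

module Defs where

open import Data.Bool.Base using (if_then_else_; _∨_)
open import Data.Fin.Base using (Fin; toℕ)
open import Data.Fin.Properties using (_≟_; nonZeroIndex)
open import Data.Integer.Base as ℤ using (ℤ; +_; -_; 0ℤ; 1ℤ; -1ℤ)
open import Data.Integer.Properties using (+-*-semiring)
open import Data.List.Base using (List; foldr; length)
open import Data.List.Relation.Unary.All using (All)
open import Data.Nat.Base as ℕ using (ℕ; suc)
open import Data.Nat.DivMod using (_mod_)
open import Data.Product.Base using (_×_; ∃; ∃-syntax; Σ-syntax; proj₁)
open import Data.Sum.Base using (_⊎_)
open import Data.Vec.Functional using (Vector; replicate; zipWith)
open import Function.Base using (id; _∘_)
open import Function.Bundles using (Bijection)
open import Level using (0ℓ)
open import Relation.Binary.Bundles using (Setoid)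
import Relation.Binary.Construct.On as On
open import Relation.Binary.PropositionalEquality using (_≡_; _≢_; _≗_; refl; sym; trans; setoid)
open import Relation.Nullary.Decidable.Core using (does)
open import Relation.Unary using (Pred; _∈_; U)

open import Algebra.Properties.Semiring.Sum +-*-semiring using (sum)

private
  variable
    n : ℕ

-- The coordinates are the coefficients of α₀ , … , αₙ₋₁.  Elements are
-- compared pointwise, by _≗_.
Qaff : ℕ → Set
Qaff n = Vector ℤ n

infixl 6 _⊕_ _⊖_
infixl 7 _·_

_⊕_ _⊖_ : Qaff n → Qaff n → Qaff n
_⊕_ = zipWith ℤ._+_
_⊖_ = zipWith ℤ._-_

_·_ : ℤ → Qaff n → Qaff n
(k · μ) i = k ℤ.* μ i

α : Fin n → Qaff n
α i j = if does (i ≟ j) then 1ℤ else 0ℤ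

c : Qaff n
c = replicate _ 1ℤ

next : Fin n → Fin n
next {n} i = (suc (toℕ i) mod n) {{nonZeroIndex i}}

-- The Cartan matrix of type A⁽¹⁾ₙ₋₁; meaningful only for n ≥ 3.
cartan : Fin n → Fin n → ℤ
cartan i j =
  if does (i ≟ j) then + 2
  else if does (next i ≟ j) ∨ does (next j ≟ i) then -1ℤ
  else 0ℤ

⟨_,_⟩ : Qaff n → Qaff n → ℤ
⟨ μ , ν ⟩ = sum λ i → sum λ j → μ i ℤ.* ν j ℤ.* cartan i j

-- Groups acting on Qaff are represented as predicates on the type of all
-- maps Qaff n → Qaff n, elements of which are compared extensionally.
Map : ℕ → Set
Map n = Qaff n → Qaff n

infix 4 _≈_

_≈_ : Map n → Map n → Set
f ≈ g = ∀ μ → f μ ≗ g μ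

mapSetoid : ℕ → Setoid 0ℓ 0ℓ
mapSetoid n = record
  { Carrier       = Map n
  ; _≈_           = _≈_
  ; isEquivalence = record
    { refl  = λ μ i → refl
    ; sym   = λ p μ i → sym (p μ i)
    ; trans = λ p q μ i → trans (p μ i) (q μ i)
    }
  }

s : Qaff n → Map n
s β μ = μ ⊖ ⟨ μ , β ⟩ · β

t : Qaff n → Map n
t μ ν = ν ⊖ ⟨ μ , ν ⟩ · c

word : List (Fin n) → Map n
word = foldr (λ i f → s (α i) ∘ f) id

-- The group generated by the sᵢ with i in P; inverses are not needed
-- because each sᵢ is an involution.
Generated : Pred (Fin n) 0ℓ → Pred (Map n) 0ℓ
Generated P f = ∃[ w ] All P w × f ≈ word w

Finite : Pred (Fin n) 0ℓ
Finite i = toℕ i ≢ 0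

Waff W : Pred (Map n) 0ℓ
Waff = Generated U
W    = Generated Finite

-- The finite root system with simple roots αᵢ , i ≠ 0, as the set of
-- W-images of these simple roots.
Π : Pred (Qaff n) 0ℓ
Π {n} β = Σ[ f ∈ Map n ] Σ[ i ∈ Fin n ] f ∈ W × i ∈ Finite × β ≗ f (α i)

Π⁺ : Pred (Qaff n) 0ℓ
Π⁺ β = β ∈ Π × (∀ i → 0ℤ ℤ.≤ β i)

Πaff⁺ : Pred (Qaff n) 0ℓ
Πaff⁺ {n} β = Σ[ γ ∈ Qaff n ] Σ[ k ∈ ℤ ]
  γ ∈ Π × β ≗ γ ⊕ k · c × (0ℤ ℤ.< k ⊎ (k ≡ 0ℤ × γ ∈ Π⁺))

-- Length f k says that f belongs to Waff and ℓ(f) = k.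
Length : Map n → ℕ → Set
Length f k =
  (∃[ w ] f ≈ word w × length w ≡ k) × (∀ w → f ≈ word w → k ℕ.≤ length w)

infix 4 _⟶_ _≤ᴮ_

_⟶_ : Map n → Map n → Set
u ⟶ v =
  (∃[ β ] β ∈ Πaff⁺ × v ≈ u ∘ s β) ×
  (∃[ k ] ∃[ l ] Length u k × Length v l × k ℕ.< l)

-- The Bruhat order on Waff.
data _≤ᴮ_ {n : ℕ} (u : Map n) : Map n → Set where
  reflexive : ∀ {v} → u ∈ Waff → u ≈ v → u ≤ᴮ v
  step      : ∀ {v w} → u ≤ᴮ v → v ⟶ w → u ≤ᴮ w

-- Edges of the moment graph; Edge is symmetric in u and v since s β is an
-- involution.
Edge : Map n → Qaff n → Map n → Set
Edge u β v = u ∈ Waff × v ∈ Waff × β ∈ Πaff⁺ × v ≈ u ∘ s β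

infixr 5 _∷_

data Chain {n : ℕ} : Map n → Map n → Set where
  []  : ∀ {u v} → u ∈ Waff → u ≈ v → Chain u v
  _∷_ : ∀ {u v w β} → Edge u β v → Chain v w → Chain u w

degree : {u v : Map n} → Chain u v → Qaff n
degree ([] _ _)         = replicate _ 0ℤ
degree (_∷_ {β = β} _ p) = β ⊕ degree p

Degree : ℕ → Set
Degree n = Vector ℕ n

-- The elements joined to some u' ≤ u by a chain of degree at most d.
Reachable : Degree n → Map n → Pred (Map n) 0ℓ
Reachable {n} d u v =
  Σ[ u' ∈ Map n ] u' ≤ᴮ u × (Σ[ p ∈ Chain u' v ] (∀ i → degree p i ℤ.≤ + d i))

Γ : Degree n → Map n → Pred (Map n) 0ℓ
Γ d u v = v ∈ Reachable d u × (∀ v' → v' ∈ Reachable d u → v ≤ᴮ v' → v ≈ v')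

-- S has exactly k elements, where maps are counted up to _≈_.
HasCard : Pred (Map n) 0ℓ → ℕ → Set
HasCard {n} S k =
  Bijection (setoid (Fin k)) (On.setoid {B = ∃ S} (mapSetoid n) proj₁)

-- An element of Waff is an affine permutation f of ℤ, and a positive real root E b - E a is a pair of
-- integers a < b of distinct residues, up to a common translation by n.  Multiplying by a reflection of
-- degree β raises the number of points that f carries rightwards across the cut k by at most β k, so an
-- element reachable in degree m c crosses every cut at most m times.  Conversely, let f cross every cut at
-- most m times.  If some cut has slack, points on its two sides can be swapped; otherwise the movers
-- chain up, and two overlapping or consecutive movers of distinct residues can be swapped without changing
-- any crossing number, unless f only moves one residue class by m n and another one by - m n, i.e. f is
-- t (m γ).  Each swap goes up in the Bruhat order, and the crossing bound bounds the length, so every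
-- reachable element lies below some t (m γ).  These all have the same length, hence are the maximal ones.

module Submission where

open import Defs
open import Data.Fin.Base as Fin using (Fin; zero; suc; toℕ; punchIn; punchOut; combine; remQuot)
open import Data.Fin.Permutation using (permutation)
open import Data.Fin.Properties as Finₚ using (_≟_; toℕ-injective; toℕ<n; nonZeroIndex; punchIn-injective; punchIn-punchOut; punchInᵢ≢i; combine-remQuot; remQuot-combine)
open import Data.Integer.Base hiding (suc; pred; _⊖_)
open import Data.Integer.Properties renaming (_≟_ to _≟ᶻ_)
open import Data.Integer.Tactic.RingSolver using (solve-∀)
open import Data.List.Base using (List; []; _∷_; _++_; length; [_]; reverse)
open import Data.List.Properties using (unfold-reverse)
open import Data.List.Relation.Unary.All using (All; []; _∷_; universal)
open import Data.List.Relation.Unary.All.Properties using (++⁺)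
open import Data.Nat.Base as ℕ using (ℕ)
open import Data.Nat.DivMod using (m<n⇒m%n≡m; n%n≡0)
import Data.Nat.Properties as ℕₚ
open import Data.Product.Base using (_×_; _,_; ∃-syntax; Σ-syntax; proj₁; proj₂)
open import Data.Sum.Base using (_⊎_; inj₁; inj₂)
open import Data.Unit.Base using (tt)
open import Data.Vec.Functional using (replicate)
open import Function.Base using (_∘_; id)
open import Relation.Binary.Definitions using (tri<; tri≈; tri>)
open import Relation.Binary.PropositionalEquality using (_≡_; _≢_; _≗_; refl; sym; trans; cong; cong₂; subst; subst₂; module ≡-Reasoning)
open import Relation.Nullary using (Dec; yes; no; contradiction; ¬_)
open import Relation.Unary using (_∈_; _≐_)

open import Algebra.Properties.Semiring.Sum +-*-semiring
  using (sum; sum-cong-≗; ∑-distrib-+; ∑-comm; *-distribˡ-sum; *-distribʳ-sum; sum-permute; sum-replicate-zero)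

-- The upward swaps maintain no chain of degree at most `m c`. The invariant is only that every
-- crossing number stays at most `m`; a chain is needed at the very end, for the translations
-- themselves. A cut with slack is chosen with minimal crossing number, because minimality is what
-- forces a point on each side of that cut to have one end adjacent to it, so that the swap costs
-- one crossing there and none elsewhere. Going up in the Bruhat order is a statement about
-- `Length`, a minimum over all words. It therefore has to be tied to a count that can be computed
-- from the permutation: Shi's inversion formula, doubled as `N`, together with the exchange
-- condition. Elements of the group are compared as linear maps, and passing from an affine
-- permutation to its linear map forgets a global shift, so everything that is read off a linear map
-- must depend on differences of points only.

private
  variable
    n : ℕ

-- Integer inequalities and finite sums

-- Inequalities are proved by exhibiting slack: the ring solver identifies `y - x` with a sum of
-- differences that are already known to be nonnegative.
linear₁ : ∀ {a b x y} → a ≤ b → y - x ≡ b - a → x ≤ y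
linear₁ a≤b eq = 0≤i-j⇒j≤i (subst (0ℤ ≤_) (sym eq) (i≤j⇒0≤j-i a≤b))

linear₂ : ∀ {a b c d x y} → a ≤ b → c ≤ d → y - x ≡ (b - a) + (d - c) → x ≤ y
linear₂ {a} {b} {c} {d} a≤b c≤d eq = linear₁ (+-mono-≤ a≤b c≤d) (trans eq (lemma a b c d))
  where
  lemma : ∀ a b c d → (b - a) + (d - c) ≡ (b + d) - (a + c)
  lemma = solve-∀

linear₃ : ∀ {a b c d e f x y} → a ≤ b → c ≤ d → e ≤ f →
          y - x ≡ (b - a) + (d - c) + (f - e) → x ≤ y
linear₃ {a} {b} {c} {d} {e} {f} a≤b c≤d e≤f eq =
  linear₂ (+-mono-≤ a≤b c≤d) e≤f (trans eq (cong (_+ (f - e)) (lemma a b c d)))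
  where
  lemma : ∀ a b c d → (b - a) + (d - c) ≡ (b + d) - (a + c)
  lemma = solve-∀

<⇒1+≤ : ∀ {x y} → x < y → 1ℤ + x ≤ y
<⇒1+≤ = i<j⇒suc[i]≤j

1+≤⇒< : ∀ {x y} → 1ℤ + x ≤ y → x < y
1+≤⇒< = suc[i]≤j⇒i<j

α-refl : (i : Fin n) → α i i ≡ 1ℤ
α-refl i with i ≟ i
... | yes _  = refl
... | no i≢i = contradiction refl i≢i

α-≢ : {i j : Fin n} → i ≢ j → α i j ≡ 0ℤ
α-≢ {i = i} {j} i≢j with i ≟ j
... | yes i≡j = contradiction i≡j i≢j
... | no _    = refl

α-sym : (i j : Fin n) → α i j ≡ α j i
α-sym i j with i ≟ j
... | yes refl = sym (α-refl i)
... | no i≢j   = sym (α-≢ (i≢j ∘ sym))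

α-nonNegative : (i j : Fin n) → 0ℤ ≤ α i j
α-nonNegative i j with i ≟ j
... | yes _ = +≤+ ℕ.z≤n
... | no _  = +≤+ ℕ.z≤n

sum-zero : (f : Fin n → ℤ) → (∀ r → f r ≡ 0ℤ) → sum f ≡ 0ℤ
sum-zero {n} f f≡0 = trans (sum-cong-≗ f≡0) (sum-replicate-zero n)

sum-single : (f : Fin n → ℤ) (i : Fin n) → (∀ r → r ≢ i → f r ≡ 0ℤ) → sum f ≡ f i
sum-single f zero f≡0 = trans
  (cong (_+_ (f zero)) (sum-zero (f ∘ suc) λ r → f≡0 (suc r) λ ())) (+-identityʳ _)
sum-single f (suc i) f≡0 = trans
  (cong₂ _+_ (f≡0 zero λ ()) (sum-single (f ∘ suc) i λ r r≢i → f≡0 (suc r) λ { refl → r≢i refl }))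
  (+-identityˡ _)

sum-α : (f : Fin n → ℤ) (i : Fin n) → sum (λ r → f r * α i r) ≡ f i
sum-α f i = begin
  sum (λ r → f r * α i r)  ≡⟨ sum-single _ i (λ r r≢i → trans (cong (f r *_) (α-≢ (r≢i ∘ sym))) (*-zeroʳ (f r))) ⟩
  f i * α i i              ≡⟨ cong (f i *_) (α-refl i) ⟩
  f i * 1ℤ                 ≡⟨ *-identityʳ (f i) ⟩
  f i                      ∎
  where open ≡-Reasoning

sum-α₁ : (j : Fin n) → sum (α j) ≡ 1ℤ
sum-α₁ j = trans (sum-cong-≗ (λ r → sym (*-identityˡ (α j r)))) (sum-α (λ _ → 1ℤ) j)

sum-neg : (f : Fin n → ℤ) → sum (λ r → - f r) ≡ - sum f
sum-neg f = begin
  sum (λ r → - f r)        ≡⟨ sum-cong-≗ (λ r → sym (-1*i≡-i (f r))) ⟩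
  sum (λ r → -1ℤ * f r)    ≡⟨ *-distribˡ-sum -1ℤ f ⟨
  -1ℤ * sum f              ≡⟨ -1*i≡-i (sum f) ⟩
  - sum f                  ∎
  where open ≡-Reasoning

sum-sub : (f g : Fin n → ℤ) → sum (λ r → f r - g r) ≡ sum f - sum g
sum-sub f g = trans (∑-distrib-+ f (λ r → - g r)) (cong (_+_ (sum f)) (sum-neg g))

sum-mono : {f g : Fin n → ℤ} → (∀ r → f r ≤ g r) → sum f ≤ sum g
sum-mono {ℕ.zero}  f≤g = ≤-refl
sum-mono {ℕ.suc n} f≤g = +-mono-≤ (f≤g zero) (sum-mono (f≤g ∘ suc))

sum-pair : (f : Fin n → ℤ) {i j : Fin n} → i ≢ j →
           (∀ r → r ≢ i → r ≢ j → f r ≡ 0ℤ) → sum f ≡ f i + f j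
sum-pair f {i} {j} i≢j f≡0 = begin
  sum f
    ≡⟨ sum-cong-≗ (λ r → split (f r) (f i * α i r)) ⟩
  sum (λ r → f i * α i r + (f r - f i * α i r))
    ≡⟨ ∑-distrib-+ (λ r → f i * α i r) (λ r → f r - f i * α i r) ⟩
  sum (λ r → f i * α i r) + sum (λ r → f r - f i * α i r)
    ≡⟨ cong₂ _+_ (sum-α (λ _ → f i) i) (sum-single _ j rest) ⟩
  f i + (f j - f i * α i j)
    ≡⟨ cong (λ z → f i + (f j - z)) (trans (cong (f i *_) (α-≢ i≢j)) (*-zeroʳ (f i))) ⟩
  f i + (f j - 0ℤ)
    ≡⟨ cong (_+_ (f i)) (+-identityʳ (f j)) ⟩
  f i + f j ∎
  where
  open ≡-Reasoning
  split : ∀ a b → a ≡ b + (a - b)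
  split = solve-∀
  rest : ∀ r → r ≢ j → f r - f i * α i r ≡ 0ℤ
  rest r r≢j with i ≟ r
  ... | yes refl = trans (cong (_-_ (f i)) (*-identityʳ (f i))) (+-inverseʳ (f i))
  ... | no i≢r   = trans (cong₂ _-_ (f≡0 r (i≢r ∘ sym) r≢j) (*-zeroʳ (f i))) refl

sum-update : (f g : Fin n → ℤ) {i j : Fin n} → i ≢ j →
             (∀ r → r ≢ i → r ≢ j → f r ≡ g r) →
             sum f ≡ sum g + ((f i - g i) + (f j - g j))
sum-update f g {i} {j} i≢j f≡g = begin
  sum f                                          ≡⟨ sum-cong-≗ (λ r → split (f r) (g r)) ⟩
  sum (λ r → g r + (f r - g r))                  ≡⟨ ∑-distrib-+ g (λ r → f r - g r) ⟩
  sum g + sum (λ r → f r - g r)                  ≡⟨ cong (_+_ (sum g)) (sum-pair _ i≢j diff) ⟩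
  sum g + ((f i - g i) + (f j - g j))            ∎
  where
  open ≡-Reasoning
  split : ∀ a b → a ≡ b + (a - b)
  split = solve-∀
  diff : ∀ r → r ≢ i → r ≢ j → f r - g r ≡ 0ℤ
  diff r r≢i r≢j = trans (cong (_- g r) (f≡g r r≢i r≢j)) (+-inverseʳ (g r))

-- Points of the integer line and the root lattice

indicator : {P : Set} → Dec P → ℤ
indicator (yes _) = 1ℤ
indicator (no _)  = 0ℤ

indicator-yes : {P : Set} (P? : Dec P) → P → indicator P? ≡ 1ℤ
indicator-yes (yes _) p = refl
indicator-yes (no ¬p) p = contradiction p ¬p

indicator-no : {P : Set} (P? : Dec P) → ¬ P → indicator P? ≡ 0ℤ
indicator-no (yes p) ¬p = contradiction p ¬p
indicator-no (no _)  ¬p = refl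

indicator-nonNegative : {P : Set} (P? : Dec P) → 0ℤ ≤ indicator P?
indicator-nonNegative (yes _) = +≤+ ℕ.z≤n
indicator-nonNegative (no _)  = ≤-refl

indicator≤1 : {P : Set} (P? : Dec P) → indicator P? ≤ 1ℤ
indicator≤1 (yes _) = ≤-refl
indicator≤1 (no _)  = +≤+ ℕ.z≤n

lt : Fin n → Fin n → ℤ
lt i j = indicator (toℕ i ℕₚ.<? toℕ j)

lt-< : {i j : Fin n} → toℕ i ℕ.< toℕ j → lt i j ≡ 1ℤ
lt-< = indicator-yes (_ ℕₚ.<? _)

lt-≥ : {i j : Fin n} → toℕ j ℕ.≤ toℕ i → lt i j ≡ 0ℤ
lt-≥ = indicator-no (_ ℕₚ.<? _) ∘ ℕₚ.≤⇒≯

lt-refl : (i : Fin n) → lt i i ≡ 0ℤ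
lt-refl i = lt-≥ {i = i} {i} ℕₚ.≤-refl

lt-nonNegative : (i j : Fin n) → 0ℤ ≤ lt i j
lt-nonNegative i j = indicator-nonNegative (toℕ i ℕₚ.<? toℕ j)

lt≤1 : (i j : Fin n) → lt i j ≤ 1ℤ
lt≤1 i j = indicator≤1 (toℕ i ℕₚ.<? toℕ j)

lt-trichotomy : {i j : Fin n} → i ≢ j → lt i j + lt j i ≡ 1ℤ
lt-trichotomy {i = i} {j} i≢j with ℕₚ.<-cmp (toℕ i) (toℕ j)
... | tri< i<j _ _ = cong₂ _+_ (lt-< {i = i} {j} i<j) (lt-≥ {i = j} {i} (ℕₚ.<⇒≤ i<j))
... | tri≈ _ i≡j _ = contradiction (toℕ-injective i≡j) i≢j
... | tri> _ _ j<i = cong₂ _+_ (lt-≥ {i = i} {j} (ℕₚ.<⇒≤ j<i)) (lt-< {i = j} {i} j<i)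

lt-triangle : (i j k : Fin n) → lt i k ≤ lt i j + lt j k
lt-triangle i j k with toℕ i ℕₚ.<? toℕ k
... | no _    = +-mono-≤ (lt-nonNegative i j) (lt-nonNegative j k)
... | yes i<k with ℕₚ.≤-<-connex (toℕ j) (toℕ i)
...   | inj₁ j≤i = subst (λ z → 1ℤ ≤ lt i j + z) (sym (lt-< {i = j} {k} (ℕₚ.≤-<-trans j≤i i<k)))
                     (+-monoˡ-≤ 1ℤ (lt-nonNegative i j))
...   | inj₂ i<j = subst (λ z → 1ℤ ≤ z + lt j k) (sym (lt-< {i = i} {j} i<j))
                     (+-monoʳ-≤ 1ℤ (lt-nonNegative j k))

carry : Fin n → ℤ
carry {n} j = indicator (ℕ.suc (toℕ j) ℕₚ.≟ n)

data NextView {n : ℕ} (j : Fin n) : Set where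
  inner : toℕ (next j) ≡ ℕ.suc (toℕ j) → carry j ≡ 0ℤ → NextView j
  last  : ℕ.suc (toℕ j) ≡ n → toℕ (next j) ≡ 0 → carry j ≡ 1ℤ → NextView j

toℕ-next : (j : Fin n) → toℕ (next j) ≡ (ℕ.suc (toℕ j) ℕ.% n) {{nonZeroIndex j}}
toℕ-next j = Finₚ.toℕ-fromℕ< _

nextView : (j : Fin n) → NextView j
nextView {n} j with ℕ.suc (toℕ j) ℕₚ.≟ n
... | yes sj≡n = last sj≡n
  (trans (toℕ-next j) (trans (cong (λ m → (m ℕ.% n) {{nonZeroIndex j}}) sj≡n) (n%n≡0 n {{nonZeroIndex j}})))
  (indicator-yes (_ ℕₚ.≟ _) sj≡n)
... | no sj≢n  = inner
  (trans (toℕ-next j) (m<n⇒m%n≡m {{nonZeroIndex j}} (ℕₚ.≤∧≢⇒< (toℕ<n j) sj≢n)))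
  (indicator-no (_ ℕₚ.≟ _) sj≢n)

private
  ≤last : {j : Fin n} (k : Fin n) → ℕ.suc (toℕ j) ≡ n → toℕ k ℕ.≤ toℕ j
  ≤last k sj≡n = ℕₚ.≤-pred (subst (ℕ.suc (toℕ k) ℕ.≤_) (sym sj≡n) (toℕ<n k))

lt-nextʳ : (r j : Fin n) → lt r (next j) - lt r j ≡ α r j - carry j
lt-nextʳ r j with nextView j
... | last sj≡n nj≡0 c≡1 with r ≟ j
...   | yes refl rewrite c≡1 | lt-refl r
        | lt-≥ {i = r} {next r} (subst (ℕ._≤ toℕ r) (sym nj≡0) ℕ.z≤n) = refl
...   | no r≢j rewrite c≡1
        | lt-≥ {i = r} {next j} (subst (ℕ._≤ toℕ r) (sym nj≡0) ℕ.z≤n)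
        | lt-< {i = r} {j} (ℕₚ.≤∧≢⇒< (≤last r sj≡n) (r≢j ∘ toℕ-injective)) = refl
lt-nextʳ r j | inner nj≡sj c≡0 with r ≟ j
...   | yes refl rewrite c≡0 | lt-refl r | lt-< {i = r} {next r} (subst (toℕ r ℕ.<_) (sym nj≡sj) ℕₚ.≤-refl) = refl
...   | no r≢j rewrite c≡0 with ℕₚ.<-cmp (toℕ r) (toℕ j)
...     | tri< r<j _ _ rewrite lt-< {i = r} {j} r<j
            | lt-< {i = r} {next j} (subst (toℕ r ℕ.<_) (sym nj≡sj) (ℕₚ.m<n⇒m<1+n r<j)) = refl
...     | tri≈ _ r≡j _ = contradiction (toℕ-injective r≡j) r≢j
...     | tri> _ _ j<r rewrite lt-≥ {i = r} {j} (ℕₚ.<⇒≤ j<r)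
            | lt-≥ {i = r} {next j} (subst (ℕ._≤ toℕ r) (sym nj≡sj) j<r) = refl

lt-nextˡ : (r k : Fin n) → lt r k - lt (next r) k + carry r ≡ α (next r) k
lt-nextˡ r k with nextView r
... | last sj≡n nj≡0 c≡1 rewrite c≡1 | lt-≥ {i = r} {k} (≤last k sj≡n) with next r ≟ k
...   | yes refl rewrite lt-refl (next r) = refl
...   | no nr≢k rewrite lt-< {i = next r} {k}
          (ℕₚ.≤∧≢⇒< (subst (ℕ._≤ toℕ k) (sym nj≡0) ℕ.z≤n) (nr≢k ∘ toℕ-injective)) = refl
lt-nextˡ r k | inner nr≡sr c≡0 rewrite c≡0 with next r ≟ k
...   | yes refl rewrite lt-refl (next r) | lt-< {i = r} {next r} (subst (toℕ r ℕ.<_) (sym nr≡sr) ℕₚ.≤-refl) = refl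
...   | no nr≢k with ℕₚ.<-cmp (toℕ (next r)) (toℕ k)
...     | tri< nr<k _ _ rewrite lt-< {i = next r} {k} nr<k
            | lt-< {i = r} {k} (ℕₚ.<-trans (subst (toℕ r ℕ.<_) (sym nr≡sr) ℕₚ.≤-refl) nr<k) = refl
...     | tri≈ _ nr≡k _ = contradiction (toℕ-injective nr≡k) nr≢k
...     | tri> _ _ k<nr rewrite lt-≥ {i = next r} {k} (ℕₚ.<⇒≤ k<nr)
            | lt-≥ {i = r} {k} (ℕₚ.≤-pred (subst (toℕ k ℕ.<_) nr≡sr k<nr)) = refl

Pt : ℕ → Set
Pt n = Fin n × ℤ

res : Pt n → Fin n
res = proj₁

shift : ℤ → Pt n → Pt n
shift l (r , q) = r , q + l

opaque
  -- For `(r , q)` read as the integer x = r + q n, this is floor((x - k) / n). So for x ≤ y the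
  -- difference `E y - E x` counts, residue by residue, the integers in the interval (x, y]; it is
  -- the sum of the simple roots met on the way from x to y.
  E : Pt n → Qaff n
  E (r , q) k = q - lt r k

  E-def : (x : Pt n) (k : Fin n) → E x k ≡ proj₂ x - lt (res x) k
  E-def x k = refl

  E-shift : (l : ℤ) (x : Pt n) (k : Fin n) → E (shift l x) k ≡ E x k + l
  E-shift l (r , q) k = lemma q l (lt r k)
    where
    lemma : ∀ q l a → q + l - a ≡ q - a + l
    lemma = solve-∀

succ : Pt n → Pt n
succ (r , q) = next r , q + carry r

opaque
  unfolding E

  E-succ : (x : Pt n) (k : Fin n) → E (succ x) k ≡ E x k + α (next (res x)) k
  E-succ (r , q) k = trans (lemma q (carry r) (lt r k) (lt (next r) k)) (cong (λ z → q - lt r k + z) (lt-nextˡ r k))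
    where
    lemma : ∀ q c a b → q + c - b ≡ q - a + (a - b + c)
    lemma = solve-∀

  -- Moving the cut one step loses exactly the points of residue `k`. After the last residue the
  -- next cut is 0 instead of n, and `carry` corrects for this.
  E-next : (x : Pt n) (k : Fin n) → E x k - E x (next k) ≡ α (res x) k - carry k
  E-next (r , q) k = trans (lemma q (lt r k) (lt r (next k))) (lt-nextʳ r k)
    where
    lemma : ∀ q a b → q - a - (q - b) ≡ b - a
    lemma = solve-∀

opaque
  -- φ x y is the floor of (y - x) / n when (r , q) stands for the integer r + q n.
  φ : Pt n → Pt n → ℤ
  φ x y = E y (res x) - E x (res x)

  φ-def : (x y : Pt n) → φ x y ≡ E y (res x) - E x (res x)
  φ-def x y = refl

opaque
  unfolding E φ

  -- Every residue class is met at least floor((y - x) / n) times between x and y. Thus `φ x y` is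
  -- the minimum of `E y k - E x k` over all cuts, attained at `k = res x`.
  φ≤ : (x y : Pt n) (k : Fin n) → φ x y ≤ E y k - E x k
  φ≤ (r , q) (r' , q') k = linear₁ (lt-triangle r' r k)
    (trans (cong (λ z → q' - lt r' k - (q - lt r k) - (q' - lt r' r - (q - z))) (lt-refl r))
           (lemma q q' (lt r' k) (lt r' r) (lt r k)))
    where
    lemma : ∀ q q' a b c → q' - a - (q - c) - (q' - b - (q - 0ℤ)) ≡ b + c - a
    lemma = solve-∀

opaque
  unfolding φ

  -- A minimum over cuts depends only on the difference `E y - E x`, hence `φ` of two images can be
  -- recovered from a linear map.
  φ-cong : {x y x' y' : Pt n} → (∀ k → E y k - E x k ≡ E y' k - E x' k) → φ x y ≡ φ x' y'
  φ-cong {x = x} {y} {x'} {y'} eq = ≤-antisym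
    (≤-trans (φ≤ x y (res x')) (≤-reflexive (eq (res x'))))
    (≤-trans (φ≤ x' y' (res x)) (≤-reflexive (sym (eq (res x)))))

opaque
  unfolding E φ

  -- floor(t) + floor(-t) is -1 unless t is an integer, and (y - x) / n is one only for equal
  -- residues.
  φ-antisym : {x y : Pt n} → res x ≢ res y → φ x y + φ y x ≡ -1ℤ
  φ-antisym {x = r , q} {r' , q'} r≢r' = trans
    (cong₂ (λ a b → (q' - lt r' r - (q - a)) + (q - lt r r' - (q' - b))) (lt-refl r) (lt-refl r'))
    (trans (lemma q q' (lt r' r) (lt r r')) (cong -_ (lt-trichotomy (r≢r'))))
    where
    lemma : ∀ q q' a b → (q' - a - (q - 0ℤ)) + (q - b - (q' - 0ℤ)) ≡ - (b + a)
    lemma = solve-∀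

opaque
  unfolding φ

  φ-shiftʳ : (l : ℤ) (x y : Pt n) → φ x (shift l y) ≡ φ x y + l
  φ-shiftʳ l x y = trans (cong (_- E x (res x)) (E-shift l y (res x))) (lemma (E y (res x)) l (E x (res x)))
    where
    lemma : ∀ a l b → a + l - b ≡ a - b + l
    lemma = solve-∀

  φ-shiftˡ : (l : ℤ) (x y : Pt n) → φ (shift l x) y ≡ φ x y - l
  φ-shiftˡ l x y = trans (cong (λ z → E y (res x) - z) (E-shift l x (res x))) (lemma (E y (res x)) l (E x (res x)))
    where
    lemma : ∀ a l b → a - (b + l) ≡ a - b - l
    lemma = solve-∀

opaque
  place : Pt n → ℤ
  place {n} (r , q) = + toℕ r + q * + n

infix 4 _≺_ _≼_

_≺_ _≼_ : Pt n → Pt n → Set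
x ≺ y = place x < place y
x ≼ y = place x ≤ place y

opaque
  unfolding place E φ

  place-shift : (l : ℤ) (x : Pt n) → place (shift l x) ≡ place x + l * + n
  place-shift {n} l (r , q) = lemma (+ toℕ r) q l (+ n)
    where
    lemma : ∀ r q l n → r + (q + l) * n ≡ r + q * n + l * n
    lemma = solve-∀

  place-succ : (x : Pt n) → place (succ x) ≡ 1ℤ + place x
  place-succ {n} (r , q) with nextView r
  ... | inner nr≡sr c≡0 rewrite c≡0 | nr≡sr = lemma (+ toℕ r) q (+ n)
    where
    lemma : ∀ r q n → 1ℤ + r + (q + 0ℤ) * n ≡ 1ℤ + (r + q * n)
    lemma = solve-∀
  ... | last sr≡n nr≡0 c≡1 rewrite c≡1 | nr≡0 = trans
    (cong (λ z → 0ℤ + (q + 1ℤ) * + z) (sym sr≡n))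
    (trans (lemma (+ toℕ r) q) (cong (λ z → 1ℤ + (+ toℕ r + q * + z)) sr≡n))
    where
    lemma : ∀ r q → 0ℤ + (q + 1ℤ) * (1ℤ + r) ≡ 1ℤ + (r + q * (1ℤ + r))
    lemma = solve-∀

cancel-summand : ∀ a b c → b - a ≡ (b + c) - (a + c)
cancel-summand = solve-∀

opaque
  unfolding place E φ

  ≼⇒φ : {x y : Pt n} → x ≼ y → 0ℤ ≤ φ x y
  ≼⇒φ {n} {r , q} {r' , q'} x≼y rewrite lt-refl r with <-cmp q q'
  ... | tri< q<q' _ _ = linear₂ (<⇒1+≤ q<q') (lt≤1 r' r) (lemma q q' (lt r' r))
    where
    lemma : ∀ q q' a → q' - a - (q - 0ℤ) - 0ℤ ≡ (q' - (1ℤ + q)) + (1ℤ - a)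
    lemma = solve-∀
  ... | tri≈ _ refl _ rewrite lt-≥ {i = r'} {r} (drop‿+≤+ (linear₁ x≼y (cancel-summand (+ toℕ r) (+ toℕ r') (q * + n)))) =
    ≤-reflexive (sym (+-inverseʳ (q - 0ℤ)))
  ... | tri> _ _ q'<q = contradiction x≼y (<⇒≱ (<-≤-trans
    (+-monoˡ-< (q' * + n) (+<+ (toℕ<n r')))
    (linear₂ (*-monoʳ-≤-nonNeg (+ n) (<⇒1+≤ q'<q)) (+≤+ (ℕ.z≤n {toℕ r}))
             (lemma (+ n) (+ toℕ r) q q'))))
    where
    lemma : ∀ n r q q' → (r + q * n) - (n + q' * n) ≡ (q * n - (1ℤ + q') * n) + (r - 0ℤ)
    lemma = solve-∀

E-mono : {x y : Pt n} → x ≼ y → ∀ k → E x k ≤ E y k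
E-mono {x = x} {y} x≼y k = linear₂ (≼⇒φ {x = x} {y} x≼y) (φ≤ x y k) (lemma (E x k) (E y k) (φ x y))
  where
  lemma : ∀ a b p → b - a ≡ (p - 0ℤ) + (b - a - p)
  lemma = solve-∀

opaque
  unfolding place E φ

  φ⇒≼ : {x y : Pt n} → 0ℤ ≤ φ x y → x ≼ y
  φ⇒≼ {n} {x@(r , q)} {y@(r' , q')} 0≤φ with ≤-total (place x) (place y)
  ... | inj₁ x≼y = x≼y
  ... | inj₂ y≼x with r ≟ r'
  ...   | no r≢r' = contradiction
    (+-mono-≤ 0≤φ (≼⇒φ {x = y} {x} y≼x))
    (λ 0≤-1 → case-neg (subst (0ℤ ≤_) (φ-antisym {x = x} {y} r≢r') 0≤-1))
    where
    case-neg : ¬ (0ℤ ≤ -1ℤ)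
    case-neg ()
  ...   | yes refl = +-monoʳ-≤ (+ toℕ r) (*-monoʳ-≤-nonNeg (+ n) {q} {q'} (linear₁ 0≤φ (lemma q q' (lt r r))))
    where
    lemma : ∀ q q' a → q' - q ≡ q' - a - (q - a) - 0ℤ
    lemma = solve-∀

opaque
  unfolding E φ

  place-injective : {x y : Pt n} → place x ≡ place y → x ≡ y
  place-injective {x = x@(r , q)} {y@(r' , q')} eq with r ≟ r'
  ... | no r≢r' = contradiction
    (subst (0ℤ ≤_) (φ-antisym {x = x} {y} r≢r')
      (+-mono-≤ (≼⇒φ {x = x} {y} (≤-reflexive eq)) (≼⇒φ {x = y} {x} (≤-reflexive (sym eq)))))
    λ ()
  ... | yes refl = cong (r ,_) (≤-antisym
    (linear₁ (≼⇒φ {x = x} {y} (≤-reflexive eq)) (lemma q q' (lt r r)))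
    (linear₁ (≼⇒φ {x = y} {x} (≤-reflexive (sym eq))) (lemma q' q (lt r r))))
    where
    lemma : ∀ q q' a → q' - q ≡ q' - a - (q - a) - 0ℤ
    lemma = solve-∀

≺⇒φ : {x y : Pt n} → res x ≢ res y → x ≺ y → φ y x < 0ℤ
≺⇒φ {x = x} {y} r≢r' x≺y = 1+≤⇒< (linear₁ (≼⇒φ {x = x} {y} (<⇒≤ x≺y))
  (trans (lemma (φ x y) (φ y x)) (trans (cong (λ z → φ x y - 0ℤ - (1ℤ + z)) (φ-antisym {x = x} {y} r≢r')) (+-identityʳ _))))
  where
  lemma : ∀ a b → 0ℤ - (1ℤ + b) ≡ a - 0ℤ - (1ℤ + (a + b))
  lemma = solve-∀

succ≼ : {x y : Pt n} → x ≺ y → succ x ≼ y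
succ≼ {x = x} {y} x≺y = subst (_≤ place y) (sym (place-succ x)) (<⇒1+≤ x≺y)

≺succ : (x : Pt n) → x ≺ succ x
≺succ x = subst (place x <_) (sym (place-succ x)) (1+≤⇒< ≤-refl)

shift-≺ : (l : ℤ) {x y : Pt n} → x ≺ y → shift l x ≺ shift l y
shift-≺ {n} l {x} {y} x≺y = subst₂ _<_ (sym (place-shift l x)) (sym (place-shift l y)) (+-monoˡ-< (l * + n) x≺y)

opaque
  unfolding place E φ

  place-window : (x : Pt n) → proj₂ x ≡ 0ℤ → place x ≡ + toℕ (res x)
  place-window _ refl = +-identityʳ _

-- The action of affine permutations

prev : Fin n → Fin n
prev {ℕ.suc m} zero    = Fin.fromℕ m
prev {ℕ.suc m} (suc i) = Fin.inject₁ i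

next-prev : (i : Fin n) → next (prev i) ≡ i
next-prev {ℕ.suc m} zero = toℕ-injective (trans (toℕ-next (Fin.fromℕ m))
  (trans (cong (λ t → ℕ.suc t ℕ.% ℕ.suc m) (Finₚ.toℕ-fromℕ m)) (n%n≡0 (ℕ.suc m))))
next-prev {ℕ.suc m} (suc i) = toℕ-injective (trans (toℕ-next (Fin.inject₁ i))
  (trans (cong (λ t → ℕ.suc t ℕ.% ℕ.suc m) (Finₚ.toℕ-inject₁ i)) (m<n⇒m%n≡m (ℕ.s≤s (toℕ<n i)))))

next-injective : {i j : Fin n} → next i ≡ next j → i ≡ j
next-injective {i = i} {j} eq with nextView i | nextView j
... | inner p _  | inner q _  = toℕ-injective (ℕₚ.suc-injective (trans (sym p) (trans (cong toℕ eq) q)))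
... | inner p _  | last _ q _ = contradiction (trans (sym p) (trans (cong toℕ eq) q)) λ ()
... | last _ p _ | inner q _  = contradiction (trans (sym q) (trans (cong toℕ (sym eq)) p)) λ ()
... | last p _ _ | last q _ _ = toℕ-injective (ℕₚ.suc-injective (trans p (sym q)))

prev-next : (i : Fin n) → prev (next i) ≡ i
prev-next i = next-injective (next-prev (next i))

next≢ : 3 ℕ.≤ n → (i : Fin n) → next i ≢ i
next≢ 3≤n i eq with nextView i
... | inner p _  = ℕₚ.1+n≢n (trans (sym p) (cong toℕ eq))
... | last p q _ = ℕₚ.<⇒≢ 3≤n′ (trans (cong ℕ.suc (trans (sym q) (cong toℕ eq))) p)
  where 3≤n′ = ℕₚ.≤-trans (ℕ.s≤s (ℕ.s≤s ℕ.z≤n)) 3≤n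

next²≢ : 3 ℕ.≤ n → (i : Fin n) → next (next i) ≢ i
next²≢ 3≤n i eq with nextView i | nextView (next i)
... | inner p _  | inner q _  = ℕₚ.m≢1+n+m (toℕ i) {1} (trans (sym (cong toℕ eq)) (trans q (cong ℕ.suc p)))
... | inner p _  | last q r _ = ℕₚ.<⇒≢ 3≤n
  (trans (cong (ℕ.suc ∘ ℕ.suc) (trans (sym r) (cong toℕ eq))) (trans (cong ℕ.suc (sym p)) q))
... | last p q _ | inner r _  = ℕₚ.<⇒≢ 3≤n (trans (cong ℕ.suc (trans (sym (trans r (cong ℕ.suc q))) (cong toℕ eq))) p)
... | last p q _ | last r _ _ = ℕₚ.<⇒≢ (ℕₚ.≤-trans (ℕ.s≤s (ℕ.s≤s ℕ.z≤n)) 3≤n) (trans (cong ℕ.suc (sym q)) r)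

cartan-α : 3 ℕ.≤ n → (i j : Fin n) → cartan i j ≡ + 2 * α i j - α (next i) j - α (next j) i
cartan-α 3≤n i j with i ≟ j
... | yes refl rewrite α-≢ (next≢ 3≤n i) = refl
... | no i≢j with next i ≟ j | next j ≟ i
...   | yes refl | yes eq = contradiction eq (next²≢ 3≤n i)
...   | yes _    | no _   = refl
...   | no _     | yes _  = refl
...   | no _     | no _   = refl

-- Coordinates of the image of `μ` under the map to the lattice of integer vectors that kills `c`
-- and sends each simple root to a difference of two unit vectors.
ε : Qaff n → Fin n → ℤ
ε μ j = μ j - μ (next j)

sum-next : (f : Fin n → ℤ) → sum (f ∘ next) ≡ sum f
sum-next f = sym (sum-permute f (permutation next prev next-prev prev-next))

-- The Cartan matrix is 2 on the diagonal minus the two cyclic shifts of the identity, and the two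
-- shifts are disjoint because n ≥ 3. After cyclic reindexing the double sum becomes the standard
-- dot product of the `ε` coordinates.
form-ε : 3 ℕ.≤ n → (μ ν : Qaff n) → ⟨ μ , ν ⟩ ≡ sum (λ r → ε μ r * ε ν r)
form-ε 3≤n μ ν = begin
  sum (λ i → sum (λ j → μ i * ν j * cartan i j))
    ≡⟨ sum-cong-≗ (λ i → row i) ⟩
  sum (λ i → μ i * ν i + μ i * ν i - μ i * ν (next i) - sum (λ j → μ i * ν j * α (next j) i))
    ≡⟨ sum-sub (λ i → μ i * ν i + μ i * ν i - μ i * ν (next i)) (λ i → sum (λ j → μ i * ν j * α (next j) i)) ⟩
  sum (λ i → μ i * ν i + μ i * ν i - μ i * ν (next i)) - sum (λ i → sum (λ j → μ i * ν j * α (next j) i))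
    ≡⟨ cong (λ z → sum (λ i → μ i * ν i + μ i * ν i - μ i * ν (next i)) - z)
         (trans (∑-comm (λ i j → μ i * ν j * α (next j) i)) (sum-cong-≗ (λ j → sum-α (λ i → μ i * ν j) (next j)))) ⟩
  sum (λ i → μ i * ν i + μ i * ν i - μ i * ν (next i)) - sum (λ i → μ (next i) * ν i)
    ≡⟨ sum-sub (λ i → μ i * ν i + μ i * ν i - μ i * ν (next i)) (λ i → μ (next i) * ν i) ⟨
  sum (λ i → μ i * ν i + μ i * ν i - μ i * ν (next i) - μ (next i) * ν i)
    ≡⟨ sum-cong-≗ (λ i → expand (μ i) (μ (next i)) (ν i) (ν (next i))) ⟩
  sum (λ i → ε μ i * ε ν i + (μ i * ν i - μ (next i) * ν (next i)))
    ≡⟨ ∑-distrib-+ (λ i → ε μ i * ε ν i) (λ i → μ i * ν i - μ (next i) * ν (next i)) ⟩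
  sum (λ i → ε μ i * ε ν i) + sum (λ i → μ i * ν i - μ (next i) * ν (next i))
    ≡⟨ cong (_+_ (sum (λ i → ε μ i * ε ν i)))
         (trans (sum-sub (λ i → μ i * ν i) (λ i → μ (next i) * ν (next i)))
           (trans (cong (λ z → sum (λ i → μ i * ν i) - z) (sum-next (λ i → μ i * ν i)))
             (+-inverseʳ (sum (λ i → μ i * ν i))))) ⟩
  sum (λ i → ε μ i * ε ν i) + 0ℤ
    ≡⟨ +-identityʳ _ ⟩
  sum (λ i → ε μ i * ε ν i) ∎
  where
  open ≡-Reasoning
  expand : ∀ a a' b b' → a * b + a * b - a * b' - a' * b ≡ (a - a') * (b - b') + (a * b - a' * b')
  expand = solve-∀
  distribute : ∀ p a b d → p * (+ 2 * a - b - d) ≡ p * a + p * a - p * b - p * d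
  distribute = solve-∀
  row : ∀ i → sum (λ j → μ i * ν j * cartan i j) ≡
        μ i * ν i + μ i * ν i - μ i * ν (next i) - sum (λ j → μ i * ν j * α (next j) i)
  row i = trans (sum-cong-≗ λ j → trans (cong (μ i * ν j *_) (cartan-α 3≤n i j)) (distribute (μ i * ν j) (α i j) (α (next i) j) (α (next j) i)))
    (trans (sum-sub (λ j → μ i * ν j * α i j + μ i * ν j * α i j - μ i * ν j * α (next i) j) (λ j → μ i * ν j * α (next j) i))
    (cong (_- sum (λ j → μ i * ν j * α (next j) i))
      (trans (sum-sub (λ j → μ i * ν j * α i j + μ i * ν j * α i j) (λ j → μ i * ν j * α (next i) j))
      (cong₂ _-_ (trans (∑-distrib-+ (λ j → μ i * ν j * α i j) (λ j → μ i * ν j * α i j))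
                   (cong₂ _+_ (sum-α (λ j → μ i * ν j) i) (sum-α (λ j → μ i * ν j) i)))
                 (sum-α (λ j → μ i * ν j) (next i))))))

ε-root : (a b : Pt n) (r : Fin n) → ε (E b ⊖ E a) r ≡ α (res b) r - α (res a) r
ε-root a b r = trans (regroup (E b r) (E a r) (E b (next r)) (E a (next r)))
  (trans (cong₂ _-_ (E-next b r) (E-next a r)) (cancel (α (res b) r) (α (res a) r) (carry r)))
  where
  regroup : ∀ b a b' a' → (b - a) - (b' - a') ≡ (b - b') - (a - a')
  regroup = solve-∀
  cancel : ∀ x y c → (x - c) - (y - c) ≡ x - y
  cancel = solve-∀

sum-root : (f : Fin n → ℤ) (a b : Pt n) → sum (λ r → f r * ε (E b ⊖ E a) r) ≡ f (res b) - f (res a)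
sum-root f a b = begin
  sum (λ r → f r * ε (E b ⊖ E a) r)
    ≡⟨ sum-cong-≗ (λ r → trans (cong (f r *_) (ε-root a b r)) (distribute (f r) (α (res b) r) (α (res a) r))) ⟩
  sum (λ r → f r * α (res b) r - f r * α (res a) r)
    ≡⟨ sum-sub (λ r → f r * α (res b) r) (λ r → f r * α (res a) r) ⟩
  sum (λ r → f r * α (res b) r) - sum (λ r → f r * α (res a) r)
    ≡⟨ cong₂ _-_ (sum-α f (res b)) (sum-α f (res a)) ⟩
  f (res b) - f (res a) ∎
  where
  open ≡-Reasoning
  distribute : ∀ f x y → f * (x - y) ≡ f * x - f * y
  distribute = solve-∀

form-cong : {μ μ' ν ν' : Qaff n} → μ ≗ μ' → ν ≗ ν' → ⟨ μ , ν ⟩ ≡ ⟨ μ' , ν' ⟩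
form-cong μ≗μ' ν≗ν' = sum-cong-≗ λ i → sum-cong-≗ λ j → cong₂ (λ a b → a * b * cartan i j) (μ≗μ' i) (ν≗ν' j)

t-cong : {β β' : Qaff n} → β ≗ β' → {μ μ' : Qaff n} → μ ≗ μ' → t β μ ≗ t β' μ'
t-cong β≗β' μ≗μ' k = cong₂ _-_ (μ≗μ' k) (cong (_* 1ℤ) (form-cong β≗β' μ≗μ'))

base : Fin n → Pt n
base r = r , 0ℤ

-- A bijection commuting with translation by n. The usual condition on the total displacement is
-- kept apart, as `Balanced`.
record Affine {n : ℕ} (f : Pt n → Pt n) : Set where
  field
    f⁻¹       : Pt n → Pt n
    f-shift   : ∀ l x → f (shift l x) ≡ shift l (f x)
    f⁻¹-shift : ∀ l x → f⁻¹ (shift l x) ≡ shift l (f⁻¹ x)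
    f-f⁻¹     : ∀ x → f (f⁻¹ x) ≡ x
    f⁻¹-f     : ∀ x → f⁻¹ (f x) ≡ x

  f-injective : ∀ {x y} → f x ≡ f y → x ≡ y
  f-injective {x} {y} eq = trans (sym (f⁻¹-f x)) (trans (cong f⁻¹ eq) (f⁻¹-f y))

opaque
  -- The linear map sending E y - E x to E (f y) - E (f x).
  act : (Pt n → Pt n) → Map n
  act f μ k = μ k + sum (λ r → ε μ r * (E (f (base r)) k - E (base r) k))

  act-cong : {f g : Pt n → Pt n} → (∀ r → f (base r) ≡ g (base r)) → act f ≈ act g
  act-cong f≡g μ k = cong (_+_ (μ k)) (sum-cong-≗ λ r → cong (λ x → ε μ r * (E x k - E (base r) k)) (f≡g r))

  act-≗ : (f : Pt n → Pt n) {μ ν : Qaff n} → μ ≗ ν → act f μ ≗ act f ν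
  act-≗ f μ≗ν k = cong₂ _+_ (μ≗ν k) (sum-cong-≗ λ r →
    cong (_* (E (f (base r)) k - E (base r) k)) (cong₂ _-_ (μ≗ν r) (μ≗ν (next r))))

  act-id : act {n} id ≈ id
  act-id μ k = trans (cong (_+_ (μ k)) (sum-zero _ λ r → trans (cong (ε μ r *_) (+-inverseʳ (E (base r) k))) (*-zeroʳ (ε μ r)))) (+-identityʳ (μ k))

  shift-base : (x : Pt n) → shift (proj₂ x) (base (res x)) ≡ x
  shift-base (r , q) = cong (r ,_) (+-identityˡ q)

  displacement-shift : {f : Pt n → Pt n} → Affine f → ∀ x k →
    E (f (base (res x))) k - E (base (res x)) k ≡ E (f x) k - E x k
  displacement-shift {f = f} F x@(r , q) k = begin
    E (f (base r)) k - E (base r) k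
      ≡⟨ cancel (E (f (base r)) k) (E (base r) k) q ⟩
    (E (f (base r)) k + q) - (E (base r) k + q)
      ≡⟨ cong₂ _-_ (E-shift q (f (base r)) k) (E-shift q (base r) k) ⟨
    E (shift q (f (base r))) k - E (shift q (base r)) k
      ≡⟨ cong₂ (λ y z → E y k - E z k) (trans (sym (Affine.f-shift F q (base r))) (cong f (shift-base x))) (shift-base x) ⟩
    E (f x) k - E x k ∎
    where
    open ≡-Reasoning
    cancel : ∀ a b q → a - b ≡ (a + q) - (b + q)
    cancel = solve-∀

  -- In `ε` coordinates only the action of `g` on residues survives: the `carry` terms of image and
  -- source cancel.
  ε-act : (g : Pt n → Pt n) (μ : Qaff n) (j : Fin n) →
          ε (act g μ) j ≡ sum (λ r → ε μ r * α (res (g (base r))) j)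
  ε-act {n} g μ j = begin
    μ j + sum (λ r → ε μ r * D r j) - (μ (next j) + sum (λ r → ε μ r * D r (next j)))
      ≡⟨ regroup (μ j) (sum (λ r → ε μ r * D r j)) (μ (next j)) (sum (λ r → ε μ r * D r (next j))) ⟩
    ε μ j + (sum (λ r → ε μ r * D r j) - sum (λ r → ε μ r * D r (next j)))
      ≡⟨ cong₂ _+_ (sum-α (ε μ) j) (sum-sub (λ r → ε μ r * D r j) (λ r → ε μ r * D r (next j))) ⟨
    sum (λ r → ε μ r * α j r) + sum (λ r → ε μ r * D r j - ε μ r * D r (next j))
      ≡⟨ ∑-distrib-+ (λ r → ε μ r * α j r) (λ r → ε μ r * D r j - ε μ r * D r (next j)) ⟨
    sum (λ r → ε μ r * α j r + (ε μ r * D r j - ε μ r * D r (next j)))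
      ≡⟨ sum-cong-≗ pointwise ⟩
    sum (λ r → ε μ r * α (res (g (base r))) j) ∎
    where
    open ≡-Reasoning
    D : Fin n → Fin n → ℤ
    D r k = E (g (base r)) k - E (base r) k
    regroup : ∀ a x b y → a + x - (b + y) ≡ (a - b) + (x - y)
    regroup = solve-∀
    collect : ∀ e a x y x' y' → e * a + (e * (x - y) - e * (x' - y')) ≡ e * a + e * ((x - x') - (y - y'))
    collect = solve-∀
    cancel : ∀ e a b c → e * a + e * ((b - c) - (a - c)) ≡ e * b
    cancel = solve-∀
    pointwise : ∀ r → ε μ r * α j r + (ε μ r * D r j - ε μ r * D r (next j)) ≡ ε μ r * α (res (g (base r))) j
    pointwise r = trans (collect (ε μ r) (α j r) (E (g (base r)) j) (E (base r) j) (E (g (base r)) (next j)) (E (base r) (next j)))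
      (trans (cong₂ (λ x y → ε μ r * x + ε μ r * y) (α-sym j r) (cong₂ _-_ (E-next (g (base r)) j) (E-next (base r) j)))
        (cancel (ε μ r) (α r j) (α (res (g (base r))) j) (carry j)))

  -- Only the outer map has to commute with shifts: its displacement at `g (base s)` is replaced by
  -- the one at the representative of the same residue.
  act-∘ : {f : Pt n → Pt n} → Affine f → (g : Pt n → Pt n) → act f ∘ act g ≈ act (f ∘ g)
  act-∘ {n} {f = f} F g μ k = begin
    act g μ k + sum (λ r → ε (act g μ) r * D f r)
      ≡⟨ cong (_+_ (act g μ k)) (sum-cong-≗ λ r → trans (cong (_* D f r) (ε-act g μ r)) (*-distribʳ-sum (D f r) (λ s → ε μ s * α (res (g (base s))) r))) ⟩
    act g μ k + sum (λ r → sum (λ s → ε μ s * α (res (g (base s))) r * D f r))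
      ≡⟨ cong (_+_ (act g μ k)) (trans (∑-comm (λ r s → ε μ s * α (res (g (base s))) r * D f r)) (sum-cong-≗ λ s →
           trans (sum-cong-≗ λ r → rearrange (ε μ s) (α (res (g (base s))) r) (D f r))
                 (sum-α (λ r → ε μ s * D f r) (res (g (base s)))))) ⟩
    act g μ k + sum (λ s → ε μ s * D f (res (g (base s))))
      ≡⟨ +-assoc (μ k) _ _ ⟩
    μ k + (sum (λ s → ε μ s * D g s) + sum (λ s → ε μ s * D f (res (g (base s)))))
      ≡⟨ cong (_+_ (μ k)) (trans (sym (∑-distrib-+ (λ s → ε μ s * D g s) (λ s → ε μ s * D f (res (g (base s))))))
           (sum-cong-≗ λ s → trans (cong (λ z → ε μ s * D g s + ε μ s * z) (displacement-shift F (g (base s)) k))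
             (telescope (ε μ s) (E (g (base s)) k) (E (base s) k) (E (f (g (base s))) k)))) ⟩
    act (f ∘ g) μ k ∎
    where
    open ≡-Reasoning
    D : (Pt n → Pt n) → Fin n → ℤ
    D h r = E (h (base r)) k - E (base r) k
    rearrange : ∀ e a d → e * a * d ≡ e * d * a
    rearrange = solve-∀
    telescope : ∀ e y x z → e * (y - x) + e * (z - y) ≡ e * (z - x)
    telescope = solve-∀

  act-root : {f : Pt n → Pt n} → Affine f → ∀ a b → act f (E b ⊖ E a) ≗ E (f b) ⊖ E (f a)
  act-root {n} {f = f} F a b k = begin
    E b k - E a k + sum (λ r → ε (E b ⊖ E a) r * D r)
      ≡⟨ cong (_+_ (E b k - E a k)) (trans (sum-cong-≗ λ r → *-comm (ε (E b ⊖ E a) r) (D r)) (sum-root D a b)) ⟩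
    E b k - E a k + (D (res b) - D (res a))
      ≡⟨ cong (_+_ (E b k - E a k)) (cong₂ _-_ (displacement-shift F b k) (displacement-shift F a k)) ⟩
    E b k - E a k + ((E (f b) k - E b k) - (E (f a) k - E a k))
      ≡⟨ cancel (E b k) (E a k) (E (f b) k) (E (f a) k) ⟩
    E (f b) k - E (f a) k ∎
    where
    open ≡-Reasoning
    D : Fin n → ℤ
    D r = E (f (base r)) k - E (base r) k
    cancel : ∀ b a fb fa → b - a + ((fb - b) - (fa - a)) ≡ fb - fa
    cancel = solve-∀

opaque
  -- The affine transposition exchanging a + l n with b + l n for all l at once; the offset of `x`
  -- within its class selects the translate.
  swap : Pt n → Pt n → Pt n → Pt n
  swap a b x with res x ≟ res a | res x ≟ res b
  ... | yes _ | _     = shift (proj₂ x - proj₂ a) b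
  ... | no _  | yes _ = shift (proj₂ x - proj₂ b) a
  ... | no _  | no _  = x

  swap-source : (a b : Pt n) → ∀ {x} → res x ≡ res a → swap a b x ≡ shift (proj₂ x - proj₂ a) b
  swap-source a b {x} x≡a with res x ≟ res a
  ... | yes _  = refl
  ... | no x≢a = contradiction x≡a x≢a

  swap-target : {a b : Pt n} → res a ≢ res b → ∀ {x} → res x ≡ res b → swap a b x ≡ shift (proj₂ x - proj₂ b) a
  swap-target {a = a} {b} a≢b {x} x≡b with res x ≟ res a | res x ≟ res b
  ... | yes x≡a | _      = contradiction (trans (sym x≡a) x≡b) a≢b
  ... | no _    | yes _  = refl
  ... | no _    | no x≢b = contradiction x≡b x≢b

  swap-fixed : (a b : Pt n) → ∀ {x} → res x ≢ res a → res x ≢ res b → swap a b x ≡ x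
  swap-fixed a b {x} x≢a x≢b with res x ≟ res a | res x ≟ res b
  ... | yes x≡a | _       = contradiction x≡a x≢a
  ... | no _    | yes x≡b = contradiction x≡b x≢b
  ... | no _    | no _    = refl

E-swap : {a b : Pt n} → res a ≢ res b → ∀ x k →
         E (swap a b x) k ≡ E x k + (α (res a) (res x) - α (res b) (res x)) * (E b k - E a k)
E-swap {a = a} {b} a≢b x k with res x ≟ res a | res x ≟ res b
... | yes x≡a  | yes x≡b = contradiction (trans (sym x≡a) x≡b) a≢b
... | yes x≡a  | no x≢b   = begin
  E (swap a b x) k
    ≡⟨ trans (cong (λ y → E y k) (swap-source a b x≡a)) (E-shift (proj₂ x - proj₂ a) b k) ⟩
  E b k + (proj₂ x - proj₂ a)
    ≡⟨ lemma (E b k) (proj₂ x) (proj₂ a) (lt (res a) k) ⟩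
  proj₂ x - lt (res a) k + (1ℤ - 0ℤ) * (E b k - (proj₂ a - lt (res a) k))
    ≡⟨ cong₂ (λ u v → u + (1ℤ - 0ℤ) * (E b k - v)) (trans (cong (λ r → proj₂ x - lt r k) (sym x≡a)) (sym (E-def x k))) (sym (E-def a k)) ⟩
  E x k + (1ℤ - 0ℤ) * (E b k - E a k)
    ≡⟨ cong₂ (λ u v → E x k + (u - v) * (E b k - E a k)) (sym (trans (cong (α (res a)) x≡a) (α-refl (res a)))) (sym (α-≢ (x≢b ∘ sym))) ⟩
  E x k + (α (res a) (res x) - α (res b) (res x)) * (E b k - E a k) ∎
  where
  open ≡-Reasoning
  lemma : ∀ e x a l → e + (x - a) ≡ x - l + (1ℤ - 0ℤ) * (e - (a - l))
  lemma = solve-∀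
... | no x≢a   | yes x≡b = begin
  E (swap a b x) k
    ≡⟨ trans (cong (λ y → E y k) (swap-target a≢b x≡b)) (E-shift (proj₂ x - proj₂ b) a k) ⟩
  E a k + (proj₂ x - proj₂ b)
    ≡⟨ lemma (E a k) (proj₂ x) (proj₂ b) (lt (res b) k) ⟩
  proj₂ x - lt (res b) k + (0ℤ - 1ℤ) * (proj₂ b - lt (res b) k - E a k)
    ≡⟨ cong₂ (λ u v → u + (0ℤ - 1ℤ) * (v - E a k)) (trans (cong (λ r → proj₂ x - lt r k) (sym x≡b)) (sym (E-def x k))) (sym (E-def b k)) ⟩
  E x k + (0ℤ - 1ℤ) * (E b k - E a k)
    ≡⟨ cong₂ (λ u v → E x k + (u - v) * (E b k - E a k)) (sym (α-≢ (x≢a ∘ sym))) (sym (trans (cong (α (res b)) x≡b) (α-refl (res b)))) ⟩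
  E x k + (α (res a) (res x) - α (res b) (res x)) * (E b k - E a k) ∎
  where
  open ≡-Reasoning
  lemma : ∀ e x b l → e + (x - b) ≡ x - l + (0ℤ - 1ℤ) * (b - l - e)
  lemma = solve-∀
... | no x≢a   | no x≢b   = begin
  E (swap a b x) k                      ≡⟨ cong (λ y → E y k) (swap-fixed a b x≢a x≢b) ⟩
  E x k                                 ≡⟨ +-identityʳ (E x k) ⟨
  E x k + (0ℤ - 0ℤ) * (E b k - E a k)   ≡⟨ cong₂ (λ u v → E x k + (u - v) * (E b k - E a k)) (sym (α-≢ (x≢a ∘ sym))) (sym (α-≢ (x≢b ∘ sym))) ⟩
  E x k + (α (res a) (res x) - α (res b) (res x)) * (E b k - E a k) ∎
  where open ≡-Reasoning

opaque
  unfolding act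

  -- By `sum-root`, pairing with `E b - E a` reads off the difference of two `ε` coordinates, and by
  -- `E-swap` the transposition displaces exactly these two classes, by plus and minus `E b - E a`.
  s-act : 3 ℕ.≤ n → {a b : Pt n} → res a ≢ res b → {β : Qaff n} → β ≗ E b ⊖ E a → s β ≈ act (swap a b)
  s-act 3≤n {a} {b} a≢b {β} β≗ μ k = begin
    μ k - ⟨ μ , β ⟩ * β k
      ≡⟨ cong₂ (λ x y → μ k - x * y) (trans (form-cong {μ = μ} {μ} (λ _ → refl) β≗) (form-ε 3≤n μ (E b ⊖ E a))) (β≗ k) ⟩
    μ k - sum (λ r → ε μ r * ε (E b ⊖ E a) r) * (E b k - E a k)
      ≡⟨ cong (λ z → μ k - z * (E b k - E a k)) (sum-root (ε μ) a b) ⟩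
    μ k - (ε μ (res b) - ε μ (res a)) * (E b k - E a k)
      ≡⟨ flip-sign (μ k) (ε μ (res b)) (ε μ (res a)) (E b k - E a k) ⟩
    μ k + (ε μ (res a) - ε μ (res b)) * (E b k - E a k)
      ≡⟨ cong (λ z → μ k + z * (E b k - E a k)) (sym (sum-root (ε μ) b a)) ⟩
    μ k + sum (λ r → ε μ r * ε (E a ⊖ E b) r) * (E b k - E a k)
      ≡⟨ cong (_+_ (μ k)) (trans (*-distribʳ-sum (E b k - E a k) (λ r → ε μ r * ε (E a ⊖ E b) r)) (sum-cong-≗ pointwise)) ⟩
    act (swap a b) μ k ∎
    where
    open ≡-Reasoning
    flip-sign : ∀ m x y d → m - (x - y) * d ≡ m + (y - x) * d
    flip-sign = solve-∀
    cancel : ∀ x y → x + y - x ≡ y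
    cancel = solve-∀
    pointwise : ∀ r → ε μ r * ε (E a ⊖ E b) r * (E b k - E a k) ≡ ε μ r * (E (swap a b (base r)) k - E (base r) k)
    pointwise r = trans (*-assoc (ε μ r) _ _) (cong (ε μ r *_) (trans (cong (_* (E b k - E a k)) (ε-root b a r))
      (sym (trans (cong (_- E (base r) k) (E-swap a≢b (base r) k)) (cancel (E (base r) k) _)))))

-- Reflections, words and roots

shift-between : (x y : Pt n) → res x ≡ res y → shift (proj₂ x - proj₂ y) y ≡ x
shift-between (r , q) (_ , q') refl = cong (r ,_) (lemma q q')
  where
  lemma : ∀ q q' → q' + (q - q') ≡ q
  lemma = solve-∀

shift-shift : (k l : ℤ) (x : Pt n) → shift k (shift l x) ≡ shift (l + k) x
shift-shift k l (r , q) = cong (r ,_) (+-assoc q l k)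

shift-zero : (x : Pt n) → shift 0ℤ x ≡ x
shift-zero (r , q) = cong (r ,_) (+-identityʳ q)

swap-a : (a b : Pt n) → swap a b a ≡ b
swap-a a b = trans (swap-source a b refl) (trans (cong (λ l → shift l b) (+-inverseʳ (proj₂ a))) (shift-zero b))

swap-b : {a b : Pt n} → res a ≢ res b → swap a b b ≡ a
swap-b {a = a} {b} a≢b = trans (swap-target a≢b refl) (trans (cong (λ l → shift l a) (+-inverseʳ (proj₂ b))) (shift-zero a))

swap-shift : {a b : Pt n} → res a ≢ res b → ∀ l x → swap a b (shift l x) ≡ shift l (swap a b x)
swap-shift {a = a} {b} a≢b l x = by-cases (res x ≟ res a) (res x ≟ res b)
  where
  lemma : ∀ x l a → x + l - a ≡ x - a + l
  lemma = solve-∀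
  by-cases : Dec (res x ≡ res a) → Dec (res x ≡ res b) → swap a b (shift l x) ≡ shift l (swap a b x)
  by-cases (yes x≡a) _ = trans (swap-source a b x≡a) (trans (cong (λ k → shift k b) (lemma (proj₂ x) l (proj₂ a)))
    (trans (sym (shift-shift l (proj₂ x - proj₂ a) b)) (cong (shift l) (sym (swap-source a b x≡a)))))
  by-cases (no _) (yes x≡b) = trans (swap-target a≢b x≡b) (trans (cong (λ k → shift k a) (lemma (proj₂ x) l (proj₂ b)))
    (trans (sym (shift-shift l (proj₂ x - proj₂ b) a)) (cong (shift l) (sym (swap-target a≢b x≡b)))))
  by-cases (no x≢a) (no x≢b) = trans (swap-fixed a b x≢a x≢b) (cong (shift l) (sym (swap-fixed a b x≢a x≢b)))

swap-involutive : {a b : Pt n} → res a ≢ res b → ∀ x → swap a b (swap a b x) ≡ x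
swap-involutive {a = a} {b} a≢b x = by-cases (res x ≟ res a) (res x ≟ res b)
  where
  by-cases : Dec (res x ≡ res a) → Dec (res x ≡ res b) → swap a b (swap a b x) ≡ x
  by-cases (yes x≡a) _ = trans (cong (swap a b) (swap-source a b x≡a))
    (trans (swap-shift a≢b _ b) (trans (cong (shift _) (swap-b a≢b)) (shift-between x a x≡a)))
  by-cases (no _) (yes x≡b) = trans (cong (swap a b) (swap-target a≢b x≡b))
    (trans (swap-shift a≢b _ a) (trans (cong (shift _) (swap-a a b)) (shift-between x b x≡b)))
  by-cases (no x≢a) (no x≢b) = trans (cong (swap a b) (swap-fixed a b x≢a x≢b)) (swap-fixed a b x≢a x≢b)

affine-swap : {a b : Pt n} → res a ≢ res b → Affine (swap a b)
affine-swap {a = a} {b} a≢b = record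
  { f⁻¹       = swap a b
  ; f-shift   = swap-shift a≢b
  ; f⁻¹-shift = swap-shift a≢b
  ; f-f⁻¹     = swap-involutive a≢b
  ; f⁻¹-f     = swap-involutive a≢b
  }

affine-id : Affine {n} id
affine-id = record
  { f⁻¹       = id
  ; f-shift   = λ _ _ → refl
  ; f⁻¹-shift = λ _ _ → refl
  ; f-f⁻¹     = λ _ → refl
  ; f⁻¹-f     = λ _ → refl
  }

affine-∘ : {f g : Pt n → Pt n} → Affine f → Affine g → Affine (f ∘ g)
affine-∘ {f = f} {g} F G = record
  { f⁻¹       = G.f⁻¹ ∘ F.f⁻¹
  ; f-shift   = λ l x → trans (cong f (G.f-shift l x)) (F.f-shift l (g x))
  ; f⁻¹-shift = λ l x → trans (cong G.f⁻¹ (F.f⁻¹-shift l x)) (G.f⁻¹-shift l (F.f⁻¹ x))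
  ; f-f⁻¹     = λ x → trans (cong f (G.f-f⁻¹ (F.f⁻¹ x))) (F.f-f⁻¹ x)
  ; f⁻¹-f     = λ x → trans (cong G.f⁻¹ (F.f⁻¹-f (g x))) (G.f⁻¹-f x)
  }
  where
  module F = Affine F
  module G = Affine G

affine-inverse : {f : Pt n → Pt n} (F : Affine f) → Affine (Affine.f⁻¹ F)
affine-inverse {f = f} F = record
  { f⁻¹       = f
  ; f-shift   = Affine.f⁻¹-shift F
  ; f⁻¹-shift = Affine.f-shift F
  ; f-f⁻¹     = Affine.f⁻¹-f F
  ; f⁻¹-f     = Affine.f-f⁻¹ F
  }

f-shift-between : {f : Pt n → Pt n} → Affine f → ∀ {x y} → res x ≡ res y →
                  f x ≡ shift (proj₂ x - proj₂ y) (f y)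
f-shift-between {f = f} F {x} {y} x≡y = trans (cong f (sym (shift-between x y x≡y))) (Affine.f-shift F _ y)

res-cong : {f : Pt n → Pt n} → Affine f → ∀ {x y} → res x ≡ res y → res (f x) ≡ res (f y)
res-cong F x≡y = cong res (f-shift-between F x≡y)

res-injective : {f : Pt n → Pt n} → Affine f → ∀ {x y} → res (f x) ≡ res (f y) → res x ≡ res y
res-injective F {x} {y} eq = subst₂ (λ u v → res u ≡ res v) (Affine.f⁻¹-f F x) (Affine.f⁻¹-f F y)
  (res-cong (affine-inverse F) eq)

-- Turns an indicator of the image residue into one of the source residue, so that `sum-α` can
-- evaluate sums over image residues.
α-inverse : {f : Pt n → Pt n} (F : Affine f) → ∀ p r → α (res p) (res (f (base r))) ≡ α (res (Affine.f⁻¹ F p)) r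
α-inverse {f = f} F p r = by-cases (res p ≟ res (f (base r))) (res (f⁻¹ p) ≟ r)
  where
  open Affine F
  by-cases : Dec (res p ≡ res (f (base r))) → Dec (res (f⁻¹ p) ≡ r) → α (res p) (res (f (base r))) ≡ α (res (f⁻¹ p)) r
  by-cases (yes eq) _        = trans (trans (cong (α (res p)) (sym eq)) (α-refl (res p)))
    (sym (trans (cong (α (res (f⁻¹ p))) (sym (trans (res-cong (affine-inverse F) eq) (cong res (f⁻¹-f (base r)))))) (α-refl (res (f⁻¹ p)))))
  by-cases (no neq) (yes eq) = contradiction (trans (cong res (sym (f-f⁻¹ p))) (res-cong F {f⁻¹ p} {base r} eq)) neq
  by-cases (no neq) (no neq') = trans (α-≢ neq) (sym (α-≢ neq'))

f-swap : {f : Pt n → Pt n} → Affine f → {a b : Pt n} → res a ≢ res b → ∀ x →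
         f (swap a b x) ≡ swap (f a) (f b) (f x)
f-swap {f = f} F {a} {b} a≢b x = by-cases (res x ≟ res a) (res x ≟ res b)
  where
  shifts : ∀ {y} → res x ≡ res y → proj₂ x - proj₂ y ≡ proj₂ (f x) - proj₂ (f y)
  shifts {y} x≡y = trans (lemma (proj₂ (f y)) (proj₂ x - proj₂ y))
                     (cong (_- proj₂ (f y)) (sym (cong proj₂ (f-shift-between F x≡y))))
    where
    lemma : ∀ a d → d ≡ a + d - a
    lemma = solve-∀
  by-cases : Dec (res x ≡ res a) → Dec (res x ≡ res b) → f (swap a b x) ≡ swap (f a) (f b) (f x)
  by-cases (yes x≡a) _ = trans (cong f (swap-source a b x≡a)) (trans (Affine.f-shift F _ b)
    (trans (cong (λ l → shift l (f b)) (shifts x≡a)) (sym (swap-source (f a) (f b) (res-cong F x≡a)))))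
  by-cases (no _) (yes x≡b) = trans (cong f (swap-target a≢b x≡b)) (trans (Affine.f-shift F _ a)
    (trans (cong (λ l → shift l (f a)) (shifts x≡b)) (sym (swap-target (a≢b ∘ res-injective F) (res-cong F x≡b)))))
  by-cases (no x≢a) (no x≢b) = trans (cong f (swap-fixed a b x≢a x≢b))
    (sym (swap-fixed (f a) (f b) (x≢a ∘ res-injective F) (x≢b ∘ res-injective F)))

swap-shifted : (l : ℤ) {a b : Pt n} → res a ≢ res b → ∀ x → swap (shift l a) (shift l b) x ≡ swap a b x
swap-shifted l {a} {b} a≢b x = by-cases (res x ≟ res a) (res x ≟ res b)
  where
  lemma : ∀ x a l → l + (x - (a + l)) ≡ x - a
  lemma = solve-∀
  by-cases : Dec (res x ≡ res a) → Dec (res x ≡ res b) → swap (shift l a) (shift l b) x ≡ swap a b x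
  by-cases (yes x≡a) _ = trans (swap-source (shift l a) (shift l b) x≡a) (trans (shift-shift _ l b)
    (trans (cong (λ k → shift k b) (lemma (proj₂ x) (proj₂ a) l)) (sym (swap-source a b x≡a))))
  by-cases (no _) (yes x≡b) = trans (swap-target {a = shift l a} {shift l b} a≢b x≡b) (trans (shift-shift _ l a)
    (trans (cong (λ k → shift k a) (lemma (proj₂ x) (proj₂ b) l)) (sym (swap-target a≢b x≡b))))
  by-cases (no x≢a) (no x≢b) = trans (swap-fixed (shift l a) (shift l b) x≢a x≢b) (sym (swap-fixed a b x≢a x≢b))

-- The adjacent integers whose difference is αᵢ: these are i - 1 and i, except for i = 0, where they
-- are n - 1 and n. So α₀ alone leaves the window [0, n).
lo hi : Fin n → Pt n
lo i = base (prev i)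
hi i = succ (lo i)

res-hi : (i : Fin n) → res (hi i) ≡ i
res-hi = next-prev

τ : Fin n → Pt n → Pt n
τ i = swap (lo i) (hi i)

α-root : (i : Fin n) → α i ≗ E (hi i) ⊖ E (lo i)
α-root i k = trans (cong (λ j → α j k) (sym (next-prev i)))
  (trans (lemma (E (lo i) k) (α (next (prev i)) k)) (cong (_- E (lo i) k) (sym (E-succ (lo i) k))))
  where
  lemma : ∀ e a → a ≡ e + a - e
  lemma = solve-∀

perm : List (Fin n) → Pt n → Pt n
perm []      = id
perm (i ∷ w) = τ i ∘ perm w

perm-++ : (v w : List (Fin n)) → perm (v ++ w) ≗ perm v ∘ perm w
perm-++ []      w x = refl
perm-++ (i ∷ v) w x = cong (τ i) (perm-++ v w x)

carry-finite : (i : Fin n) → Finite i → carry (prev i) ≡ 0ℤ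
carry-finite i i≢0 with nextView (prev i)
... | inner _ c≡0 = c≡0
... | last _ p _  = contradiction (trans (cong toℕ (sym (next-prev i))) p) i≢0

record FiniteRoot {n : ℕ} (γ : Qaff n) : Set where
  field
    source target : Fin n
    source≢target : source ≢ target
    root          : γ ≗ E (base target) ⊖ E (base source)

module _ (3≤n : 3 ℕ.≤ n) where

  lo≢hi : (i : Fin n) → res (lo i) ≢ res (hi i)
  lo≢hi i = next≢ 3≤n (prev i) ∘ sym

  -- Only s₀ moves points across a multiple of n; the generators of the finite Weyl group preserve
  -- every window.
  τ-finite : (i : Fin n) → Finite i → ∀ x → proj₂ (τ i x) ≡ proj₂ x
  τ-finite i i≢0 x = by-cases (res x ≟ res (lo i)) (res x ≟ res (hi i))
    where
    by-cases : Dec (res x ≡ res (lo i)) → Dec (res x ≡ res (hi i)) → proj₂ (τ i x) ≡ proj₂ x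
    by-cases (yes x≡lo) _ = trans (cong proj₂ (swap-source (lo i) (hi i) x≡lo))
      (trans (cong (λ c → 0ℤ + c + (proj₂ x - 0ℤ)) (carry-finite i i≢0)) (lemma (proj₂ x)))
      where
      lemma : ∀ q → 0ℤ + 0ℤ + (q - 0ℤ) ≡ q
      lemma = solve-∀
    by-cases (no _) (yes x≡hi) = trans (cong proj₂ (swap-target (lo≢hi i) x≡hi))
      (trans (cong (λ c → 0ℤ + (proj₂ x - (0ℤ + c))) (carry-finite i i≢0)) (lemma (proj₂ x)))
      where
      lemma : ∀ q → 0ℤ + (q - (0ℤ + 0ℤ)) ≡ q
      lemma = solve-∀
    by-cases (no x≢lo) (no x≢hi) = cong proj₂ (swap-fixed (lo i) (hi i) x≢lo x≢hi)

  perm-finite : {w : List (Fin n)} → All Finite w → ∀ x → proj₂ (perm w x) ≡ proj₂ x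
  perm-finite []        x = refl
  perm-finite {w = i ∷ w} (p ∷ ps) x = trans (τ-finite i p (perm w x)) (perm-finite ps x)

  affine-perm : (w : List (Fin n)) → Affine (perm w)
  affine-perm []      = affine-id
  affine-perm (i ∷ w) = affine-∘ (affine-swap (lo≢hi i)) (affine-perm w)

  word-act : (w : List (Fin n)) → word w ≈ act (perm w)
  word-act []      μ k = sym (act-id μ k)
  word-act (i ∷ w) μ k = trans (s-act 3≤n (lo≢hi i) (α-root i) (word w μ) k)
    (trans (act-≗ (τ i) (word-act w μ) k) (act-∘ (affine-swap (lo≢hi i)) (perm w) μ k))

  perm-reverse : (w : List (Fin n)) → ∀ x → perm w (perm (reverse w) x) ≡ x
  perm-reverse []      x = refl
  perm-reverse (i ∷ w) x = begin
    τ i (perm w (perm (reverse (i ∷ w)) x))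
      ≡⟨ cong (λ v → τ i (perm w (perm v x))) (unfold-reverse i w) ⟩
    τ i (perm w (perm (reverse w ++ [ i ]) x))
      ≡⟨ cong (τ i ∘ perm w) (perm-++ (reverse w) [ i ] x) ⟩
    τ i (perm w (perm (reverse w) (τ i x)))
      ≡⟨ cong (τ i) (perm-reverse w (τ i x)) ⟩
    τ i (τ i x)
      ≡⟨ swap-involutive (lo≢hi i) x ⟩
    x ∎
    where open ≡-Reasoning

  τ-succ : (a : Pt n) → ∀ x → swap a (succ a) x ≡ τ (res (succ a)) x
  τ-succ a x = trans (cong₂ (λ u v → swap u v x) (sym a≡) (sym b≡)) (swap-shifted (proj₂ a) (lo≢hi _) x)
    where
    i = res (succ a)
    a≡ : shift (proj₂ a) (lo i) ≡ a
    a≡ = trans (cong (λ r → shift (proj₂ a) (base r)) (prev-next (res a))) (shift-base a)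
    b≡ : shift (proj₂ a) (hi i) ≡ succ a
    b≡ = trans (cong (λ r → shift (proj₂ a) (succ (base r))) (prev-next (res a)))
      (cong (next (res a) ,_) (lemma (carry (res a)) (proj₂ a)))
      where
      lemma : ∀ c q → 0ℤ + c + q ≡ q + c
      lemma = solve-∀

  τ-up : (i : Fin n) {x : Pt n} → res x ≡ res (lo i) → τ i x ≡ succ x
  τ-up i {x} x≡lo = trans (cong (λ j → τ j x) (trans (sym (next-prev i)) (cong next (sym x≡lo))))
    (trans (sym (τ-succ x x)) (swap-a x (succ x)))

  τ-down : (i : Fin n) {x : Pt n} → res x ≡ i → ∃[ y ] x ≡ succ y × τ i x ≡ y
  τ-down i {x} x≡i = y , x≡ , trans (cong (λ j → τ j x) (sym (trans (cong res (sym x≡)) x≡i)))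
    (trans (sym (τ-succ y x)) (trans (cong (swap y (succ y)) x≡) (swap-b (next≢ 3≤n (res y) ∘ sym))))
    where
    y : Pt n
    y = prev (res x) , proj₂ x - carry (prev (res x))
    lemma : ∀ q c → q ≡ q - c + c
    lemma = solve-∀
    x≡ : x ≡ succ y
    x≡ = cong₂ _,_ (sym (next-prev (res x))) (lemma (proj₂ x) (carry (prev (res x))))

  place-τ-≥ : (i : Fin n) {x : Pt n} → res x ≢ i → place x ≤ place (τ i x)
  place-τ-≥ i {x} x≢i = by-cases (res x ≟ res (lo i))
    where
    by-cases : Dec (res x ≡ res (lo i)) → place x ≤ place (τ i x)
    by-cases (yes x≡lo) = subst (λ y → place x ≤ place y) (sym (τ-up i x≡lo)) (<⇒≤ (≺succ x))
    by-cases (no x≢lo)  = ≤-reflexive (cong place (sym (swap-fixed (lo i) (hi i) x≢lo (λ eq → x≢i (trans eq (res-hi i))))))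

  place-τ-≤ : (i : Fin n) {x : Pt n} → res x ≢ i → place (τ i x) ≤ 1ℤ + place x
  place-τ-≤ i {x} x≢i = by-cases (res x ≟ res (lo i))
    where
    by-cases : Dec (res x ≡ res (lo i)) → place (τ i x) ≤ 1ℤ + place x
    by-cases (yes x≡lo) = ≤-reflexive (trans (cong place (τ-up i x≡lo)) (place-succ x))
    by-cases (no x≢lo)  = subst (λ y → place y ≤ 1ℤ + place x)
      (sym (swap-fixed (lo i) (hi i) x≢lo (λ eq → x≢i (trans eq (res-hi i))))) (i≤suc[i] (place x))

  -- The larger of two distinct points of [0, n) is not 0, so s₀ is never the generator chosen while
  -- both points stay in this window.
  positive-finite : {a b : Pt n} → a ≺ b → proj₂ a ≡ 0ℤ → proj₂ b ≡ 0ℤ → Finite (res b)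
  positive-finite {a} {b} a≺b a≡0 b≡0 eq = contradiction
    (subst₂ _<_ (place-window a a≡0) (trans (place-window b b≡0) (cong +_ eq)) a≺b)
    λ { (+<+ ()) }

  -- Presents `E b - E a` as the image of a simple root under a word. For two points of the window
  -- [0, n) the field `finite` supplies what membership in `Π` asks for.
  record Conjugate (a b : Pt n) : Set where
    field
      conjugator : List (Fin n)
      start      : Pt n
      image-lo   : perm conjugator start ≡ a
      image-hi   : perm conjugator (succ start) ≡ b
      finite     : proj₂ a ≡ 0ℤ → proj₂ b ≡ 0ℤ → All Finite conjugator × Finite (res (succ start))

  -- Applying τ (res b) to both points moves b one step down and a at most one step up.
  conjugate-within : (d : ℕ) {a b : Pt n} → place b ≤ + d + place a → a ≺ b → res a ≢ res b → Conjugate a b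
  conjugate-within ℕ.zero {a} {b} b≤a a≺b _ = contradiction (subst (place b ≤_) (+-identityˡ (place a)) b≤a) (<⇒≱ a≺b)
  conjugate-within (ℕ.suc d) {a} {b} b≤d+a a≺b a≢b with place b ≟ᶻ 1ℤ + place a
  ... | yes b≡ = record
    { conjugator = []
    ; start      = a
    ; image-lo   = refl
    ; image-hi   = sym b≡succ
    ; finite     = λ a≡0 b≡0 → [] , subst (Finite ∘ res) b≡succ (positive-finite a≺b a≡0 b≡0)
    }
    where
    b≡succ : b ≡ succ a
    b≡succ = place-injective (trans b≡ (sym (place-succ a)))
  ... | no b≢ with τ-down (res b) {b} refl
  ...   | b' , b≡ , τb≡ = record
    { conjugator = i ∷ C.conjugator
    ; start      = C.start
    ; image-lo   = trans (cong (τ i) C.image-lo) (swap-involutive (lo≢hi i) a)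
    ; image-hi   = trans (cong (τ i) C.image-hi) (trans (cong (τ i) (sym τb≡)) (swap-involutive (lo≢hi i) b))
    ; finite     = λ a≡0 b≡0 → let i-finite = positive-finite a≺b a≡0 b≡0
                                   (w-finite , s-finite) = C.finite (trans (τ-finite i i-finite a) a≡0)
                                     (trans (cong proj₂ (sym τb≡)) (trans (τ-finite i i-finite b) b≡0))
                               in i-finite ∷ w-finite , s-finite
    }
    where
    i = res b
    a' = τ i a
    place-b : place b ≡ 1ℤ + place b'
    place-b = trans (cong place b≡) (place-succ b')
    a'≢b' : res a' ≢ res b'
    a'≢b' eq = a≢b (res-injective (affine-swap (lo≢hi i)) {a} {b} (trans eq (cong res (sym τb≡))))
    gap : 1ℤ + (1ℤ + place a) ≤ 1ℤ + place b'
    gap = subst (1ℤ + (1ℤ + place a) ≤_) place-b (<⇒1+≤ (≤∧≢⇒< (<⇒1+≤ a≺b) (b≢ ∘ sym)))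
    -- The gap was at least 2 and shrinks by at most 2; the points cannot meet because their
    -- residues differ.
    a'≺b' : a' ≺ b'
    a'≺b' = ≤∧≢⇒< (linear₂ (place-τ-≤ i {a} a≢b) gap (lemma (place a) (place a') (place b')))
                   (a'≢b' ∘ cong res ∘ place-injective)
      where
      lemma : ∀ a a' b' → b' - a' ≡ (1ℤ + a - a') + (1ℤ + b' - (1ℤ + (1ℤ + a)))
      lemma = solve-∀
    b'≤d+a' : place b' ≤ + d + place a'
    b'≤d+a' = linear₂ (subst (_≤ 1ℤ + + d + place a) place-b b≤d+a) (place-τ-≥ i {a} a≢b)
      (lemma (+ d) (place a) (place a') (place b'))
      where
      lemma : ∀ d a a' b' → d + a' - b' ≡ (1ℤ + d + a - (1ℤ + b')) + (a' - a)
      lemma = solve-∀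
    module C = Conjugate (conjugate-within d b'≤d+a' a'≺b' a'≢b')

  conjugate : {a b : Pt n} → a ≺ b → res a ≢ res b → Conjugate a b
  conjugate {a} {b} a≺b = conjugate-within ∣ place b - place a ∣
    (≤-reflexive (trans (lemma (place a) (place b))
      (cong (_+ place a) (sym (0≤i⇒+∣i∣≡i (i≤j⇒0≤j-i (<⇒≤ a≺b))))))) a≺b
    where
    lemma : ∀ a b → b ≡ b - a + a
    lemma = solve-∀

  -- The conjugate of a generator by `w` swaps the images under `w` of the generator's two points,
  -- and the reversed word inverts `w`.
  reflection-word : {a b : Pt n} → a ≺ b → res a ≢ res b → ∃[ w ] perm w ≗ swap a b
  reflection-word {a} {b} a≺b a≢b = w ++ i ∷ reverse w , λ x → begin
    perm (w ++ i ∷ reverse w) x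
      ≡⟨ perm-++ w (i ∷ reverse w) x ⟩
    perm w (τ i (perm (reverse w) x))
      ≡⟨ cong (perm w) (sym (τ-succ C.start (perm (reverse w) x))) ⟩
    perm w (swap C.start (succ C.start) (perm (reverse w) x))
      ≡⟨ f-swap (affine-perm w) (next≢ 3≤n (res C.start) ∘ sym) (perm (reverse w) x) ⟩
    swap (perm w C.start) (perm w (succ C.start)) (perm w (perm (reverse w) x))
      ≡⟨ cong (λ y → swap (perm w C.start) (perm w (succ C.start)) y) (perm-reverse w x) ⟩
    swap (perm w C.start) (perm w (succ C.start)) x
      ≡⟨ cong₂ (λ y z → swap y z x) C.image-lo C.image-hi ⟩
    swap a b x ∎
    where
    open ≡-Reasoning
    module C = Conjugate (conjugate a≺b a≢b)
    w = C.conjugator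
    i = res (succ C.start)

  word-root : (w : List (Fin n)) (i : Fin n) → word w (α i) ≗ E (perm w (hi i)) ⊖ E (perm w (lo i))
  word-root w i k = trans (word-act w (α i) k)
    (trans (act-≗ (perm w) (α-root i) k) (act-root (affine-perm w) (lo i) (hi i) k))

  Π⇒FiniteRoot : {γ : Qaff n} → γ ∈ Π → FiniteRoot γ
  Π⇒FiniteRoot {γ} (f , i , (w , w-finite , f≈w) , i-finite , γ≗) = record
    { source        = res a
    ; target        = res b
    ; source≢target = lo≢hi i ∘ res-injective (affine-perm w)
    ; root          = λ k → trans (γ≗ k) (trans (f≈w (α i) k) (trans (word-root w i k)
                        (cong₂ (λ x y → E x k - E y k) b≡ a≡)))
    }
    where
    a = perm w (lo i)
    b = perm w (hi i)
    a≡ : a ≡ base (res a)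
    a≡ = cong (res a ,_) (perm-finite w-finite (lo i))
    b≡ : b ≡ base (res b)
    b≡ = cong (res b ,_) (trans (perm-finite w-finite (hi i))
      (trans (cong proj₂ (sym (swap-a (lo i) (hi i)))) (τ-finite i i-finite (lo i))))

  positive⇒Π : {p q : Fin n} → base p ≺ base q → p ≢ q → {γ : Qaff n} → γ ≗ E (base q) ⊖ E (base p) → γ ∈ Π
  positive⇒Π {p} {q} p≺q p≢q γ≗ =
    word w , i , (w , proj₁ (C.finite refl refl) , λ _ _ → refl) , proj₂ (C.finite refl refl) ,
    λ k → trans (γ≗ k) (sym (trans (word-act w (α i) k) (trans (act-≗ (perm w) α≗ k)
      (trans (act-root (affine-perm w) C.start (succ C.start) k) (cong₂ (λ x y → E x k - E y k) C.image-hi C.image-lo)))))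
    where
    module C = Conjugate (conjugate p≺q p≢q)
    w = C.conjugator
    i = res (succ C.start)
    lemma : ∀ e a → a ≡ e + a - e
    lemma = solve-∀
    α≗ : α i ≗ E (succ C.start) ⊖ E C.start
    α≗ k = trans (lemma (E C.start k) (α i k)) (cong (_- E C.start k) (sym (E-succ C.start k)))

base-root : (p q : Pt n) (k : Fin n) →
            E q k - E p k ≡ E (base (res q)) k - E (base (res p)) k + (proj₂ q - proj₂ p)
base-root p q k = trans (cong₂ (λ x y → E x k - E y k) (sym (shift-base q)) (sym (shift-base p)))
  (trans (cong₂ _-_ (E-shift (proj₂ q) (base (res q)) k) (E-shift (proj₂ p) (base (res p)) k))
    (lemma (E (base (res q)) k) (E (base (res p)) k) (proj₂ q) (proj₂ p)))
  where
  lemma : ∀ a b q p → a + q - (b + p) ≡ a - b + (q - p)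
  lemma = solve-∀

φ-base : (p q : Fin n) → φ (base p) (base q) ≡ - lt q p
φ-base p q = trans (φ-def (base p) (base q)) (trans (cong₂ _-_ (E-def (base q) p) (trans (E-def (base p) p) (cong (λ z → 0ℤ - z) (lt-refl p))))
  (lemma (lt q p)))
  where
  lemma : ∀ a → (0ℤ - a) - (0ℤ - 0ℤ) ≡ - a
  lemma = solve-∀

≼∧≢⇒≺ : {x y : Pt n} → x ≼ y → x ≢ y → x ≺ y
≼∧≢⇒≺ x≼y x≢y = ≤∧≢⇒< x≼y (x≢y ∘ place-injective)

≺-connex : {x y : Pt n} → x ≢ y → x ≺ y ⊎ y ≺ x
≺-connex {x = x} {y} x≢y with <-cmp (place x) (place y)
... | tri< x≺y _ _ = inj₁ x≺y
... | tri≈ _ x≡y _ = contradiction (place-injective x≡y) x≢y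
... | tri> _ _ y≺x = inj₂ y≺x

swap-comm : {a b : Pt n} → res a ≢ res b → swap a b ≗ swap b a
swap-comm {a = a} {b} a≢b x = by-cases (res x ≟ res a) (res x ≟ res b)
  where
  by-cases : Dec (res x ≡ res a) → Dec (res x ≡ res b) → swap a b x ≡ swap b a x
  by-cases (yes x≡a) _ = trans (swap-source a b x≡a) (sym (swap-target (a≢b ∘ sym) x≡a))
  by-cases (no _) (yes x≡b) = trans (swap-target a≢b x≡b) (sym (swap-source b a x≡b))
  by-cases (no x≢a) (no x≢b) = trans (swap-fixed a b x≢a x≢b) (sym (swap-fixed b a x≢b x≢a))

record RealRoot {n : ℕ} (β : Qaff n) : Set where
  field
    source target : Pt n
    source≺target : source ≺ target
    source≢target : res source ≢ res target
    root          : β ≗ E target ⊖ E source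

module _ (3≤n : 3 ℕ.≤ n) where

  -- A generator negates its own simple root. Appending it to the word that produces the positive
  -- root therefore gives the negative one.
  negative⇒Π : {p q : Fin n} → base p ≺ base q → p ≢ q → {γ : Qaff n} → γ ≗ E (base p) ⊖ E (base q) → γ ∈ Π
  negative⇒Π {p} {q} p≺q p≢q {γ} γ≗ =
    word v , i , (v , ++⁺ (proj₁ (C.finite refl refl)) (i-finite ∷ []) , λ _ _ → refl) , i-finite , λ k → sym (begin
      word v (α i) k
        ≡⟨ word-act 3≤n v (α i) k ⟩
      act (perm v) (α i) k
        ≡⟨ act-≗ (perm v) α≗ k ⟩
      act (perm v) (E (succ C.start) ⊖ E C.start) k
        ≡⟨ act-root (affine-perm 3≤n v) C.start (succ C.start) k ⟩
      E (perm v (succ C.start)) k - E (perm v C.start) k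
        ≡⟨ cong₂ (λ x y → E x k - E y k) hi↦ lo↦ ⟩
      E (base p) k - E (base q) k
        ≡⟨ γ≗ k ⟨
      γ k ∎)
    where
    open ≡-Reasoning
    module C = Conjugate (conjugate 3≤n p≺q p≢q)
    w = C.conjugator
    i = res (succ C.start)
    v = w ++ [ i ]
    i-finite = proj₂ (C.finite refl refl)
    lemma : ∀ e a → a ≡ e + a - e
    lemma = solve-∀
    α≗ : α i ≗ E (succ C.start) ⊖ E C.start
    α≗ k = trans (lemma (E C.start k) (α i k)) (cong (_- E C.start k) (sym (E-succ C.start k)))
    lo↦ : perm v C.start ≡ base q
    lo↦ = trans (perm-++ w [ i ] C.start) (trans (cong (perm w)
      (trans (sym (τ-succ 3≤n C.start C.start)) (swap-a C.start (succ C.start)))) C.image-hi)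
    hi↦ : perm v (succ C.start) ≡ base p
    hi↦ = trans (perm-++ w [ i ] (succ C.start)) (trans (cong (perm w)
      (trans (sym (τ-succ 3≤n C.start (succ C.start))) (swap-b (next≢ 3≤n (res C.start) ∘ sym)))) C.image-lo)

  root⇒Π : {p q : Fin n} → p ≢ q → {γ : Qaff n} → γ ≗ E (base q) ⊖ E (base p) → γ ∈ Π
  root⇒Π {p} {q} p≢q γ≗ with ≺-connex {x = base p} {base q} (p≢q ∘ cong res)
  ... | inj₁ p≺q = positive⇒Π 3≤n p≺q p≢q γ≗
  ... | inj₂ q≺p = negative⇒Π q≺p (p≢q ∘ sym) γ≗

  -- Adding `k c` to a finite root amounts to moving the target by `k` windows. Positivity becomes
  -- `φ ≥ 0` for source and target, where for the finite root `φ` is 0 or -1.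
  Πaff⁺⇒RealRoot : {β : Qaff n} → β ∈ Πaff⁺ → RealRoot β
  Πaff⁺⇒RealRoot {β} (γ , k , γ∈Π , β≗ , positive) = record
    { source        = base p
    ; target        = shift k (base q)
    ; source≺target = ≼∧≢⇒≺ (φ⇒≼ (subst (0ℤ ≤_) (trans (cong (λ z → φ (base p) (base q) + z) (*-identityʳ k))
                        (sym (φ-shiftʳ k (base p) (base q)))) (0≤φ+k positive))) (R.source≢target ∘ cong res)
    ; source≢target = R.source≢target
    ; root          = λ j → trans (β≗ j) (trans (cong (_+ k * 1ℤ) (R.root j))
                        (trans (lemma (E (base q) j) (E (base p) j) k)
                          (cong (_- E (base p) j) (sym (E-shift k (base q) j)))))
    }
    where
    module R = FiniteRoot (Π⇒FiniteRoot 3≤n γ∈Π)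
    p = R.source
    q = R.target
    lemma : ∀ a b k → a - b + k * 1ℤ ≡ a + k - b
    lemma = solve-∀
    bound : ∀ a k → - a + k * 1ℤ - 0ℤ ≡ 1ℤ - a + (k - (1ℤ + 0ℤ))
    bound = solve-∀
    0≤φ+k : 0ℤ < k ⊎ (k ≡ 0ℤ × γ ∈ Π⁺) → 0ℤ ≤ φ (base p) (base q) + k * 1ℤ
    0≤φ+k (inj₁ 0<k) = linear₂ (lt≤1 q p) (<⇒1+≤ 0<k)
      (trans (cong (λ z → z + k * 1ℤ - 0ℤ) (φ-base p q)) (bound (lt q p) k))
    -- The coordinate of `γ` at the residue of its source is `φ (base p) (base q)` itself, so this
    -- single coordinate decides the order of the two points.
    0≤φ+k (inj₂ (refl , _ , 0≤γ)) = subst (0ℤ ≤_) (trans (R.root p) (trans (sym (φ-def (base p) (base q))) (sym (+-identityʳ _)))) (0≤γ p)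

  RealRoot⇒Πaff⁺ : {a b : Pt n} → a ≺ b → res a ≢ res b → E b ⊖ E a ∈ Πaff⁺
  RealRoot⇒Πaff⁺ {a} {b} a≺b a≢b = γ , k , root⇒Π a≢b (λ _ → refl) ,
    (λ j → trans (base-root a b j) (cong (_+_ (γ j)) (sym (*-identityʳ k)))) , by-cases (<-cmp 0ℤ k)
    where
    γ = E (base (res b)) ⊖ E (base (res a))
    k = proj₂ b - proj₂ a
    bound : ∀ l k → k - 0ℤ ≡ - l + k - 0ℤ + (l - 0ℤ)
    bound = solve-∀
    0≤k : 0ℤ ≤ k
    0≤k = linear₂ (≼⇒φ {x = a} {b} (<⇒≤ a≺b)) (lt-nonNegative (res b) (res a))
      (trans (bound (lt (res b) (res a)) k) (cong (λ z → z - 0ℤ + (lt (res b) (res a) - 0ℤ))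
        (sym (trans (φ-def a b) (trans (base-root a b (res a)) (cong (_+ k) (trans (sym (φ-def (base (res a)) (base (res b)))) (φ-base (res a) (res b)))))))))
    by-cases : _ → 0ℤ < k ⊎ (k ≡ 0ℤ × γ ∈ Π⁺)
    by-cases (tri< 0<k _ _) = inj₁ 0<k
    by-cases (tri≈ _ 0≡k _) = inj₂ (sym 0≡k , root⇒Π a≢b (λ _ → refl) , λ j →
      subst (0ℤ ≤_) (trans (base-root a b j) (trans (cong (_+_ (γ j)) (sym 0≡k)) (+-identityʳ (γ j))))
        (i≤j⇒0≤j-i (E-mono (<⇒≤ a≺b) j)))
    by-cases (tri> _ _ k<0) = contradiction 0≤k (<⇒≱ k<0)

φ-self : (x : Pt n) → φ x x ≡ 0ℤ
φ-self x = trans (φ-def x x) (+-inverseʳ (E x (res x)))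

φ-same : (x y : Pt n) → res y ≡ res x → φ x y ≡ proj₂ y - proj₂ x
φ-same x y y≡x = trans (cong (φ x) (sym (shift-between y x y≡x)))
  (trans (φ-shiftʳ (proj₂ y - proj₂ x) x x) (trans (cong (_+ (proj₂ y - proj₂ x)) (φ-self x)) (+-identityˡ _)))

φ-affine-same : {f : Pt n → Pt n} → Affine f → ∀ x y → res y ≡ res x → φ (f x) (f y) ≡ φ x y
φ-affine-same {f = f} F x y y≡x = trans (cong (φ (f x)) (f-shift-between F y≡x))
  (trans (φ-shiftʳ (proj₂ y - proj₂ x) (f x) (f x)) (trans (cong (_+ (proj₂ y - proj₂ x)) (φ-self (f x)))
    (trans (+-identityˡ _) (sym (φ-same x y y≡x)))))

opaque
  unfolding φ

  -- floor((y - x) / n) changes when x advances by one only if n divides y - x.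
  φ-succˡ : (x y : Pt n) → res y ≢ res x → φ (succ x) y ≡ φ x y
  φ-succˡ {n} x y y≢x = trans (cong (λ z → E y nr - z) (trans (E-succ x nr) (cong (_+_ (E x nr)) (α-refl nr))))
    (trans (lemma (E y r) (E y nr) (E x r) (E x nr))
      (trans (cong₂ (λ u v → E y r - E x r - (u - v) - 1ℤ)
        (trans (E-next y r) (cong (_- carry r) (α-≢ y≢x)))
        (trans (E-next x r) (cong (_- carry r) (α-refl r))))
        (cancel (E y r - E x r) (carry r))))
    where
    r nr : Fin n
    r  = res x
    nr = next r
    lemma : ∀ a a' b b' → a' - (b' + 1ℤ) ≡ a - b - ((a - a') - (b - b')) - 1ℤ
    lemma = solve-∀
    cancel : ∀ d c → d - (0ℤ - c - (1ℤ - c)) - 1ℤ ≡ d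
    cancel = solve-∀

  φ-succʳ : (x y : Pt n) → φ x (succ y) ≡ φ x y + α (next (res y)) (res x)
  φ-succʳ x y = trans (cong (_- E x (res x)) (E-succ y (res x))) (lemma (E y (res x)) (α (next (res y)) (res x)) (E x (res x)))
    where
    lemma : ∀ e a b → e + a - b ≡ e - b + a
    lemma = solve-∀

-- Length and inversions

φ-≺succ : (x : Pt n) → next (res x) ≢ res x → φ x (succ x) ≡ 0ℤ
φ-≺succ x nx≢x = trans (sym (φ-succˡ x (succ x) nx≢x)) (φ-self (succ x))

φ-τ-ascending : (3≤n : 3 ℕ.≤ n) (i : Fin n) (z z' : Pt n) → res z ≡ res (lo i) → res z' ≡ i →
                φ (τ i z) (τ i z') ≡ φ z z' - 1ℤ
φ-τ-ascending 3≤n i z z' z≡lo z'≡i = from-predecessor (τ-down 3≤n i {z'} z'≡i)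
  where
  from-predecessor : ∃[ y ] z' ≡ succ y × τ i z' ≡ y → φ (τ i z) (τ i z') ≡ φ z z' - 1ℤ
  from-predecessor (y , z'≡ , τz'≡) = trans (cong₂ φ (τ-up 3≤n i z≡lo) τz'≡)
    (trans (lemma (φ (succ z) y))
      (cong (_- 1ℤ) (trans (sym (trans (φ-succʳ (succ z) y) (cong (_+_ (φ (succ z) y)) (trans (cong (λ r → α (next r) (next (res z))) y≡z) (α-refl (next (res z)))))))
        (trans (φ-succˡ z (succ y) (λ eq → next≢ 3≤n (res z) (trans (cong next (sym y≡z)) eq))) (cong (φ z) (sym z'≡))))))
    where
    y≡z : res y ≡ res z
    y≡z = trans (next-injective (trans (sym (cong res z'≡)) (trans z'≡i (sym (res-hi i))))) (sym z≡lo)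
    lemma : ∀ a → a ≡ a + 1ℤ - 1ℤ
    lemma = solve-∀

-- Each point moves by at most one step, so the floor changes only when the two points lie in the
-- two exchanged classes and pass each other. The two products are the indicators of the two ways in
-- which this happens.
φ-τ : (3≤n : 3 ℕ.≤ n) (i : Fin n) (z z' : Pt n) →
      φ (τ i z) (τ i z') ≡
      φ z z' - α (res (lo i)) (res z) * α i (res z') + α i (res z) * α (res (lo i)) (res z')
φ-τ {n} 3≤n i z z' = by-cases (view z) (view z')
  where
  l = res (lo i)
  i≢l : i ≢ l
  i≢l eq = lo≢hi 3≤n i (sym (trans (res-hi i) eq))
  data View (x : Pt n) : Set where
    at-lo     : res x ≡ l → View x
    at-hi     : res x ≡ i → View x
    elsewhere : res x ≢ l → res x ≢ i → View x
  view : (x : Pt n) → View x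
  view x with res x ≟ l | res x ≟ i
  ... | yes x≡l | _       = at-lo x≡l
  ... | no _    | yes x≡i = at-hi x≡i
  ... | no x≢l  | no x≢i  = elsewhere x≢l x≢i
  fixed : ∀ {x} → res x ≢ l → res x ≢ i → τ i x ≡ x
  fixed x≢l x≢i = swap-fixed (lo i) (hi i) x≢l (λ eq → x≢i (trans eq (res-hi i)))
  next-l : ∀ {y} → res y ≡ l → next (res y) ≡ i
  next-l y≡l = trans (cong next y≡l) (res-hi i)
  on : ∀ {j k} → k ≡ j → α j k ≡ 1ℤ
  on {j} refl = α-refl j
  off : ∀ {j k} → k ≢ j → α j k ≡ 0ℤ
  off k≢j = α-≢ (k≢j ∘ sym)
  formula : ∀ {a b a' b' x} → α l (res z) ≡ a → α i (res z') ≡ b → α i (res z) ≡ a' → α l (res z') ≡ b' →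
            x ≡ φ z z' - a * b + a' * b' →
            x ≡ φ z z' - α l (res z) * α i (res z') + α i (res z) * α l (res z')
  formula refl refl refl refl eq = eq
  expand : ∀ {a b a' b'} d → - (a * b) + a' * b' ≡ d → ∀ {x} → x ≡ φ z z' + d → x ≡ φ z z' - a * b + a' * b'
  expand d eq x≡ = trans x≡ (trans (cong (_+_ (φ z z')) (sym eq)) (sym (+-assoc (φ z z') _ _)))
  unchanged : ∀ {a b a' b'} → - (a * b) + a' * b' ≡ 0ℤ → ∀ {x} → x ≡ φ z z' → x ≡ φ z z' - a * b + a' * b'
  unchanged {a} {b} {a'} {b'} eq x≡ = expand {a} {b} {a'} {b'} 0ℤ eq (trans x≡ (sym (+-identityʳ _)))
  same : res z' ≡ res z → φ (τ i z) (τ i z') ≡ φ z z'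
  same = φ-affine-same (affine-swap (lo≢hi 3≤n i)) z z'
  l≢i : l ≢ i
  l≢i = i≢l ∘ sym
  by-cases : View z → View z' → φ (τ i z) (τ i z') ≡
             φ z z' - α l (res z) * α i (res z') + α i (res z) * α l (res z')
  by-cases (at-lo z≡) (at-lo z'≡) =
    formula (on z≡) (off (λ e → l≢i (trans (sym z'≡) e))) (off (λ e → l≢i (trans (sym z≡) e))) (on z'≡)
      (unchanged {1ℤ} {0ℤ} {0ℤ} {1ℤ} refl (same (trans z'≡ (sym z≡))))
  by-cases (at-hi z≡) (at-hi z'≡) =
    formula (off (λ e → i≢l (trans (sym z≡) e))) (on z'≡) (on z≡) (off (λ e → i≢l (trans (sym z'≡) e)))
      (unchanged {0ℤ} {1ℤ} {1ℤ} {0ℤ} refl (same (trans z'≡ (sym z≡))))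
  by-cases (at-lo z≡) (at-hi z'≡) =
    formula (on z≡) (on z'≡) (off (λ e → l≢i (trans (sym z≡) e))) (off (λ e → i≢l (trans (sym z'≡) e)))
      (expand {1ℤ} {1ℤ} {0ℤ} {0ℤ} -1ℤ refl (φ-τ-ascending 3≤n i z z' z≡ z'≡))
  by-cases (at-hi z≡) (at-lo z'≡) =
    formula (off (λ e → i≢l (trans (sym z≡) e))) (off (λ e → l≢i (trans (sym z'≡) e))) (on z≡) (on z'≡)
      (expand {0ℤ} {0ℤ} {1ℤ} {1ℤ} 1ℤ refl (trans (lemma (φ (τ i z) (τ i z'))) (cong (_+ 1ℤ)
        (trans (sym (φ-τ-ascending 3≤n i (τ i z) (τ i z') τz≡lo τz'≡i))
          (cong₂ φ (swap-involutive (lo≢hi 3≤n i) z) (swap-involutive (lo≢hi 3≤n i) z'))))))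
    where
    lemma : ∀ a → a ≡ a - 1ℤ + 1ℤ
    lemma = solve-∀
    τz≡lo : res (τ i z) ≡ l
    τz≡lo = cong res (swap-target (lo≢hi 3≤n i) (trans z≡ (sym (res-hi i))))
    τz'≡i : res (τ i z') ≡ i
    τz'≡i = trans (cong res (τ-up 3≤n i z'≡)) (next-l {z'} z'≡)
  by-cases (at-lo z≡) (elsewhere z'≢l z'≢i) =
    formula (on z≡) (off z'≢i) (off (λ e → l≢i (trans (sym z≡) e))) (off z'≢l)
      (unchanged {1ℤ} {0ℤ} {0ℤ} {0ℤ} refl (trans (cong₂ φ (τ-up 3≤n i z≡) (fixed z'≢l z'≢i))
        (φ-succˡ z z' (λ e → z'≢l (trans e z≡)))))
  by-cases (at-hi z≡) (elsewhere z'≢l z'≢i) = from-predecessor (τ-down 3≤n i {z} z≡)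
    where
    from-predecessor : ∃[ y ] z ≡ succ y × τ i z ≡ y → φ (τ i z) (τ i z') ≡
      φ z z' - α l (res z) * α i (res z') + α i (res z) * α l (res z')
    from-predecessor (y , z≡succ , τz≡) =
        formula (off (λ e → i≢l (trans (sym z≡) e))) (off z'≢i) (on z≡) (off z'≢l)
          (unchanged {0ℤ} {0ℤ} {1ℤ} {0ℤ} refl (trans (cong₂ φ τz≡ (fixed z'≢l z'≢i))
            (trans (sym (φ-succˡ y z' (λ e → z'≢l (trans e y≡l)))) (cong (λ x → φ x z') (sym z≡succ)))))
        where
        y≡l : res y ≡ l
        y≡l = next-injective (trans (sym (cong res z≡succ)) (trans z≡ (sym (res-hi i))))
  by-cases (elsewhere z≢l z≢i) (at-lo z'≡) =
    formula (off z≢l) (off (λ e → l≢i (trans (sym z'≡) e))) (off z≢i) (on z'≡)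
      (unchanged {0ℤ} {0ℤ} {0ℤ} {1ℤ} refl (trans (cong₂ φ (fixed z≢l z≢i) (τ-up 3≤n i z'≡))
        (trans (φ-succʳ z z') (trans (cong (_+_ (φ z z')) (α-≢ (λ e → z≢i (trans (sym e) (next-l {z'} z'≡))))) (+-identityʳ _)))))
  by-cases (elsewhere z≢l z≢i) (at-hi z'≡) = from-predecessor (τ-down 3≤n i {z'} z'≡)
    where
    from-predecessor : ∃[ y ] z' ≡ succ y × τ i z' ≡ y → φ (τ i z) (τ i z') ≡
      φ z z' - α l (res z) * α i (res z') + α i (res z) * α l (res z')
    from-predecessor (y , z'≡succ , τz'≡) =
        formula (off z≢l) (on z'≡) (off z≢i) (off (λ e → i≢l (trans (sym z'≡) e)))
          (unchanged {0ℤ} {1ℤ} {0ℤ} {0ℤ} refl (trans (cong₂ φ (fixed z≢l z≢i) τz'≡)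
            (sym (trans (cong (φ z) z'≡succ) (trans (φ-succʳ z y)
              (trans (cong (_+_ (φ z y)) (α-≢ (λ e → z≢i (trans (sym e) (trans (sym (cong res z'≡succ)) z'≡))))) (+-identityʳ _)))))))
  by-cases (elsewhere z≢l z≢i) (elsewhere z'≢l z'≢i) =
    formula (off z≢l) (off z'≢i) (off z≢i) (off z'≢l)
      (unchanged {0ℤ} {0ℤ} {0ℤ} {0ℤ} refl (cong₂ φ (fixed z≢l z≢i) (fixed z'≢l z'≢i)))

-- For points 0 ≤ x < y < n the term `φ x y` vanishes and the absolute value is a summand of Shi's
-- length formula. Subtracting `φ x y` makes the value antisymmetric, so ordered pairs can be summed
-- without comparing residues.
Ψ : (Pt n → Pt n) → Pt n → Pt n → ℤ
Ψ f x y = φ (f x) (f y) - φ x y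

opaque
  -- Twice the number of inversions of f.
  N : (Pt n → Pt n) → ℤ
  N f = sum λ r → sum λ r' → + ∣ Ψ f (base r) (base r') ∣

  N-def : (f : Pt n → Pt n) → N f ≡ sum (λ r → sum λ r' → + ∣ Ψ f (base r) (base r') ∣)
  N-def f = refl

  N-cong : {f g : Pt n → Pt n} → f ≗ g → N f ≡ N g
  N-cong f≗g = sum-cong-≗ λ r → sum-cong-≗ λ r' →
    cong₂ (λ x y → + ∣ φ x y - φ (base r) (base r') ∣) (f≗g (base r)) (f≗g (base r'))

  -- `act` does not distinguish `f` from `shift l ∘ f`, so `f` and `g` need not agree as
  -- permutations. The inversion count still agrees, since `φ-cong` needs differences only.
  N-act : {f g : Pt n → Pt n} → Affine f → Affine g → act f ≈ act g → N f ≡ N g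
  N-act {f = f} {g} F G f≈g = sum-cong-≗ λ r → sum-cong-≗ λ r' →
    cong (λ z → + ∣ z - φ (base r) (base r') ∣) (φ-cong {x = f (base r)} {f (base r')} {g (base r)} {g (base r')} λ k →
      trans (sym (act-root F (base r) (base r') k)) (trans (f≈g (E (base r') ⊖ E (base r)) k) (act-root G (base r) (base r') k)))

  N-id : N {n} id ≡ 0ℤ
  N-id {n} = sum-zero {n} _ λ r → sum-zero {n} _ λ r' → cong (+_ ∘ ∣_∣) (+-inverseʳ (φ (base r) (base r')))

Ψ-base : {f : Pt n → Pt n} → Affine f → ∀ x y → Ψ f (base (res x)) (base (res y)) ≡ Ψ f x y
Ψ-base {f = f} F x y = sym (trans (cong₂ _-_ (shifted (f (base (res x))) (f (base (res y))) (fx≡ x) (fx≡ y))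
  (shifted (base (res x)) (base (res y)) (sym (shift-base x)) (sym (shift-base y))))
  (lemma (φ (f (base (res x))) (f (base (res y)))) (φ (base (res x)) (base (res y))) (proj₂ x) (proj₂ y)))
  where
  fx≡ : ∀ z → f z ≡ shift (proj₂ z) (f (base (res z)))
  fx≡ z = trans (cong f (sym (shift-base z))) (Affine.f-shift F (proj₂ z) (base (res z)))
  shifted : ∀ {u v} u' v' → u ≡ shift (proj₂ x) u' → v ≡ shift (proj₂ y) v' → φ u v ≡ φ u' v' + proj₂ y - proj₂ x
  shifted u' v' u≡ v≡ = trans (cong₂ φ u≡ v≡) (trans (φ-shiftˡ (proj₂ x) u' (shift (proj₂ y) v'))
    (cong (_- proj₂ x) (φ-shiftʳ (proj₂ y) u' v')))
  lemma : ∀ a b q q' → (a + q' - q) - (b + q' - q) ≡ a - b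
  lemma = solve-∀

Ψ-antisym : {f : Pt n → Pt n} → Affine f → ∀ {x y} → res x ≢ res y → Ψ f y x ≡ - Ψ f x y
Ψ-antisym {f = f} F {x} {y} x≢y = trans (lemma (φ (f x) (f y)) (φ (f y) (f x)) (φ x y) (φ y x))
  (trans (cong₂ (λ u v → - (φ (f x) (f y) - φ x y) + (u - v))
    (φ-antisym {x = f x} {f y} (x≢y ∘ res-injective F)) (φ-antisym {x = x} {y} x≢y)) (+-identityʳ _))
  where
  lemma : ∀ a b c d → b - d ≡ - (a - c) + ((a + b) - (c + d))
  lemma = solve-∀

∣-∣-pred : ∀ {a} → a ≤ 0ℤ → + ∣ a - 1ℤ ∣ ≡ + ∣ a ∣ + 1ℤ
∣-∣-pred { -[1+ a ]} _ = cong +_ (trans (cong (ℕ.suc ∘ ℕ.suc) (ℕₚ.+-identityʳ a)) (ℕₚ.+-comm 1 (ℕ.suc a)))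
∣-∣-pred {+ 0} _ = refl
∣-∣-pred {+[1+ a ]} (+≤+ ())

module _ (3≤n : 3 ℕ.≤ n) {f : Pt n → Pt n} (F : Affine f) (i : Fin n) where

  open Affine F

  private
    x = f⁻¹ (lo i)
    y = f⁻¹ (hi i)

    x≢y : res x ≢ res y
    x≢y = lo≢hi 3≤n i ∘ res-injective (affine-inverse F)

    Ψ-step : ∀ r r' → Ψ (τ i ∘ f) (base r) (base r') ≡
             Ψ f (base r) (base r') - α (res x) r * α (res y) r' + α (res y) r * α (res x) r'
    Ψ-step r r' = trans (cong (_- φ (base r) (base r')) (φ-τ 3≤n i (f (base r)) (f (base r'))))
      (trans (lemma (φ (f (base r)) (f (base r'))) (φ (base r) (base r')) _ _)
        (cong₂ (λ u v → Ψ f (base r) (base r') - u + v)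
          (cong₂ _*_ (α-inverse F (lo i) r) (hi-f r')) (cong₂ _*_ (hi-f r) (α-inverse F (lo i) r'))))
      where
      hi-f : ∀ r → α i (res (f (base r))) ≡ α (res y) r
      hi-f r = trans (cong (λ j → α j (res (f (base r)))) (sym (res-hi i))) (α-inverse F (hi i) r)
      lemma : ∀ a b c d → a - c + d - b ≡ a - b - c + d
      lemma = solve-∀

  -- Only the classes of `x` and `y` are affected. Their images are adjacent, with `φ` equal to 0,
  -- while `φ x y ≥ 0`; hence `Ψ` is nonpositive there and lowering it by one raises its absolute
  -- value by one, once for each order of the pair.
  N-up : x ≺ y → N (τ i ∘ f) ≡ N f + + 2
  N-up x≺y = begin
    N (τ i ∘ f)
      ≡⟨ trans (N-def (τ i ∘ f)) (sum-cong-≗ (λ r → sum-cong-≗ (λ r' → absolute r r'))) ⟩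
    sum (λ r → sum (λ r' → A r r' + (α X r * α Y r' + α Y r * α X r')))
      ≡⟨ sum-cong-≗ (λ r → trans (∑-distrib-+ (A r) (λ r' → α X r * α Y r' + α Y r * α X r'))
           (cong (_+_ (sum (A r))) (trans (∑-distrib-+ (λ r' → α X r * α Y r') (λ r' → α Y r * α X r'))
             (cong₂ _+_ (sum-α (λ _ → α X r) Y) (sum-α (λ _ → α Y r) X))))) ⟩
    sum (λ r → sum (A r) + (α X r + α Y r))
      ≡⟨ trans (∑-distrib-+ (λ r → sum (A r)) (λ r → α X r + α Y r)) (cong₂ _+_ (sym (N-def f)) (∑-distrib-+ (α X) (α Y))) ⟩
    N f + (sum (α X) + sum (α Y))
      ≡⟨ cong (_+_ (N f)) (cong₂ _+_ (sum-α₁ X) (sum-α₁ Y)) ⟩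
    N f + + 2 ∎
    where
    open ≡-Reasoning
    X = res x
    Y = res y
    A : Fin n → Fin n → ℤ
    A r r' = + ∣ Ψ f (base r) (base r') ∣
    Ψ≤0 : Ψ f (base X) (base Y) ≤ 0ℤ
    Ψ≤0 = linear₁ (≼⇒φ {x = x} {y} (<⇒≤ x≺y)) (trans (cong (λ z → 0ℤ - z) (trans (Ψ-base F x y)
      (cong (_- φ x y) (trans (cong₂ φ (f-f⁻¹ (lo i)) (f-f⁻¹ (hi i))) (φ-≺succ (lo i) (lo≢hi 3≤n i ∘ sym))))))
      (lemma (φ x y)))
      where
      lemma : ∀ a → 0ℤ - (0ℤ - a) ≡ a - 0ℤ
      lemma = solve-∀
    on : ∀ {j r} → j ≡ r → α j r ≡ 1ℤ
    on {j} refl = α-refl j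
    Ψ-pred : ∀ {r r'} → X ≡ r → Y ≡ r' → + ∣ Ψ f (base r) (base r') - 1ℤ ∣ ≡ + ∣ Ψ f (base r) (base r') ∣ + 1ℤ
    Ψ-pred refl refl = ∣-∣-pred Ψ≤0
    Ψ-flip : ∀ {r r'} → Y ≡ r → X ≡ r' → Ψ f (base r) (base r') ≡ - Ψ f (base r') (base r)
    Ψ-flip refl refl = Ψ-antisym F {base X} {base Y} x≢y
    absolute : ∀ r r' → + ∣ Ψ (τ i ∘ f) (base r) (base r') ∣ ≡ A r r' + (α X r * α Y r' + α Y r * α X r')
    absolute r r' = trans (cong (+_ ∘ ∣_∣) (Ψ-step r r')) (by-cases (X ≟ r) (Y ≟ r) (X ≟ r') (Y ≟ r'))
      where
      P = Ψ f (base r) (base r')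
      P⁻ = Ψ f (base r') (base r)
      with-values : ∀ {a b a' b'} → α X r ≡ a → α Y r' ≡ b → α Y r ≡ a' → α X r' ≡ b' →
                    + ∣ P - a * b + a' * b' ∣ ≡ + ∣ P ∣ + (a * b + a' * b') →
                    + ∣ P - α X r * α Y r' + α Y r * α X r' ∣ ≡ + ∣ P ∣ + (α X r * α Y r' + α Y r * α X r')
      with-values refl refl refl refl eq = eq
      unchanged : ∀ {c d} → c ≡ 0ℤ → d ≡ 0ℤ → + ∣ P - c + d ∣ ≡ + ∣ P ∣ + (c + d)
      unchanged refl refl = trans (cong (+_ ∘ ∣_∣) (trans (+-identityʳ (P - 0ℤ)) (+-identityʳ P))) (sym (+-identityʳ _))
      lemma : ∀ a → - a - 0ℤ + 1ℤ ≡ - (a - 1ℤ)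
      lemma = solve-∀
      by-cases : Dec (X ≡ r) → Dec (Y ≡ r) → Dec (X ≡ r') → Dec (Y ≡ r') →
                 + ∣ P - α X r * α Y r' + α Y r * α X r' ∣ ≡ + ∣ P ∣ + (α X r * α Y r' + α Y r * α X r')
      by-cases (yes X≡r) (yes Y≡r) _ _ = contradiction (trans X≡r (sym Y≡r)) x≢y
      by-cases _ _ (yes X≡r') (yes Y≡r') = contradiction (trans X≡r' (sym Y≡r')) x≢y
      by-cases (yes X≡r) (no Y≢r) (no X≢r') (yes Y≡r') =
        with-values (on X≡r) (on Y≡r') (α-≢ Y≢r) (α-≢ X≢r')
          (trans (cong (+_ ∘ ∣_∣) (+-identityʳ (P - 1ℤ))) (Ψ-pred X≡r Y≡r'))
      by-cases (no X≢r) (yes Y≡r) (yes X≡r') (no Y≢r') =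
        with-values (α-≢ X≢r) (α-≢ Y≢r') (on Y≡r) (on X≡r')
          (trans (cong (+_) (trans (cong (λ z → ∣ z - 0ℤ + 1ℤ ∣) (Ψ-flip Y≡r X≡r'))
              (trans (cong ∣_∣ (lemma P⁻)) (∣-i∣≡∣i∣ (P⁻ - 1ℤ)))))
            (trans (Ψ-pred X≡r' Y≡r) (cong (λ z → + z + 1ℤ) (trans (sym (∣-i∣≡∣i∣ P⁻)) (cong ∣_∣ (sym (Ψ-flip Y≡r X≡r')))))))
      by-cases (no X≢r) (no Y≢r) _ _ = unchanged (cong (_* α Y r') (α-≢ X≢r)) (cong (_* α X r') (α-≢ Y≢r))
      by-cases _ _ (no X≢r') (no Y≢r') = unchanged (zero-right (α X r) (α-≢ Y≢r')) (zero-right (α Y r) (α-≢ X≢r'))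
        where
        zero-right : ∀ c {d} → d ≡ 0ℤ → c * d ≡ 0ℤ
        zero-right c refl = *-zeroʳ c
      by-cases (yes X≡r) (no Y≢r) (yes X≡r') (no Y≢r') =
        with-values (on X≡r) (α-≢ Y≢r') (α-≢ Y≢r) (on X≡r') (unchanged {0ℤ} {0ℤ} refl refl)
      by-cases (no X≢r) (yes Y≡r) (no X≢r') (yes Y≡r') =
        with-values (α-≢ X≢r) (on Y≡r') (on Y≡r) (α-≢ X≢r') (unchanged {0ℤ} {0ℤ} refl refl)

module _ (3≤n : 3 ℕ.≤ n) where

  N-down : {f : Pt n → Pt n} (F : Affine f) (i : Fin n) → Affine.f⁻¹ F (hi i) ≺ Affine.f⁻¹ F (lo i) →
           N f ≡ N (τ i ∘ f) + + 2
  N-down {f} F i y≺x = trans (N-cong {f = f} {τ i ∘ τ i ∘ f} (λ z → sym (swap-involutive {a = lo i} {hi i} (lo≢hi 3≤n i) (f z))))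
    (N-up 3≤n (affine-∘ (affine-swap (lo≢hi 3≤n i)) F) i
      (subst₂ _≺_ (cong f⁻¹ (sym (swap-a (lo i) (hi i)))) (cong f⁻¹ (sym (swap-b (lo≢hi 3≤n i)))) y≺x))
    where open Affine F

  lo-hi-connex : {f : Pt n → Pt n} (F : Affine f) (i : Fin n) →
                 Affine.f⁻¹ F (lo i) ≺ Affine.f⁻¹ F (hi i) ⊎ Affine.f⁻¹ F (hi i) ≺ Affine.f⁻¹ F (lo i)
  lo-hi-connex F i = ≺-connex (λ eq → lo≢hi 3≤n i (cong res (Affine.f-injective (affine-inverse F) eq)))

  double : List (Fin n) → ℤ
  double w = + (2 ℕ.* length w)

  double-∷ : (i : Fin n) (w : List (Fin n)) → double (i ∷ w) ≡ double w + + 2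
  double-∷ i w = cong +_ (trans (ℕₚ.*-distribˡ-+ 2 1 (length w)) (ℕₚ.+-comm 2 (2 ℕ.* length w)))

  N≤double : (w : List (Fin n)) → N (perm w) ≤ double w
  N≤double []      = ≤-reflexive (N-id {n})
  N≤double (i ∷ w) = subst (N (perm (i ∷ w)) ≤_) (sym (double-∷ i w)) (by-cases (lo-hi-connex F i))
    where
    F = affine-perm 3≤n w
    by-cases : _ → N (perm (i ∷ w)) ≤ double w + + 2
    by-cases (inj₁ x≺y) = ≤-trans (≤-reflexive (N-up 3≤n F i x≺y)) (+-monoˡ-≤ (+ 2) (N≤double w))
    by-cases (inj₂ y≺x) = ≤-trans (i≤i+j (N (perm (i ∷ w))) (+ 2))
      (≤-trans (≤-reflexive (sym (N-down F i y≺x))) (≤-trans (N≤double w) (i≤i+j (double w) (+ 2))))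

  -- `φ z z'` drops from nonnegative to negative, so the subtracted product in `φ-τ` must be 1,
  -- which fixes both residues. Then `φ z z' - 1 < 0` leaves `φ z z' = 0`, and the points are
  -- adjacent.
  crossing-generator : (i : Fin n) {z z' : Pt n} → res z ≢ res z' → z ≺ z' → τ i z' ≺ τ i z →
                       z' ≡ succ z × i ≡ res (succ z)
  crossing-generator i {z} {z'} z≢z' z≺z' τz'≺τz = by-cases (res (lo i) ≟ res z) (i ≟ res z')
    where
    T = affine-swap (lo≢hi 3≤n i)
    0≤φ : 0ℤ ≤ φ z z'
    0≤φ = ≼⇒φ {x = z} {z'} (<⇒≤ z≺z')
    φτ<0 : φ (τ i z) (τ i z') < 0ℤ
    φτ<0 = ≺⇒φ {x = τ i z'} {τ i z} (z≢z' ∘ sym ∘ res-injective T) τz'≺τz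
    up = α i (res z) * α (res (lo i)) (res z')
    0≤up : 0ℤ ≤ up
    0≤up = *-mono-nonNeg (α-nonNegative i (res z)) (α-nonNegative (res (lo i)) (res z'))
      where
      *-mono-nonNeg : ∀ {a b} → 0ℤ ≤ a → 0ℤ ≤ b → 0ℤ ≤ a * b
      *-mono-nonNeg {+ a} {+ b} _ _ = subst (0ℤ ≤_) (pos-* a b) (+≤+ ℕ.z≤n)
    impossible : α (res (lo i)) (res z) * α i (res z') ≡ 0ℤ → z' ≡ succ z × i ≡ res (succ z)
    impossible eq = contradiction (subst (0ℤ ≤_)
      (trans (cong (λ p → φ z z' - p + up) (sym eq)) (sym (φ-τ 3≤n i z z')))
      (+-mono-≤ (subst (0ℤ ≤_) (sym (+-identityʳ (φ z z'))) 0≤φ) 0≤up)) (<⇒≱ φτ<0)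
    by-cases : Dec (res (lo i) ≡ res z) → Dec (i ≡ res z') → z' ≡ succ z × i ≡ res (succ z)
    by-cases (no lo≢z) _ = impossible (cong (_* α i (res z')) (α-≢ lo≢z))
    by-cases (yes _) (no i≢z') = impossible (trans (cong (_*_ (α (res (lo i)) (res z))) (α-≢ i≢z')) (*-zeroʳ (α (res (lo i)) (res z))))
    by-cases (yes lo≡z) (yes i≡z') = z'≡ , trans i≡z' (cong res z'≡)
      where
      sz = succ z
      z'≡sz : res z' ≡ res sz
      z'≡sz = trans (sym i≡z') (trans (sym (res-hi i)) (cong next lo≡z))
      φ≤0 : φ z z' - 1ℤ < 0ℤ
      φ≤0 = subst (_< 0ℤ) (φ-τ-ascending 3≤n i z z' (sym lo≡z) (sym i≡z')) φτ<0
      φ≡0 : φ z z' ≡ 0ℤ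
      φ≡0 = ≤-antisym (linear₁ (<⇒1+≤ φ≤0) (lemma (φ z z'))) 0≤φ
        where
        lemma : ∀ a → 0ℤ - a ≡ 0ℤ - (1ℤ + (a - 1ℤ))
        lemma = solve-∀
      between : proj₂ z' - proj₂ sz ≡ 0ℤ
      between = trans (sym (φ-same sz z' z'≡sz)) (trans (φ-succˡ z z' (z≢z' ∘ sym)) φ≡0)
      z'≡ : z' ≡ sz
      z'≡ = trans (sym (shift-between z' sz z'≡sz)) (trans (cong (λ l → shift l sz) between) (shift-zero sz))

  -- The strong exchange condition. Reading the word from the right, some letter is the first to
  -- reverse the images of `x` and `y`; by `crossing-generator` it is the swap of these two images,
  -- and so it cancels against `swap x y` moved through the letters to its right.
  deletion : (w : List (Fin n)) {x y : Pt n} → res x ≢ res y → x ≺ y → perm w y ≺ perm w x →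
             ∃[ v ] length w ≡ ℕ.suc (length v) × perm v ≗ perm w ∘ swap x y
  deletion [] x≢y x≺y y≺x = contradiction (<-trans x≺y y≺x) (<-irrefl refl)
  deletion (i ∷ w) {x} {y} x≢y x≺y wy≺wx = by-cases (≺-connex (x≢y ∘ cong res ∘ Affine.f-injective F))
    where
    F = affine-perm 3≤n w
    by-cases : perm w x ≺ perm w y ⊎ perm w y ≺ perm w x →
               ∃[ v ] length (i ∷ w) ≡ ℕ.suc (length v) × perm v ≗ perm (i ∷ w) ∘ swap x y
    by-cases (inj₂ y≺x) with deletion w x≢y x≺y y≺x
    ... | v , length-v , perm-v = i ∷ v , cong ℕ.suc length-v , λ z → cong (τ i) (perm-v z)
    by-cases (inj₁ z≺z') with crossing-generator i (x≢y ∘ res-injective F) z≺z' wy≺wx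
    ... | z'≡ , i≡ = w , refl , λ u → sym (begin
      τ i (perm w (swap x y u))
        ≡⟨ cong (τ i) (f-swap F x≢y u) ⟩
      τ i (swap (perm w x) (perm w y) (perm w u))
        ≡⟨ cong (λ z → τ i (swap (perm w x) z (perm w u))) z'≡ ⟩
      τ i (swap (perm w x) (succ (perm w x)) (perm w u))
        ≡⟨ cong (τ i) (trans (τ-succ 3≤n (perm w x) (perm w u)) (cong (λ j → τ j (perm w u)) (sym i≡))) ⟩
      τ i (τ i (perm w u))
        ≡⟨ swap-involutive (lo≢hi 3≤n i) (perm w u) ⟩
      perm w u ∎)
      where open ≡-Reasoning

  lo≺hi : (i : Fin n) → lo i ≺ hi i
  lo≺hi i = ≺succ (lo i)

  -- Supplies a word whose length is half the inversion count; with the lower bound `N≤double` it is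
  -- reduced, which identifies `Length` with half of `N`.
  reduce : (w : List (Fin n)) → ∃[ v ] perm v ≗ perm w × N (perm w) ≡ double v
  reduce [] = [] , (λ _ → refl) , N-id {n}
  reduce (i ∷ w) with reduce w
  ... | v , v≗w , N≡ = by-cases (lo-hi-connex F i)
    where
    F = affine-perm 3≤n v
    open Affine F
    N-τ : N (perm (i ∷ w)) ≡ N (perm (i ∷ v))
    N-τ = N-cong (λ z → cong (τ i) (sym (v≗w z)))
    N-v : N (perm v) ≡ double v
    N-v = trans (N-cong v≗w) N≡
    by-cases : _ → ∃[ u ] perm u ≗ perm (i ∷ w) × N (perm (i ∷ w)) ≡ double u
    by-cases (inj₁ x≺y) = i ∷ v , (λ z → cong (τ i) (v≗w z)) ,
      trans N-τ (trans (N-up 3≤n F i x≺y) (trans (cong (_+ + 2) N-v) (sym (double-∷ i v))))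
    -- Here `v` reverses the preimages of `lo i` and `hi i`, so deleting one letter of `v` already
    -- yields the permutation of `i ∷ v`.
    by-cases (inj₂ y≺x) with deletion v {f⁻¹ (hi i)} {f⁻¹ (lo i)}
        (lo≢hi 3≤n i ∘ sym ∘ res-injective (affine-inverse F)) y≺x
        (subst₂ _≺_ (sym (f-f⁻¹ (lo i))) (sym (f-f⁻¹ (hi i))) (lo≺hi i))
    ... | u , length-u , perm-u = u , (λ z → begin
          perm u z
            ≡⟨ perm-u z ⟩
          perm v (swap (f⁻¹ (hi i)) (f⁻¹ (lo i)) z)
            ≡⟨ f-swap F (lo≢hi 3≤n i ∘ sym ∘ res-injective (affine-inverse F)) z ⟩
          swap (perm v (f⁻¹ (hi i))) (perm v (f⁻¹ (lo i))) (perm v z)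
            ≡⟨ cong₂ (λ a b → swap a b (perm v z)) (f-f⁻¹ (hi i)) (f-f⁻¹ (lo i)) ⟩
          swap (hi i) (lo i) (perm v z)
            ≡⟨ swap-comm (lo≢hi 3≤n i ∘ sym) (perm v z) ⟩
          τ i (perm v z)
            ≡⟨ cong (τ i) (v≗w z) ⟩
          τ i (perm w z) ∎) ,
      trans N-τ (+-cancelʳ (N (perm (i ∷ v))) (double u)
        (trans (sym (N-down F i y≺x)) (trans N-v (trans (cong (λ l → + (2 ℕ.* l)) length-u) (double-∷ i u)))))
      where
      open ≡-Reasoning
      +-cancelʳ : ∀ a b → a + + 2 ≡ b + + 2 → a ≡ b
      +-cancelʳ a b eq = ≤-antisym (linear₁ (≤-reflexive eq) (lemma a b)) (linear₁ (≤-reflexive (sym eq)) (lemma b a))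
        where
        lemma : ∀ a b → b - a ≡ b + + 2 - (a + + 2)
        lemma = solve-∀

  perm⇒word : {v w : List (Fin n)} → perm v ≗ perm w → word v ≈ word w
  perm⇒word {v} {w} v≗w μ k = trans (word-act 3≤n v μ k) (trans (act-cong {f = perm v} {perm w} (v≗w ∘ base) μ k) (sym (word-act 3≤n w μ k)))

  N-word : {v w : List (Fin n)} → word v ≈ word w → N (perm v) ≡ N (perm w)
  N-word {v} {w} v≈w = N-act (affine-perm 3≤n v) (affine-perm 3≤n w) λ μ k →
    trans (sym (word-act 3≤n v μ k)) (trans (v≈w μ k) (word-act 3≤n w μ k))

  double-reflects-≤ : {k l : ℕ} → + (2 ℕ.* k) ≤ + (2 ℕ.* l) → k ℕ.≤ l
  double-reflects-≤ {k} {l} (+≤+ 2k≤2l) = ℕₚ.*-cancelˡ-≤ 2 2k≤2l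

  N⇒Length : {f : Map n} (w : List (Fin n)) → f ≈ word w → ∀ {k} → N (perm w) ≡ + (2 ℕ.* k) → Length f k
  N⇒Length {f} w f≈w {k} N≡ with reduce w
  ... | v , v≗w , N≡v =
    (v , (λ μ j → trans (f≈w μ j) (sym (perm⇒word {v} {w} v≗w μ j))) ,
     ℕₚ.≤-antisym (double-reflects-≤ (≤-reflexive (trans (sym N≡v) N≡))) (double-reflects-≤ (≤-reflexive (trans (sym N≡) N≡v)))) ,
    λ u f≈u → double-reflects-≤ (≤-trans (≤-reflexive (trans (sym N≡) (N-word {w} {u} λ μ j → trans (sym (f≈w μ j)) (f≈u μ j))))
      (N≤double u))

  Length-exists : {f : Map n} (w : List (Fin n)) → f ≈ word w → ∃[ k ] Length f k × N (perm w) ≡ + (2 ℕ.* k)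
  Length-exists w f≈w with reduce w
  ... | v , v≗w , N≡v = length v , N⇒Length w f≈w N≡v , N≡v

  -- A reduced word of the swapped element reverses `a` and `b`. Deleting a letter from it gives a
  -- word of the original element, shorter by one.
  Length-increases : {f g : Map n} (v w : List (Fin n)) → f ≈ word v → g ≈ word w → {a b : Pt n} →
                     res a ≢ res b → a ≺ b → perm v a ≺ perm v b → perm w ≗ perm v ∘ swap a b →
                     ∀ {k l} → Length f k → Length g l → k ℕ.< l
  Length-increases {f} {g} v w f≈v g≈w {a} {b} a≢b a≺b va≺vb w≗ (_ , k-minimal) ((u , g≈u , refl) , _)
    with reduce w
  ... | w' , w'≗w , N≡w' with deletion w' a≢b a≺b (subst₂ _≺_ (sym w'b) (sym w'a) va≺vb)
    where
    w'b : perm w' b ≡ perm v a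
    w'b = trans (w'≗w b) (trans (w≗ b) (cong (perm v) (swap-b a≢b)))
    w'a : perm w' a ≡ perm v b
    w'a = trans (w'≗w a) (trans (w≗ a) (cong (perm v) (swap-a a b)))
  ...   | v' , length-w' , v'≗ = ℕₚ.<-≤-trans
    (subst (_ ℕ.<_) (sym length-w') (ℕ.s≤s (k-minimal v' λ μ j → trans (f≈v μ j) (perm⇒word {v} {v'} v≗v' μ j))))
    (double-reflects-≤ (≤-trans (≤-reflexive (trans (sym N≡w') (N-word {w} {u} λ μ j → trans (sym (g≈w μ j)) (g≈u μ j)))) (N≤double u)))
    where
    v≗v' : perm v ≗ perm v'
    v≗v' z = sym (trans (v'≗ z) (trans (w'≗w (swap a b z)) (trans (w≗ (swap a b z)) (cong (perm v) (swap-involutive a≢b z)))))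

-- Crossings

sum-nonNegative : {f : Fin n → ℤ} → (∀ r → 0ℤ ≤ f r) → 0ℤ ≤ sum f
sum-nonNegative {n} {f} 0≤f = subst (_≤ sum f) (sum-zero {n} (λ _ → 0ℤ) (λ _ → refl)) (sum-mono 0≤f)

term≤sum : {f : Fin n → ℤ} → (∀ r → 0ℤ ≤ f r) → ∀ i → f i ≤ sum f
term≤sum {f = f} 0≤f i = subst (_≤ sum f) (sum-α f i) (sum-mono λ r → by-cases r (i ≟ r))
  where
  by-cases : ∀ r → Dec (i ≡ r) → f r * α i r ≤ f r
  by-cases r (yes refl) = ≤-reflexive (trans (cong (_*_ (f r)) (α-refl r)) (*-identityʳ (f r)))
  by-cases r (no i≢r)   = subst (_≤ f r) (sym (trans (cong (_*_ (f r)) (α-≢ i≢r)) (*-zeroʳ (f r)))) (0≤f r)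

sum-shortfall : {f g : Fin n → ℤ} (h : Fin n → ℤ) → sum h ≡ 1ℤ → (∀ r → f r + h r ≤ g r) → sum f < sum g
sum-shortfall {f = f} {g} h Σh≡1 f+h≤g = 1+≤⇒< (subst (_≤ sum g)
  (trans (∑-distrib-+ f h) (trans (cong (_+_ (sum f)) Σh≡1) (+-comm (sum f) 1ℤ))) (sum-mono f+h≤g))

infix 9 _⁺

_⁺ : ℤ → ℤ
x ⁺ = x ⊔ 0ℤ

x≤x⁺ : ∀ x → x ≤ x ⁺
x≤x⁺ x = i≤i⊔j x 0ℤ

0≤x⁺ : ∀ x → 0ℤ ≤ x ⁺
0≤x⁺ x = i≤j⊔i x 0ℤ

⁺-lub : ∀ {x z} → x ≤ z → 0ℤ ≤ z → x ⁺ ≤ z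
⁺-lub = ⊔-lub

⁺-nonNegative : ∀ {x} → 0ℤ ≤ x → x ⁺ ≡ x
⁺-nonNegative = i≥j⇒i⊔j≡i

⁺-nonPositive : ∀ {x} → x ≤ 0ℤ → x ⁺ ≡ 0ℤ
⁺-nonPositive = i≤j⇒i⊔j≡j

⁺-parts : ∀ x → x ⁺ - (- x) ⁺ ≡ x
⁺-parts x with ≤-total 0ℤ x
... | inj₁ 0≤x = trans (cong₂ _-_ (⁺-nonNegative 0≤x) (⁺-nonPositive (neg-mono-≤ 0≤x))) (+-identityʳ x)
... | inj₂ x≤0 = trans (cong₂ _-_ (⁺-nonPositive x≤0) (⁺-nonNegative (neg-mono-≤ x≤0))) (lemma x)
  where
  lemma : ∀ x → 0ℤ - (- x) ≡ x
  lemma = solve-∀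

-- Effect of a swap at positions a ≤ b, with values x and y, on one cut.
exchange-chain : ∀ a b x y → a ≤ b →
                 (y - a) ⁺ + (x - b) ⁺ ≤ (x - a) ⁺ + (y - b) ⁺ + (b - a)
exchange-chain a b x y a≤b = linear₂
  (⁺-lub {y - a} {(y - b) ⁺ + (b - a)} (linear₁ (x≤x⁺ (y - b)) (lemma₁ a b y ((y - b) ⁺)))
    (+-mono-≤ (0≤x⁺ (y - b)) (i≤j⇒0≤j-i a≤b)))
  (⁺-lub {x - b} {(x - a) ⁺} (linear₂ (x≤x⁺ (x - a)) a≤b (lemma₂ a b x ((x - a) ⁺))) (0≤x⁺ (x - a)))
  (lemma₃ ((y - a) ⁺) ((x - b) ⁺) ((x - a) ⁺) ((y - b) ⁺) (b - a))
  where
  lemma₁ : ∀ a b y p → p + (b - a) - (y - a) ≡ p - (y - b)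
  lemma₁ = solve-∀
  lemma₂ : ∀ a b x p → p - (x - b) ≡ (p - (x - a)) + (b - a)
  lemma₂ = solve-∀
  lemma₃ : ∀ p q r s d → r + s + d - (p + q) ≡ (s + d - p) + (r - q)
  lemma₃ = solve-∀

-- If `b ≤ x`, both new differences are nonnegative and have the same sum as the old ones, which
-- truncation can only increase. If `y ≤ a`, both new terms vanish.
exchange-overlap : ∀ a b x y → a ≤ b → x ≤ y → b ≤ x ⊎ y ≤ a →
                   (y - a) ⁺ + (x - b) ⁺ ≤ (x - a) ⁺ + (y - b) ⁺
exchange-overlap a b x y a≤b x≤y (inj₁ b≤x) = subst (_≤ (x - a) ⁺ + (y - b) ⁺)
  (sym (trans (cong₂ _+_ (⁺-nonNegative (i≤j⇒0≤j-i (≤-trans a≤b (≤-trans b≤x x≤y)))) (⁺-nonNegative (i≤j⇒0≤j-i b≤x)))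
    (lemma a b x y)))
  (+-mono-≤ (x≤x⁺ (x - a)) (x≤x⁺ (y - b)))
  where
  lemma : ∀ a b x y → y - a + (x - b) ≡ x - a + (y - b)
  lemma = solve-∀
exchange-overlap a b x y a≤b x≤y (inj₂ y≤a) = subst (_≤ (x - a) ⁺ + (y - b) ⁺)
  (sym (cong₂ _+_ (⁺-nonPositive (i≤j⇒i-j≤0 y≤a)) (⁺-nonPositive (i≤j⇒i-j≤0 (≤-trans x≤y (≤-trans y≤a a≤b))))))
  (+-mono-≤ (0≤x⁺ (x - a)) (0≤x⁺ (y - b)))

-- After the swap one move runs from `a` to `y` across the gap and the other contributes nothing.
-- The part of that move on either side of the gap is already paid for, because on each side a
-- position or a value sits at the edge.
exchange-gap : ∀ a b x y e e' → e ≤ e' → a ≤ e → x ≤ e → a ≡ e ⊎ x ≡ e → e' ≤ b → e' ≤ y → b ≡ e' ⊎ y ≡ e' →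
               (y - a) ⁺ + (x - b) ⁺ ≤ (x - a) ⁺ + (y - b) ⁺ + (e' - e)
exchange-gap a b x y e e' e≤e' a≤e x≤e left e'≤b e'≤y right = subst (_≤ (x - a) ⁺ + (y - b) ⁺ + (e' - e))
  (sym (trans (cong₂ _+_ (⁺-nonNegative (i≤j⇒0≤j-i (≤-trans a≤e (≤-trans e≤e' e'≤y))))
                         (⁺-nonPositive (i≤j⇒i-j≤0 (≤-trans x≤e (≤-trans e≤e' e'≤b)))))
    (lemma a y e e')))
  (+-monoˡ-≤ (e' - e) (+-mono-≤ (left-part left) (right-part right)))
  where
  lemma : ∀ a y e e' → y - a + 0ℤ ≡ e - a + (y - e') + (e' - e)
  lemma = solve-∀
  left-part : a ≡ e ⊎ x ≡ e → e - a ≤ (x - a) ⁺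
  left-part (inj₁ refl) = ≤-trans (≤-reflexive (+-inverseʳ a)) (0≤x⁺ (x - a))
  left-part (inj₂ refl) = x≤x⁺ (x - a)
  right-part : b ≡ e' ⊎ y ≡ e' → y - e' ≤ (y - b) ⁺
  right-part (inj₁ refl) = x≤x⁺ (y - b)
  right-part (inj₂ refl) = ≤-trans (≤-reflexive (+-inverseʳ y)) (0≤x⁺ (y - b))

-- The cut k separates the points of residue k from their predecessors:
-- E y k - E x k counts the translates of this cut lying between x and y.
rise : (Pt n → Pt n) → Fin n → Pt n → ℤ
rise f k x = E (f x) k - E x k

opaque
  -- Points crossing one fixed cut are counted class by class: as many translates of `base r` cross
  -- it rightwards as `base r` itself crosses translates of the cut.
  crossing : (Pt n → Pt n) → Fin n → ℤ
  crossing f k = sum λ r → rise f k (base r) ⁺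

  crossing-def : (f : Pt n → Pt n) (k : Fin n) → crossing f k ≡ sum (λ r → rise f k (base r) ⁺)
  crossing-def f k = refl

opaque
  unfolding crossing

  crossing-cong : {f g : Pt n → Pt n} → f ≗ g → crossing f ≗ crossing g
  crossing-cong f≗g k = sum-cong-≗ λ r → cong (λ x → (E x k - E (base r) k) ⁺) (f≗g (base r))

  crossing-id : (k : Fin n) → crossing id k ≡ 0ℤ
  crossing-id k = sum-zero (λ r → rise id k (base r) ⁺) λ r → cong _⁺ (+-inverseʳ (E (base r) k))

rise-res : {f : Pt n → Pt n} → Affine f → ∀ k {x y} → res x ≡ res y → rise f k x ≡ rise f k y
rise-res {f = f} F k {x} {y} x≡y = trans (sym (displacement-shift F x k))
  (trans (cong (λ r → rise f k (base r)) x≡y) (displacement-shift F y k))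

opaque
  unfolding crossing

  crossing-swap : {f : Pt n → Pt n} → Affine f → {a b : Pt n} → res a ≢ res b → ∀ k →
    crossing (f ∘ swap a b) k ≡
    crossing f k + (((E (f b) k - E a k) ⁺ - rise f k a ⁺) + ((E (f a) k - E b k) ⁺ - rise f k b ⁺))
  crossing-swap {n} {f = f} F {a} {b} a≢b k = trans
    (sum-update (λ r → rise (f ∘ swap a b) k (base r) ⁺) (λ r → rise f k (base r) ⁺) a≢b
      λ r r≢a r≢b → cong (λ x → (E (f x) k - E (base r) k) ⁺) (swap-fixed a b r≢a r≢b))
    (cong (_+_ (crossing f k)) (cong₂ _+_
      (cong₂ _-_ (cong _⁺ (trans (rise-res G k {base (res a)} {a} refl) (cong (λ x → E (f x) k - E a k) (swap-a a b))))
                 (cong _⁺ (rise-res F k {base (res a)} {a} refl)))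
      (cong₂ _-_ (cong _⁺ (trans (rise-res G k {base (res b)} {b} refl) (cong (λ x → E (f x) k - E b k) (swap-b a≢b))))
                 (cong _⁺ (rise-res F k {base (res b)} {b} refl)))))
    where
    G : Affine (f ∘ swap a b)
    G = affine-∘ F (affine-swap a≢b)

crossing-swap-≤ : {f : Pt n → Pt n} → Affine f → {a b : Pt n} → res a ≢ res b → ∀ k {d} →
  (E (f b) k - E a k) ⁺ + (E (f a) k - E b k) ⁺ ≤ rise f k a ⁺ + rise f k b ⁺ + d →
  crossing (f ∘ swap a b) k ≤ crossing f k + d
crossing-swap-≤ {f = f} F {a} {b} a≢b k {d} ineq = linear₁ ineq
  (trans (cong (λ c → crossing f k + d - c) (crossing-swap F a≢b k))
    (lemma (crossing f k) ((E (f b) k - E a k) ⁺) ((E (f a) k - E b k) ⁺) (rise f k a ⁺) (rise f k b ⁺) d))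
  where
  lemma : ∀ c p q r s d → c + d - (c + ((p - r) + (q - s))) ≡ r + s + d - (p + q)
  lemma = solve-∀

-- The normalisation of affine permutations by total displacement zero, stated at each cut: as many
-- points cross it leftwards as rightwards. This selects the Weyl group among all affine
-- permutations.
Balanced : (Pt n → Pt n) → Set
Balanced f = ∀ k → sum (λ r → rise f k (base r)) ≡ 0ℤ

balanced-id : Balanced {n} id
balanced-id k = sum-zero (λ r → rise id k (base r)) λ r → +-inverseʳ (E (base r) k)

balanced-swap : {f : Pt n → Pt n} → Affine f → Balanced f → {a b : Pt n} → res a ≢ res b → Balanced (swap a b ∘ f)
balanced-swap {f = f} F bal {a} {b} a≢b k = begin
  sum (λ r → E (swap a b (f (base r))) k - E (base r) k)
    ≡⟨ sum-cong-≗ (λ r → trans (cong (_- E (base r) k) (E-swap a≢b (f (base r)) k))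
         (trans (lemma (E (f (base r)) k) (E (base r) k) _ _ d)
           (cong₂ (λ u v → rise f k (base r) + (d * u - d * v)) (α-inverse F a r) (α-inverse F b r)))) ⟩
  sum (λ r → rise f k (base r) + (d * α X r - d * α Y r))
    ≡⟨ ∑-distrib-+ (λ r → rise f k (base r)) (λ r → d * α X r - d * α Y r) ⟩
  sum (λ r → rise f k (base r)) + sum (λ r → d * α X r - d * α Y r)
    ≡⟨ cong₂ _+_ (bal k) (trans (sum-sub (λ r → d * α X r) (λ r → d * α Y r))
         (trans (cong₂ _-_ (sum-α (λ _ → d) X) (sum-α (λ _ → d) Y)) (+-inverseʳ d))) ⟩
  0ℤ ∎
  where
  open ≡-Reasoning
  X = res (Affine.f⁻¹ F a)
  Y = res (Affine.f⁻¹ F b)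
  d = E b k - E a k
  lemma : ∀ e e' p q d → e + (p - q) * d - e' ≡ e - e' + (d * p - d * q)
  lemma = solve-∀

opaque
  descent : (Pt n → Pt n) → Fin n → ℤ
  descent f k = sum λ r → (- rise f k (base r)) ⁺

  descent-def : (f : Pt n → Pt n) (k : Fin n) → descent f k ≡ sum (λ r → (- rise f k (base r)) ⁺)
  descent-def f k = refl

opaque
  unfolding crossing descent

  descent≡crossing : {f : Pt n → Pt n} → Balanced f → descent f ≗ crossing f
  descent≡crossing {f = f} bal k = sym (m-n≡0 (trans (sym (sum-sub (λ r → rise f k (base r) ⁺) (λ r → (- rise f k (base r)) ⁺)))
    (trans (sum-cong-≗ (λ r → ⁺-parts (rise f k (base r)))) (bal k))))
    where
    m-n≡0 : ∀ {x y} → x - y ≡ 0ℤ → x ≡ y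
    m-n≡0 {x} {y} = i-j≡0⇒i≡j x y

rise-next : (f : Pt n → Pt n) (x : Pt n) (k : Fin n) → rise f k x ≡ rise f (next k) x + (α (res (f x)) k - α (res x) k)
rise-next f x k = trans (lemma₁ (E (f x) k) (E (f x) (next k)) (E x k) (E x (next k)))
  (cong (_+_ (rise f (next k) x)) (trans (cong₂ _-_ (E-next (f x) k) (E-next x k)) (lemma₂ (α (res (f x)) k) (α (res x) k) (carry k))))
  where
  lemma₁ : ∀ a a' b b' → a - b ≡ a' - b' + ((a - a') - (b - b'))
  lemma₁ = solve-∀
  lemma₂ : ∀ a b c → (a - c) - (b - c) ≡ a - b
  lemma₂ = solve-∀

module _ {f : Pt n → Pt n} (F : Affine f) where

  open Affine F

  same-residue-image : ∀ {u x} → res (f x) ≡ res u → ∃[ l ] f x ≡ shift l u × x ≡ shift l (f⁻¹ u)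
  same-residue-image {u} {x} fx≡u = l , fx≡ , trans (sym (f⁻¹-f x)) (trans (cong f⁻¹ fx≡) (f⁻¹-shift l u))
    where
    l = proj₂ (f x) - proj₂ u
    fx≡ : f x ≡ shift l u
    fx≡ = sym (shift-between (f x) u fx≡u)

  moves-with : ∀ {u x} → res x ≡ res u → ∃[ l ] x ≡ shift l u × f x ≡ shift l (f u)
  moves-with {u} {x} x≡u = proj₂ x - proj₂ u , sym (shift-between x u x≡u) , f-shift-between F x≡u

  -- The crossings of the cuts before and after u differ only by the points leaving u and arriving at u.
  crossing-next-> : ∀ u → u ≺ f u → u ≺ f⁻¹ u → crossing f (res u) < crossing f (next (res u))
  crossing-next-> u u≺fu u≺f⁻¹u = subst₂ _<_ (sym (crossing-def f (res u))) (sym (crossing-def f (next (res u)))) (sum-shortfall (α k) (sum-α₁ k) λ r → pointwise (base r) (k ≟ r) (res (f (base r)) ≟ k))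
    where
    k = res u
    fx≺x : ∀ {x} → res (f x) ≡ k → f x ≺ x
    fx≺x fx≡k with same-residue-image {u} fx≡k
    ... | l , fx≡ , x≡ = subst₂ _≺_ (sym fx≡) (sym x≡) (shift-≺ l {u} {f⁻¹ u} u≺f⁻¹u)
    pointwise : ∀ x → Dec (k ≡ res x) → Dec (res (f x) ≡ k) → rise f k x ⁺ + α k (res x) ≤ rise f (next k) x ⁺
    pointwise x (yes k≡x) (yes fx≡k) with moves-with {u} {x} (sym k≡x)
    ... | l , x≡ , fx≡ = contradiction (fx≺x fx≡k) (<-asym (subst₂ _≺_ (sym x≡) (sym fx≡) (shift-≺ l {u} {f u} u≺fu)))
    pointwise x (yes k≡x) (no fx≢k) = begin
      rise f k x ⁺ + α k (res x)
        ≡⟨ cong₂ _+_ (cong _⁺ rise≡) (trans (cong (α k) (sym k≡x)) (α-refl k)) ⟩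
      (rise f (next k) x - 1ℤ) ⁺ + 1ℤ
        ≡⟨ cong (_+ 1ℤ) (⁺-nonNegative (i≤j⇒0≤j-i 1≤rise)) ⟩
      rise f (next k) x - 1ℤ + 1ℤ
        ≡⟨ lemma (rise f (next k) x) ⟩
      rise f (next k) x
        ≤⟨ x≤x⁺ (rise f (next k) x) ⟩
      rise f (next k) x ⁺ ∎
      where
      open ≤-Reasoning
      lemma : ∀ a → a - 1ℤ + 1ℤ ≡ a
      lemma = solve-∀
      rise≡ : rise f k x ≡ rise f (next k) x - 1ℤ
      rise≡ = trans (rise-next f x k) (cong (_+_ (rise f (next k) x)) (cong₂ _-_ (α-≢ fx≢k) (trans (cong (λ j → α j k) (sym k≡x)) (α-refl k))))
      1≤rise : 1ℤ ≤ rise f (next k) x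
      1≤rise = subst (1ℤ ≤_) (rise-res F (next k) {u} {x} k≡x) (linear₁ (E-mono (succ≼ {x = u} {f u} u≺fu) (next k))
        (trans (lemma₂ (E (f u) (next k)) (E u (next k))) (cong (λ z → E (f u) (next k) - z)
          (sym (trans (E-succ u (next k)) (cong (_+_ (E u (next k))) (α-refl (next k))))))))
        where
        lemma₂ : ∀ a b → a - b - 1ℤ ≡ a - (b + 1ℤ)
        lemma₂ = solve-∀
    pointwise x (no k≢x) (yes fx≡k) = ≤-trans
      (≤-reflexive (cong₂ _+_ (⁺-nonPositive (i≤j⇒i-j≤0 (E-mono (<⇒≤ (fx≺x fx≡k)) k))) (α-≢ k≢x)))
      (0≤x⁺ (rise f (next k) x))
    pointwise x (no k≢x) (no fx≢k) = ≤-reflexive (trans (cong₂ _+_ (cong _⁺ (trans (rise-next f x k)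
      (trans (cong (_+_ (rise f (next k) x)) (cong₂ _-_ (α-≢ fx≢k) (α-≢ (k≢x ∘ sym)))) (+-identityʳ (rise f (next k) x))))) (α-≢ k≢x)) (+-identityʳ (rise f (next k) x ⁺)))

  -- Mirror image: the point arriving at `u` from the left crosses the cut before `u` but not the
  -- one after it. The gain is therefore indexed by the residue of the image, and sits at the class
  -- of `f⁻¹ u`.
  crossing-next-< : ∀ u → f u ≺ u → f⁻¹ u ≺ u → crossing f (next (res u)) < crossing f (res u)
  crossing-next-< u fu≺u f⁻¹u≺u = subst₂ _<_ (sym (crossing-def f (next (res u)))) (sym (crossing-def f (res u))) (sum-shortfall (λ r → α k (res (f (base r))))
    (trans (sum-cong-≗ (α-inverse F u)) (sum-α₁ (res (f⁻¹ u))))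
    λ r → pointwise (base r) (res (base r) ≟ k) (k ≟ res (f (base r))))
    where
    k = res u
    x≺fx : ∀ {x} → k ≡ res (f x) → x ≺ f x
    x≺fx k≡fx with same-residue-image {u} (sym k≡fx)
    ... | l , fx≡ , x≡ = subst₂ _≺_ (sym x≡) (sym fx≡) (shift-≺ l {f⁻¹ u} {u} f⁻¹u≺u)
    fx≺x : ∀ {x} → res x ≡ k → f x ≺ x
    fx≺x x≡k with moves-with {u} x≡k
    ... | l , x≡ , fx≡ = subst₂ _≺_ (sym fx≡) (sym x≡) (shift-≺ l {f u} {u} fu≺u)
    pointwise : ∀ x → Dec (res x ≡ k) → Dec (k ≡ res (f x)) → rise f (next k) x ⁺ + α k (res (f x)) ≤ rise f k x ⁺
    pointwise x (yes x≡k) (yes k≡fx) = contradiction (x≺fx k≡fx) (<-asym (fx≺x x≡k))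
    pointwise x (no x≢k) (yes k≡fx) = begin
      rise f (next k) x ⁺ + α k (res (f x))
        ≡⟨ cong₂ _+_ (⁺-nonNegative (i≤j⇒0≤j-i (E-mono (<⇒≤ (x≺fx k≡fx)) (next k)))) (trans (cong (α k) (sym k≡fx)) (α-refl k)) ⟩
      rise f (next k) x + (1ℤ - 0ℤ)
        ≡⟨ cong (_+_ (rise f (next k) x)) (cong₂ _-_ (sym (trans (cong (λ j → α j k) (sym k≡fx)) (α-refl k))) (sym (α-≢ x≢k))) ⟩
      rise f (next k) x + (α (res (f x)) k - α (res x) k)
        ≡⟨ rise-next f x k ⟨
      rise f k x
        ≤⟨ x≤x⁺ (rise f k x) ⟩
      rise f k x ⁺ ∎
      where open ≤-Reasoning
    pointwise x (yes x≡k) (no k≢fx) = ≤-trans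
      (≤-reflexive (cong₂ _+_ (⁺-nonPositive (i≤j⇒i-j≤0 (E-mono (<⇒≤ (fx≺x x≡k)) (next k)))) (α-≢ k≢fx)))
      (0≤x⁺ (rise f k x))
    pointwise x (no x≢k) (no k≢fx) = ≤-reflexive (trans (cong₂ _+_ (cong _⁺ (sym (trans (rise-next f x k)
      (trans (cong (_+_ (rise f (next k) x)) (cong₂ _-_ (α-≢ (k≢fx ∘ sym)) (α-≢ x≢k))) (+-identityʳ (rise f (next k) x)))))) (α-≢ k≢fx)) (+-identityʳ (rise f k x ⁺)))

-- Ascents

fin-choice : {A : Set} {P : Fin n → Set} → (∀ r → A ⊎ P r) → A ⊎ (∀ r → P r)
fin-choice {ℕ.zero} choice = inj₂ λ ()
fin-choice {ℕ.suc n} choice with choice zero | fin-choice (choice ∘ suc)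
... | inj₁ a | _       = inj₁ a
... | inj₂ _ | inj₁ a  = inj₁ a
... | inj₂ p | inj₂ ps = inj₂ λ { zero → p ; (suc r) → ps r }

fin-minimum : (g : Fin (ℕ.suc n) → ℤ) → ∃[ i ] (∀ j → g i ≤ g j)
fin-minimum {ℕ.zero} g = zero , λ { zero → ≤-refl }
fin-minimum {ℕ.suc n} g with fin-minimum (g ∘ suc)
... | i , i-min with ≤-total (g zero) (g (suc i))
...   | inj₁ g0≤gi = zero , λ { zero → ≤-refl ; (suc j) → ≤-trans g0≤gi (i-min j) }
...   | inj₂ gi≤g0 = suc i , λ { zero → gi≤g0 ; (suc j) → i-min j }

shift-mono : {k l : ℤ} → k ≤ l → (x : Pt n) → shift k x ≼ shift l x
shift-mono {n} {k} {l} k≤l x = subst₂ _≤_ (sym (place-shift k x)) (sym (place-shift l x))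
  (+-monoʳ-≤ (place x) (*-monoʳ-≤-nonNeg (+ n) {k} {l} k≤l))

≼-≢-res : {x y : Pt n} → x ≼ y → res x ≢ res y → x ≺ y
≼-≢-res x≼y x≢y = ≼∧≢⇒≺ x≼y (x≢y ∘ cong res)

-- Shifting by `- φ x y` brings the distance from `x` into [0, n), and distinct residues exclude 0.
between : {x y : Pt n} → res x ≢ res y → ∃[ j ] x ≺ shift j y × shift j y ≺ shift 1ℤ x
between {x = x} {y} x≢y = j , ≼-≢-res (φ⇒≼ (≤-reflexive (sym φ≡0))) x≢y ,
  ≼-≢-res (φ⇒≼ (≤-reflexive (sym φ'≡0))) (x≢y ∘ sym)
  where
  j = - φ x y
  φ≡0 : φ x (shift j y) ≡ 0ℤ
  φ≡0 = trans (φ-shiftʳ j x y) (+-inverseʳ (φ x y))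
  lemma : ∀ a b → (b + 1ℤ) - (- a) ≡ a + b + 1ℤ
  lemma = solve-∀
  φ'≡0 : φ (shift j y) (shift 1ℤ x) ≡ 0ℤ
  φ'≡0 = trans (φ-shiftˡ j y (shift 1ℤ x)) (trans (cong (_- j) (φ-shiftʳ 1ℤ y x))
    (trans (lemma (φ x y) (φ y x)) (cong (_+ 1ℤ) (φ-antisym {x = x} {y} x≢y))))

-- The two order conditions make `f ∘ swap a b` longer than `f`, and `bounded` passes the crossing
-- bound on to it.
record Ascent {n : ℕ} (m : ℤ) (f : Pt n → Pt n) : Set where
  field
    a b     : Pt n
    a≢b     : res a ≢ res b
    a≺b     : a ≺ b
    fa≺fb   : f a ≺ f b
    bounded : ∀ k → crossing (f ∘ swap a b) k ≤ m

record Translation {n : ℕ} (m : ℤ) (f : Pt n → Pt n) : Set where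
  field
    right left  : Fin n
    right≢left  : right ≢ left
    right-moves : f (base right) ≡ shift m (base right)
    left-moves  : f (base left) ≡ shift (- m) (base left)
    fixed       : ∀ r → r ≢ right → r ≢ left → f (base r) ≡ base r

module _ {f : Pt n → Pt n} (F : Affine f) {m : ℤ} (crossing≤m : ∀ k → crossing f k ≤ m) where

  open Affine F

  overlap-ascent : {a b : Pt n} → res a ≢ res b → a ≺ b → f a ≺ f b → b ≼ f a ⊎ f b ≼ a → Ascent m f
  overlap-ascent {a} {b} a≢b a≺b fa≺fb cover = record
    { a = a ; b = b ; a≢b = a≢b ; a≺b = a≺b ; fa≺fb = fa≺fb
    ; bounded = λ k → ≤-trans (crossing-swap-≤ F a≢b k {0ℤ} (≤-trans
        (exchange-overlap (E a k) (E b k) (E (f a) k) (E (f b) k) (E-mono (<⇒≤ a≺b) k) (E-mono (<⇒≤ fa≺fb) k) (levels k cover))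
        (≤-reflexive (sym (+-identityʳ _)))))
        (≤-trans (≤-reflexive (+-identityʳ (crossing f k))) (crossing≤m k))
    }
    where
    levels : ∀ k → b ≼ f a ⊎ f b ≼ a → E b k ≤ E (f a) k ⊎ E (f b) k ≤ E a k
    levels k (inj₁ b≼fa) = inj₁ (E-mono b≼fa k)
    levels k (inj₂ fb≼a) = inj₂ (E-mono fb≼a k)

  -- `E (succ u) - E u` is a simple root, so the swap can cost a crossing only at the cut between
  -- `u` and `succ u`; this is where the slack is spent.
  gap-ascent : (u : Pt n) → crossing f (res (succ u)) < m → {a b : Pt n} → res a ≢ res b →
               a ≼ u → f a ≼ u → a ≡ u ⊎ f a ≡ u →
               succ u ≼ b → succ u ≼ f b → b ≡ succ u ⊎ f b ≡ succ u → Ascent m f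
  gap-ascent u slack {a} {b} a≢b a≼u fa≼u left u⁺≼b u⁺≼fb right = record
    { a = a ; b = b ; a≢b = a≢b
    ; a≺b = ≤-<-trans a≼u (<-≤-trans (≺succ u) u⁺≼b)
    ; fa≺fb = ≤-<-trans fa≼u (<-≤-trans (≺succ u) u⁺≼fb)
    ; bounded = λ k → ≤-trans (crossing-swap-≤ F a≢b k (exchange-gap (E a k) (E b k) (E (f a) k) (E (f b) k) (E u k) (E (succ u) k)
        (E-mono (<⇒≤ (≺succ u)) k) (E-mono a≼u k) (E-mono fa≼u k) (levels k left)
        (E-mono u⁺≼b k) (E-mono u⁺≼fb k) (levels k right)))
        (≤-trans (≤-reflexive (cong (λ z → crossing f k + z) (trans (cong (_- E u k) (E-succ u k)) (cancel (E u k) (α (res (succ u)) k)))))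
          (by-cases k (res (succ u) ≟ k)))
    }
    where
    cancel : ∀ e a → e + a - e ≡ a
    cancel = solve-∀
    levels : ∀ k {x y v} → x ≡ v ⊎ y ≡ v → E x k ≡ E v k ⊎ E y k ≡ E v k
    levels k (inj₁ eq) = inj₁ (cong (λ z → E z k) eq)
    levels k (inj₂ eq) = inj₂ (cong (λ z → E z k) eq)
    by-cases : ∀ k → Dec (res (succ u) ≡ k) → crossing f k + α (res (succ u)) k ≤ m
    by-cases k (yes refl) = subst (λ z → crossing f k + z ≤ m) (sym (α-refl (res (succ u))))
      (subst (_≤ m) (+-comm 1ℤ (crossing f k)) (<⇒1+≤ slack))
    by-cases k (no ≢k) = subst (λ z → crossing f k + z ≤ m) (sym (α-≢ ≢k))
      (subst (_≤ m) (sym (+-identityʳ (crossing f k))) (crossing≤m k))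

  -- If `u` moved right and were also entered from the right, the cut before `u` would be crossed
  -- strictly less often. Minimality thus leaves `f u ≼ u` or `f⁻¹ u ≼ u`: some move has one end at
  -- `u` and the other no further right. The same holds, reflected, at `succ u`.
  slack-ascent : (u : Pt n) → res u ≢ res (succ u) → crossing f (res (succ u)) < m →
                 (∀ k → crossing f (res (succ u)) ≤ crossing f k) → Ascent m f
  slack-ascent u u≢u⁺ slack minimal = by-cases (place (f u) ≤? place u) (place u⁺ ≤? place (f u⁺))
    where
    u⁺ = succ u
    left-entry : ¬ f u ≼ u → f⁻¹ u ≼ u
    left-entry fu⋠u = ≮⇒≥ λ u≺f⁻¹u → <⇒≱ (crossing-next-> F u (≰⇒> fu⋠u) u≺f⁻¹u) (minimal (res u))
    right-entry : ¬ u⁺ ≼ f u⁺ → u⁺ ≼ f⁻¹ u⁺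
    right-entry u⁺⋠fu⁺ = ≮⇒≥ λ f⁻¹u⁺≺u⁺ → <⇒≱ (crossing-next-< F u⁺ (≰⇒> u⁺⋠fu⁺) f⁻¹u⁺≺u⁺) (minimal (next (res u⁺)))
    at : ∀ {x y} → x ≡ y → x ≼ y
    at eq = ≤-reflexive (cong place eq)
    by-cases : Dec (f u ≼ u) → Dec (u⁺ ≼ f u⁺) → Ascent m f
    by-cases (yes fu≼u) (yes u⁺≼fu⁺) =
      gap-ascent u slack u≢u⁺ ≤-refl fu≼u (inj₁ refl) ≤-refl u⁺≼fu⁺ (inj₁ refl)
    by-cases (no fu⋠u) (no u⁺⋠fu⁺) =
      gap-ascent u slack (u≢u⁺ ∘ res-injective (affine-inverse F)) (left-entry fu⋠u) (at (f-f⁻¹ u)) (inj₂ (f-f⁻¹ u))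
        (right-entry u⁺⋠fu⁺) (at (sym (f-f⁻¹ u⁺))) (inj₂ (f-f⁻¹ u⁺))
    by-cases (yes fu≼u) (no u⁺⋠fu⁺) = resolve (res u ≟ res (f⁻¹ u⁺))
      where
      resolve : Dec (res u ≡ res (f⁻¹ u⁺)) → Ascent m f
      resolve (no u≢b) = gap-ascent u slack u≢b ≤-refl fu≼u (inj₁ refl)
        (right-entry u⁺⋠fu⁺) (at (sym (f-f⁻¹ u⁺))) (inj₂ (f-f⁻¹ u⁺))
      -- The two candidates are translates of each other and cannot be swapped. Instead `u⁺` itself
      -- moves left and the move of `f⁻¹ u⁺` ends at `u⁺`, so these two moves abut. The other mixed
      -- case is its reflection.
      resolve (yes u≡b) = overlap-ascent u⁺≢b (≼-≢-res (right-entry u⁺⋠fu⁺) u⁺≢b)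
        (<-≤-trans (≰⇒> u⁺⋠fu⁺) (at (sym (f-f⁻¹ u⁺)))) (inj₂ (at (f-f⁻¹ u⁺)))
        where
        u⁺≢b : res u⁺ ≢ res (f⁻¹ u⁺)
        u⁺≢b eq = u≢u⁺ (trans u≡b (sym eq))
    by-cases (no fu⋠u) (yes u⁺≼fu⁺) = resolve (res (f⁻¹ u) ≟ res u⁺)
      where
      resolve : Dec (res (f⁻¹ u) ≡ res u⁺) → Ascent m f
      resolve (no a≢u⁺) = gap-ascent u slack a≢u⁺ (left-entry fu⋠u) (at (f-f⁻¹ u)) (inj₂ (f-f⁻¹ u))
        ≤-refl u⁺≼fu⁺ (inj₁ refl)
      resolve (yes a≡u⁺) = overlap-ascent a≢u (≼-≢-res (left-entry fu⋠u) a≢u)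
        (≤-<-trans (at (f-f⁻¹ u)) (≰⇒> fu⋠u)) (inj₁ (at (sym (f-f⁻¹ u))))
        where
        a≢u : res (f⁻¹ u) ≢ res u
        a≢u eq = u≢u⁺ (trans (sym eq) a≡u⁺)

  -- Take the translate b of `y` between `x` and its next translate. Since `k ≤ l` the images keep
  -- their order, and a shift by at least one whole window carries `f x` past b, or `f b` below `x`.
  shifting-ascent : {x y : Pt n} {k l : ℤ} → res x ≢ res y → f x ≡ shift k x → f y ≡ shift l y → k ≤ l →
                    1ℤ ≤ k ⊎ l ≤ -1ℤ → Ascent m f
  shifting-ascent {x} {y} {k} {l} x≢y fx≡ fy≡ k≤l direction with between {x = x} {y} x≢y
  ... | j , x≺b , b≺x⁺ = overlap-ascent x≢y x≺b fx≺fb (cover direction)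
    where
    b = shift j y
    fb≡ : f b ≡ shift l b
    fb≡ = trans (f-shift j y) (trans (cong (shift j) fy≡)
      (trans (shift-shift j l y) (trans (cong (λ z → shift z y) (+-comm l j)) (sym (shift-shift l j y)))))
    fx≺fb : f x ≺ f b
    fx≺fb = subst₂ _≺_ (sym fx≡) (sym fb≡) (<-≤-trans (shift-≺ k {x} {b} x≺b) (shift-mono k≤l b))
    cover : 1ℤ ≤ k ⊎ l ≤ -1ℤ → b ≼ f x ⊎ f b ≼ x
    cover (inj₁ 1≤k)  = inj₁ (≤-trans (<⇒≤ b≺x⁺) (subst (shift 1ℤ x ≼_) (sym fx≡) (shift-mono 1≤k x)))
    cover (inj₂ l≤-1) = inj₂ (subst₂ _≼_ (sym fb≡) (trans (shift-shift -1ℤ 1ℤ x) (shift-zero x))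
      (≤-trans (shift-mono l≤-1 b) (<⇒≤ (shift-≺ -1ℤ {b} {shift 1ℤ x} b≺x⁺))))

  shift-of : ∀ {x} → res (f x) ≡ res x → ∃[ l ] f x ≡ shift l x
  shift-of {x} fx≡x = _ , sym (shift-between (f x) x fx≡x)

  shift-right : ∀ {l} {x : Pt n} → f x ≡ shift l x → x ≺ f x → 1ℤ ≤ l
  shift-right {l} {x} fx≡ x≺fx = ≮⇒≥ λ l<1 → <⇒≱ x≺fx (subst (_≼ x) (sym fx≡)
    (subst (shift l x ≼_) (shift-zero x) (shift-mono (linear₁ (<⇒1+≤ l<1) (lemma l)) x)))
    where
    lemma : ∀ l → 0ℤ - l ≡ 1ℤ - (1ℤ + l)
    lemma = solve-∀

  shift-left : ∀ {l} {x : Pt n} → f x ≡ shift l x → f x ≺ x → l ≤ -1ℤ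
  shift-left {l} {x} fx≡ fx≺x = ≮⇒≥ λ -1<l → <⇒≱ fx≺x (subst (x ≼_) (sym fx≡)
    (subst (_≼ shift l x) (shift-zero x) (shift-mono (<⇒1+≤ -1<l) x)))

  module _ (constant : ∀ k → crossing f k ≡ m) where

    -- Let `u = f x`. If `u` moved left although it is entered from the left, neighbouring cuts
    -- would have different crossing numbers; and `u` is not fixed, by injectivity. So the moves of
    -- `x` and `u` abut and can be swapped unless their residues agree.
    right-step : ∀ x → x ≺ f x → Ascent m f ⊎ res (f x) ≡ res x
    right-step x x≺fx = by-cases (res (f x) ≟ res x)
      where
      u = f x
      u≺fu : u ≺ f u
      u≺fu = ≼∧≢⇒≺ (≮⇒≥ λ fu≺u → <-irrefl (trans (constant _) (sym (constant _)))
        (crossing-next-< F u fu≺u (subst (_≺ u) (sym (f⁻¹-f x)) x≺fx)))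
        (λ u≡fu → <-irrefl (cong place (f-injective u≡fu)) x≺fx)
      by-cases : Dec (res (f x) ≡ res x) → Ascent m f ⊎ res (f x) ≡ res x
      by-cases (yes eq) = inj₂ eq
      by-cases (no neq) = inj₁ (overlap-ascent (neq ∘ sym) x≺fx u≺fu (inj₁ ≤-refl))

    left-step : ∀ x → f x ≺ x → Ascent m f ⊎ res (f x) ≡ res x
    left-step x fx≺x = by-cases (res (f x) ≟ res x)
      where
      u = f x
      fu≺u : f u ≺ u
      fu≺u = ≼∧≢⇒≺ (≮⇒≥ λ u≺fu → <-irrefl (trans (constant _) (sym (constant _)))
        (crossing-next-> F u u≺fu (subst (u ≺_) (sym (f⁻¹-f x)) fx≺x)))
        (λ fu≡u → <-irrefl (cong place (f-injective fu≡u)) fx≺x)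
      by-cases : Dec (res (f x) ≡ res x) → Ascent m f ⊎ res (f x) ≡ res x
      by-cases (yes eq) = inj₂ eq
      by-cases (no neq) = inj₁ (overlap-ascent neq fx≺x fu≺u (inj₂ ≤-refl))

    -- By `right-step` both classes are shifted by whole windows, or there is already an ascent. The
    -- class with the smaller shift takes the left position in `shifting-ascent`.
    unique-right : {p : Fin n} → base p ≺ f (base p) → ∀ r → Ascent m f ⊎ (r ≢ p → f (base r) ≼ base r)
    unique-right {p} p≺ r = by-cases (place (f (base r)) ≤? place (base r)) (p ≟ r)
      where
      by-cases : Dec (f (base r) ≼ base r) → Dec (p ≡ r) → Ascent m f ⊎ (r ≢ p → f (base r) ≼ base r)
      by-cases (yes r≽) _ = inj₂ λ _ → r≽
      by-cases _ (yes p≡r) = inj₂ λ r≢p → contradiction (sym p≡r) r≢p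
      by-cases (no r⋡) (no p≢r) with right-step (base p) p≺ | right-step (base r) (≰⇒> r⋡)
      ... | inj₁ ascent | _ = inj₁ ascent
      ... | inj₂ _ | inj₁ ascent = inj₁ ascent
      ... | inj₂ p-same | inj₂ r-same with shift-of {base p} p-same | shift-of {base r} r-same
      ...   | k , fp≡ | l , fr≡ with ≤-total k l
      ...     | inj₁ k≤l = inj₁ (shifting-ascent p≢r fp≡ fr≡ k≤l (inj₁ (shift-right fp≡ p≺)))
      ...     | inj₂ l≤k = inj₁ (shifting-ascent (p≢r ∘ sym) fr≡ fp≡ l≤k (inj₁ (shift-right fr≡ (≰⇒> r⋡))))

    unique-left : {q : Fin n} → f (base q) ≺ base q → ∀ r → Ascent m f ⊎ (r ≢ q → base r ≼ f (base r))
    unique-left {q} q≻ r = by-cases (place (base r) ≤? place (f (base r))) (q ≟ r)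
      where
      by-cases : Dec (base r ≼ f (base r)) → Dec (q ≡ r) → Ascent m f ⊎ (r ≢ q → base r ≼ f (base r))
      by-cases (yes r≼) _ = inj₂ λ _ → r≼
      by-cases _ (yes q≡r) = inj₂ λ r≢q → contradiction (sym q≡r) r≢q
      by-cases (no r⋠) (no q≢r) with left-step (base q) q≻ | left-step (base r) (≰⇒> r⋠)
      ... | inj₁ ascent | _ = inj₁ ascent
      ... | inj₂ _ | inj₁ ascent = inj₁ ascent
      ... | inj₂ q-same | inj₂ r-same with shift-of {base q} q-same | shift-of {base r} r-same
      ...   | k , fq≡ | l , fr≡ with ≤-total k l
      ...     | inj₁ k≤l = inj₁ (shifting-ascent q≢r fq≡ fr≡ k≤l (inj₂ (shift-left fr≡ (≰⇒> r⋠))))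
      ...     | inj₂ l≤k = inj₁ (shifting-ascent (q≢r ∘ sym) fr≡ fq≡ l≤k (inj₂ (shift-left fq≡ q≻)))

    right-mover : 0ℤ < m → Fin n → ∃[ p ] base p ≺ f (base p)
    right-mover 0<m k with fin-choice (λ r → by-cases r (place (f (base r)) ≤? place (base r)))
      where
      by-cases : ∀ r → Dec (f (base r) ≼ base r) → (∃[ p ] base p ≺ f (base p)) ⊎ f (base r) ≼ base r
      by-cases r (yes r≽) = inj₂ r≽
      by-cases r (no r⋡)  = inj₁ (r , ≰⇒> r⋡)
    ... | inj₁ mover = mover
    ... | inj₂ none  = contradiction (trans (sym (trans (crossing-def f k) (sum-zero (λ r → rise f k (base r) ⁺)
                         (λ r → ⁺-nonPositive (i≤j⇒i-j≤0 (E-mono (none r) k)))))) (constant k)) (<⇒≢ 0<m)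

    left-mover : Balanced f → 0ℤ < m → Fin n → ∃[ q ] f (base q) ≺ base q
    left-mover bal 0<m k with fin-choice (λ r → by-cases r (place (base r) ≤? place (f (base r))))
      where
      by-cases : ∀ r → Dec (base r ≼ f (base r)) → (∃[ q ] f (base q) ≺ base q) ⊎ base r ≼ f (base r)
      by-cases r (yes r≼) = inj₂ r≼
      by-cases r (no r⋠)  = inj₁ (r , ≰⇒> r⋠)
    ... | inj₁ mover = mover
    ... | inj₂ none  = contradiction (trans (sym (trans (descent-def f k) (sum-zero (λ r → (- rise f k (base r)) ⁺)
                         (λ r → ⁺-nonPositive (neg-mono-≤ (i≤j⇒0≤j-i (E-mono (none r) k)))))))
                         (trans (descent≡crossing {f = f} bal k) (constant k))) (<⇒≢ 0<m)

    rise-shift : ∀ {l x} k → f x ≡ shift l x → rise f k x ≡ l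
    rise-shift {l} {x} k fx≡ = trans (cong (λ y → E y k - E x k) fx≡) (trans (cong (_- E x k) (E-shift l x k)) (lemma (E x k) l))
      where
      lemma : ∀ e l → e + l - e ≡ l
      lemma = solve-∀

    constant-step : Balanced f → 0ℤ < m → Fin n → Ascent m f ⊎ Translation m f
    constant-step bal 0<m k with right-mover 0<m k | left-mover bal 0<m k
    ... | p , p≺ | q , q≻ with fin-choice (unique-right p≺) | fin-choice (unique-left q≻)
                             | right-step (base p) p≺ | left-step (base q) q≻
    ... | inj₁ ascent | _ | _ | _ = inj₁ ascent
    ... | inj₂ _ | inj₁ ascent | _ | _ = inj₁ ascent
    ... | inj₂ _ | inj₂ _ | inj₁ ascent | _ = inj₁ ascent
    ... | inj₂ _ | inj₂ _ | inj₂ _ | inj₁ ascent = inj₁ ascent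
    ... | inj₂ only-p | inj₂ only-q | inj₂ p-same | inj₂ q-same with shift-of {base p} p-same | shift-of {base q} q-same
    ...   | l , fp≡ | l' , fq≡ = inj₂ record
      { right       = p
      ; left        = q
      ; right≢left  = λ { refl → <-asym p≺ q≻ }
      ; right-moves = trans fp≡ (cong (λ z → shift z (base p)) l≡m)
      ; left-moves  = trans fq≡ (cong (λ z → shift z (base q)) l'≡-m)
      ; fixed       = λ r r≢p r≢q → place-injective (≤-antisym (only-p r r≢p) (only-q r r≢q))
      }
      where
      -- No other class moves right, so the crossing number at `k` is the shift of this class alone.
      l≡m : l ≡ m
      l≡m = begin
        l                              ≡⟨ ⁺-nonNegative (≤-trans (+≤+ ℕ.z≤n) (shift-right fp≡ p≺)) ⟨
        l ⁺                            ≡⟨ cong _⁺ (rise-shift k fp≡) ⟨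
        rise f k (base p) ⁺            ≡⟨ trans (crossing-def f k) (sum-single _ p (λ r r≢p → ⁺-nonPositive (i≤j⇒i-j≤0 (E-mono (only-p r r≢p) k)))) ⟨
        crossing f k                   ≡⟨ constant k ⟩
        m ∎
        where open ≡-Reasoning
      l'≡-m : l' ≡ - m
      l'≡-m = begin
        l'                             ≡⟨ neg-involutive l' ⟨
        - (- l')                       ≡⟨ cong -_ (⁺-nonNegative (neg-mono-≤ { l' } {0ℤ} (≤-trans (shift-left fq≡ q≻) -≤+))) ⟨
        - (- l') ⁺                     ≡⟨ cong (λ z → - (- z) ⁺) (rise-shift k fq≡) ⟨
        - (- rise f k (base q)) ⁺      ≡⟨ cong -_ (trans (descent-def f k) (sum-single _ q (λ r r≢q → ⁺-nonPositive (neg-mono-≤ (i≤j⇒0≤j-i (E-mono (only-q r r≢q) k)))))) ⟨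
        - descent f k                  ≡⟨ cong -_ (trans (descent≡crossing {f = f} bal k) (constant k)) ⟩
        - m ∎
        where open ≡-Reasoning

ascent-or-translation : 3 ℕ.≤ n → {f : Pt n → Pt n} → Affine f → Balanced f → {m : ℤ} → 0ℤ < m →
                        (∀ k → crossing f k ≤ m) → Ascent m f ⊎ Translation m f
ascent-or-translation {ℕ.suc _} 3≤n {f} F bal {m} 0<m crossing≤m with fin-minimum (crossing f)
... | k , k-minimal = by-cases (m ≤? crossing f k)
  where
  u : Pt _
  u = lo k
  by-cases : Dec (m ≤ crossing f k) → Ascent m f ⊎ Translation m f
  -- If even the smallest crossing number reaches `m`, every cut is saturated.
  by-cases (yes m≤) = constant-step F crossing≤m (λ j → ≤-antisym (crossing≤m j) (≤-trans m≤ (k-minimal j))) bal 0<m k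
  by-cases (no m≰)  = inj₁ (slack-ascent F crossing≤m u (next≢ 3≤n (res u) ∘ sym)
    (subst (λ j → crossing f j < m) (sym (res-hi k)) (≰⇒> m≰))
    (subst (λ j → ∀ i → crossing f j ≤ crossing f i) (sym (res-hi k)) k-minimal))

-- Bruhat order and chains

≈-refl : {f : Map n} → f ≈ f
≈-refl _ _ = refl

≈-sym : {f g : Map n} → f ≈ g → g ≈ f
≈-sym f≈g μ k = sym (f≈g μ k)

≈-trans : {f g h : Map n} → f ≈ g → g ≈ h → f ≈ h
≈-trans f≈g g≈h μ k = trans (f≈g μ k) (g≈h μ k)

word∈Waff : (w : List (Fin n)) → word w ∈ Waff
word∈Waff w = w , universal (λ _ → tt) w , ≈-refl

Waff-resp : {f g : Map n} → f ≈ g → f ∈ Waff → g ∈ Waff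
Waff-resp f≈g (w , all , f≈w) = w , all , ≈-trans (≈-sym f≈g) f≈w

Length-resp : {f g : Map n} → f ≈ g → ∀ {k} → Length f k → Length g k
Length-resp f≈g ((w , f≈w , length≡) , minimal) =
  (w , ≈-trans (≈-sym f≈g) f≈w , length≡) , λ v g≈v → minimal v (≈-trans f≈g g≈v)

Length-unique : {f : Map n} → ∀ {k l} → Length f k → Length f l → k ≡ l
Length-unique ((v , f≈v , refl) , v-minimal) ((w , f≈w , refl) , w-minimal) =
  ℕₚ.≤-antisym (v-minimal w f≈w) (w-minimal v f≈v)

⟶-resp : {u v w : Map n} → v ≈ w → u ⟶ v → u ⟶ w
⟶-resp v≈w ((β , β∈ , v≈) , k , l , length-u , length-v , k<l) =
  (β , β∈ , ≈-trans (≈-sym v≈w) v≈) , k , l , length-u , Length-resp v≈w length-v , k<l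

≤ᴮ-resp : {u v w : Map n} → v ≈ w → u ≤ᴮ v → u ≤ᴮ w
≤ᴮ-resp v≈w (reflexive u∈ u≈v) = reflexive u∈ (≈-trans u≈v v≈w)
≤ᴮ-resp v≈w (step u≤ ⟶v)       = step u≤ (⟶-resp v≈w ⟶v)

≤ᴮ-trans : {u v w : Map n} → u ≤ᴮ v → v ≤ᴮ w → u ≤ᴮ w
≤ᴮ-trans u≤v (reflexive _ v≈w) = ≤ᴮ-resp v≈w u≤v
≤ᴮ-trans u≤v (step v≤ ⟶w)      = step (≤ᴮ-trans u≤v v≤) ⟶w

≤ᴮ-respˡ : {u v w : Map n} → v ∈ Waff → v ≈ u → u ≤ᴮ w → v ≤ᴮ w
≤ᴮ-respˡ v∈ v≈u = ≤ᴮ-trans (reflexive v∈ v≈u)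

-- The consequence needed for maximality is that Bruhat-comparable elements of equal length
-- coincide.
≤ᴮ-length : {u v : Map n} → u ≤ᴮ v → ∀ {k l} → Length u k → Length v l → u ≈ v ⊎ k ℕ.< l
≤ᴮ-length (reflexive _ u≈v) _ _ = inj₁ u≈v
≤ᴮ-length (step u≤v (_ , p , q , length-v , length-w , p<q)) length-u length-w' with ≤ᴮ-length u≤v length-u length-v
... | inj₁ u≈v = inj₂ (subst₂ ℕ._<_ (Length-unique length-v (Length-resp u≈v length-u)) (Length-unique length-w length-w') p<q)
... | inj₂ k<p = inj₂ (subst (_ ℕ.<_) (Length-unique length-w length-w') (ℕₚ.<-trans k<p p<q))

≤ᴮ-id : {u : Map n} → u ≤ᴮ id → u ≈ id
≤ᴮ-id (reflexive _ u≈id) = u≈id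
≤ᴮ-id (step _ (_ , k , l , _ , (_ , minimal) , k<l)) = contradiction (minimal [] ≈-refl) (ℕₚ.<⇒≱ (ℕₚ.≤-<-trans ℕ.z≤n k<l))

Chain-resp : {u v w : Map n} (p : Chain u v) → v ≈ w → Σ[ q ∈ Chain u w ] degree q ≗ degree p
Chain-resp ([] u∈ u≈v) v≈w = [] u∈ (≈-trans u≈v v≈w) , λ _ → refl
Chain-resp (_∷_ {β = β} e p) v≈w with Chain-resp p v≈w
... | q , degree-q = e ∷ q , λ i → cong (_+_ (β i)) (degree-q i)

sum-const : (n : ℕ) (a : ℤ) → sum {n} (λ _ → a) ≡ + n * a
sum-const ℕ.zero    a = refl
sum-const (ℕ.suc n) a = trans (cong (_+_ a) (sum-const n a)) (sym (suc-* (+ n) a))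

module _ (3≤n : 3 ℕ.≤ n) where

  word-s : {u : Map n} {β : Qaff n} (v w : List (Fin n)) {a b : Pt n} → u ≈ word v → res a ≢ res b →
           β ≗ E b ⊖ E a → perm w ≗ perm v ∘ swap a b → word w ≈ u ∘ s β
  word-s {u} {β} v w {a} {b} u≈v a≢b β≗ w≗ μ k =
    trans (word-act 3≤n w μ k)
    (trans (act-cong {f = perm w} {perm v ∘ swap a b} (w≗ ∘ base) μ k)
    (trans (sym (act-∘ (affine-perm 3≤n v) (swap a b) μ k))
    (trans (sym (act-≗ (perm v) {s β μ} {act (swap a b) μ} (s-act 3≤n {a} {b} a≢b {β} β≗ μ) k))
    (trans (sym (word-act 3≤n v (s β μ) k)) (sym (u≈v (s β μ) k))))))

  opaque
    extend : (v : List (Fin n)) {a b : Pt n} → a ≺ b → res a ≢ res b → ∃[ w ] perm w ≗ perm v ∘ swap a b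
    extend v {a} {b} a≺b a≢b = append (reflection-word 3≤n a≺b a≢b)
      where
      append : ∃[ u ] perm u ≗ swap a b → ∃[ w ] perm w ≗ perm v ∘ swap a b
      append (u , u≗) = v ++ u , λ x → trans (perm-++ v u x) (cong (perm v) (u≗ x))

    ascending : (v w : List (Fin n)) {a b : Pt n} → res a ≢ res b → a ≺ b → perm v a ≺ perm v b →
                perm w ≗ perm v ∘ swap a b → word v ≤ᴮ word w × N (perm v) < N (perm w)
    ascending v w {a} {b} a≢b a≺b va≺vb w≗ =
      compare (Length-exists 3≤n {word v} v (≈-refl {f = word v})) (Length-exists 3≤n {word w} w (≈-refl {f = word w}))
      where
      compare : ∃[ k ] Length (word v) k × N (perm v) ≡ + (2 ℕ.* k) → ∃[ l ] Length (word w) l × N (perm w) ≡ + (2 ℕ.* l) →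
                word v ≤ᴮ word w × N (perm v) < N (perm w)
      compare (k , length-v , N-v) (l , length-w , N-w) =
        step (reflexive (word∈Waff v) (≈-refl {f = word v}))
          ((E b ⊖ E a , RealRoot⇒Πaff⁺ 3≤n {a} {b} a≺b a≢b , word-s {word v} v w {a} {b} (≈-refl {f = word v}) a≢b (λ _ → refl) w≗) ,
           k , l , length-v , length-w , k<l) ,
        subst₂ _<_ (sym N-v) (sym N-w) (+<+ (ℕₚ.*-monoʳ-< 2 k<l))
        where
        k<l : k ℕ.< l
        k<l = Length-increases 3≤n {word v} {word w} v w (≈-refl {f = word v}) (≈-refl {f = word w}) {a} {b} a≢b a≺b va≺vb w≗ length-v length-w

  balanced-perm : (w : List (Fin n)) → Balanced (perm w)
  balanced-perm []      = balanced-id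
  balanced-perm (i ∷ w) = balanced-swap (affine-perm 3≤n w) (balanced-perm w) (lo≢hi 3≤n i)

  opaque
    unfolding crossing descent φ

    -- At the cut `r` the value `φ (base r) (base r')` is attained exactly, while `φ` of the images
    -- is only bounded above. So `Ψ` is at most the rise of `base r'` minus that of `base r`, and
    -- each part is at most `m`, the second one through `descent≡crossing`.
    Ψ≤2m : {f : Pt n → Pt n} → Affine f → Balanced f → {m : ℤ} → (∀ k → crossing f k ≤ m) →
           ∀ r r' → Ψ f (base r) (base r') ≤ m + m
    Ψ≤2m {f} F bal {m} crossing≤m r r' = linear₃ (φ≤ (f (base r)) (f (base r')) r)
      (≤-trans (x≤x⁺ (rise f r (base r'))) (≤-trans (term≤sum (λ j → 0≤x⁺ (rise f r (base j))) r') (crossing≤m r)))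
      (≤-trans (x≤x⁺ (- rise f r (base r))) (≤-trans (term≤sum (λ j → 0≤x⁺ (- rise f r (base j))) r)
        (≤-trans (≤-reflexive (descent≡crossing {f = f} bal r)) (crossing≤m r))))
      (lemma m (φ (f (base r)) (f (base r'))) (E (f (base r')) r) (E (f (base r)) r) (E (base r') r) (E (base r) r))
      where
      lemma : ∀ m p a b c d → m + m - (p - (c - d)) ≡ (a - b - p) + (m - (a - c)) + (m - - (b - d))
      lemma = solve-∀

  ∣Ψ∣≤2m : {f : Pt n → Pt n} → Affine f → Balanced f → {m : ℤ} → (∀ k → crossing f k ≤ m) →
           ∀ r r' → + ∣ Ψ f (base r) (base r') ∣ ≤ m + m
  ∣Ψ∣≤2m {f} F bal {m} crossing≤m r r' with ≤-total 0ℤ (Ψ f (base r) (base r')) | r ≟ r'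
  ... | inj₁ 0≤Ψ | _ = subst (_≤ m + m) (sym (0≤i⇒+∣i∣≡i 0≤Ψ)) (Ψ≤2m F bal crossing≤m r r')
  ... | inj₂ _   | yes refl = subst (λ z → + ∣ z ∣ ≤ m + m) (sym Ψ≡0) (subst (_≤ m + m) Ψ≡0 (Ψ≤2m F bal crossing≤m r r))
    where
    Ψ≡0 : Ψ f (base r) (base r) ≡ 0ℤ
    Ψ≡0 = i≡j⇒i-j≡0 (φ-affine-same F (base r) (base r) refl)
  ... | inj₂ Ψ≤0 | no r≢r' = subst (_≤ m + m) (trans (sym (0≤i⇒+∣i∣≡i 0≤Ψ')) (cong +_ (trans (cong ∣_∣ Ψ'≡) (∣-i∣≡∣i∣ (Ψ f (base r) (base r'))))))
    (Ψ≤2m F bal crossing≤m r' r)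
    where
    Ψ'≡ : Ψ f (base r') (base r) ≡ - Ψ f (base r) (base r')
    Ψ'≡ = Ψ-antisym F {base r} {base r'} r≢r'
    0≤Ψ' : 0ℤ ≤ Ψ f (base r') (base r)
    0≤Ψ' = subst (0ℤ ≤_) (sym Ψ'≡) (neg-mono-≤ Ψ≤0)

  opaque
    unfolding N

    -- The crude bound of 2m for each ordered pair of residues; any bound depending on `m` and `n`
    -- alone would make the ascents terminate.
    ceiling : ℤ → ℤ
    ceiling m = sum {n} λ _ → sum {n} λ _ → m + m

    N≤ceiling : (w : List (Fin n)) {m : ℤ} → (∀ k → crossing (perm w) k ≤ m) → N (perm w) ≤ ceiling m
    N≤ceiling w crossing≤m = sum-mono λ r → sum-mono λ r' → ∣Ψ∣≤2m (affine-perm 3≤n w) (balanced-perm w) crossing≤m r r'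

  -- Ascents strictly increase N, which stays bounded by the ceiling.
  dominated : {m : ℤ} → 0ℤ < m → (d : ℕ) (w : List (Fin n)) → (∀ k → crossing (perm w) k ≤ m) →
              ceiling m ≤ N (perm w) + + d → ∃[ v ] word w ≤ᴮ word v × Translation m (perm v)
  dominated {m} 0<m d w crossing≤m fuel =
    by-cases d fuel (ascent-or-translation 3≤n (affine-perm 3≤n w) (balanced-perm w) 0<m crossing≤m)
    where
    by-cases : ∀ d → ceiling m ≤ N (perm w) + + d → Ascent m (perm w) ⊎ Translation m (perm w) →
               ∃[ v ] word w ≤ᴮ word v × Translation m (perm v)
    by-cases _ _ (inj₂ translation) = w , reflexive (word∈Waff w) (≈-refl {f = word w}) , translation
    by-cases d fuel (inj₁ ascent) = ascend d fuel (extend w a≺b a≢b)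
      where
      open Ascent ascent
      ascend : ∀ d → ceiling m ≤ N (perm w) + + d → ∃[ w' ] perm w' ≗ perm w ∘ swap a b →
               ∃[ v ] word w ≤ᴮ word v × Translation m (perm v)
      ascend d fuel (w' , w'≗) = continue d fuel (ascending w w' a≢b a≺b fa≺fb w'≗)
        where
        crossing'≤m : ∀ k → crossing (perm w') k ≤ m
        crossing'≤m k = ≤-trans (≤-reflexive (crossing-cong w'≗ k)) (bounded k)
        lemma : ∀ c a b d → b + d - c ≡ (a + (1ℤ + d) - c) + (b - (1ℤ + a))
        lemma = solve-∀
        prepend : word w ≤ᴮ word w' → ∃[ v ] word w' ≤ᴮ word v × Translation m (perm v) →
                  ∃[ v ] word w ≤ᴮ word v × Translation m (perm v)
        prepend w≤w' (v , w'≤v , translation) = v , ≤ᴮ-trans w≤w' w'≤v , translation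
        continue : ∀ d → ceiling m ≤ N (perm w) + + d → word w ≤ᴮ word w' × N (perm w) < N (perm w') →
                   ∃[ v ] word w ≤ᴮ word v × Translation m (perm v)
        -- With no fuel left `N (perm w)` has reached the ceiling, which a further ascent would
        -- exceed.
        continue ℕ.zero fuel (_ , N<) = contradiction
          (≤-trans (N≤ceiling w' crossing'≤m) (≤-trans fuel (≤-reflexive (+-identityʳ (N (perm w)))))) (<⇒≱ N<)
        continue (ℕ.suc d) fuel (w≤w' , N<) = prepend w≤w' (dominated 0<m d w' crossing'≤m
          (linear₂ fuel (<⇒1+≤ N<) (lemma (ceiling m) (N (perm w)) (N (perm w')) (+ d))))

  dominated-by-translation : {m : ℤ} → 0ℤ < m → (w : List (Fin n)) → (∀ k → crossing (perm w) k ≤ m) →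
                             ∃[ v ] word w ≤ᴮ word v × Translation m (perm v)
  dominated-by-translation {m} 0<m w crossing≤m = dominated 0<m ∣ ceiling m ∣ w crossing≤m
    (≤-trans (≤-reflexive (sym (trans (+-identityˡ _) (0≤i⇒+∣i∣≡i (≤-trans 0≤N (N≤ceiling w crossing≤m))))))
      (+-monoˡ-≤ (+ ∣ ceiling m ∣) 0≤N))
    where
    0≤N : 0ℤ ≤ N (perm w)
    0≤N = subst (0ℤ ≤_) (sym (N-def (perm w))) (sum-nonNegative {f = λ r → sum λ r' → + ∣ Ψ (perm w) (base r) (base r') ∣} λ r →
      sum-nonNegative {f = λ r' → + ∣ Ψ (perm w) (base r) (base r') ∣} λ r' → +≤+ ℕ.z≤n)

  -- The vertices of a chain are linear maps, whereas crossings belong to permutations; so a word is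
  -- carried along each edge.
  chain-crossing : {u v : Map n} (p : Chain u v) (w : List (Fin n)) → u ≈ word w →
                   ∃[ w' ] v ≈ word w' × (∀ k → crossing (perm w') k ≤ crossing (perm w) k + degree p k)
  chain-crossing ([] {u} {v} _ u≈v) w u≈w =
    w , ≈-trans {f = v} {u} {word w} (≈-sym {f = u} {v} u≈v) u≈w , λ k → ≤-reflexive (sym (+-identityʳ (crossing (perm w) k)))
  chain-crossing (_∷_ {u} {u₁} {v} {β} (_ , _ , β∈ , u₁≈) p) w u≈w = follow (Πaff⁺⇒RealRoot 3≤n β∈)
    where
    Bound : List (Fin n) → (Fin n → ℤ) → Set
    Bound w d = ∃[ w' ] v ≈ word w' × (∀ k → crossing (perm w') k ≤ crossing (perm w) k + d k)
    follow : RealRoot β → Bound w (λ k → β k + degree p k)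
    follow R = reflected (extend w source≺target source≢target)
      where
      open RealRoot R renaming (source to a; target to b)
      F = affine-perm 3≤n w
      lemma : ∀ c β d c' → c + (β + d) - (c' + d) ≡ c + β - c'
      lemma = solve-∀
      reflected : ∃[ w₁ ] perm w₁ ≗ perm w ∘ swap a b → Bound w (λ k → β k + degree p k)
      reflected (w₁ , w₁≗) = conclude (chain-crossing p w₁ (≈-trans {f = u₁} {u ∘ s β} {word w₁} u₁≈
          (≈-sym {f = word w₁} {u ∘ s β} (word-s {u} {β} w w₁ {a} {b} u≈w source≢target root w₁≗))))
        where
        conclude : Bound w₁ (degree p) → Bound w (λ k → β k + degree p k)
        conclude (w' , v≈w' , crossing≤) = w' , v≈w' , λ k → ≤-trans (crossing≤ k)
          (linear₁ (crossing-swap-≤ F source≢target k (exchange-chain (E a k) (E b k) (E (perm w a) k) (E (perm w b) k) (E-mono (<⇒≤ source≺target) k)))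
            (trans (cong₂ (λ x y → crossing (perm w) k + (x + degree p k) - (y + degree p k)) (root k) (crossing-cong w₁≗ k))
              (lemma (crossing (perm w) k) (E b k - E a k) (degree p k) (crossing (perm w ∘ swap a b) k))))

-- Translations

weight : Fin n → Fin n → Fin n → ℤ
weight p q r = α p r - α q r

weight-right : {p q : Fin n} → p ≢ q → weight p q p ≡ 1ℤ
weight-right {p = p} p≢q = cong₂ _-_ (α-refl p) (α-≢ (p≢q ∘ sym))

weight-left : {p q : Fin n} → p ≢ q → weight p q q ≡ -1ℤ
weight-left {q = q} p≢q = cong₂ _-_ (α-≢ p≢q) (α-refl q)

weight-other : {p q r : Fin n} → p ≢ r → q ≢ r → weight p q r ≡ 0ℤ
weight-other p≢r q≢r = cong₂ _-_ (α-≢ p≢r) (α-≢ q≢r)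

translate : Fin n → Fin n → ℤ → Pt n → Pt n
translate p q m x = shift (m * weight p q (res x)) x

translate-+ : (p q : Fin n) (k l : ℤ) → ∀ x → translate p q k (translate p q l x) ≡ translate p q (l + k) x
translate-+ p q k l x = trans (shift-shift (k * weight p q (res x)) (l * weight p q (res x)) x)
  (cong (λ z → shift z x) (sym (*-distribʳ-+ (weight p q (res x)) l k)))

translate-zero : (p q : Fin n) → ∀ x → translate p q 0ℤ x ≡ x
translate-zero p q x = shift-zero x

translate-Translation : {p q : Fin n} → p ≢ q → (m : ℤ) → Translation m (translate p q m)
translate-Translation {p = p} {q} p≢q m = record
  { right       = p
  ; left        = q
  ; right≢left  = p≢q
  ; right-moves = cong (λ z → shift z (base p)) (trans (cong (_*_ m) (weight-right p≢q)) (*-identityʳ m))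
  ; left-moves  = cong (λ z → shift z (base q)) (trans (cong (_*_ m) (weight-left p≢q)) (trans (*-comm m -1ℤ) (-1*i≡-i m)))
  ; fixed       = λ r r≢p r≢q → trans (cong (λ z → shift z (base r))
                    (trans (cong (_*_ m) (weight-other (r≢p ∘ sym) (r≢q ∘ sym))) (*-zeroʳ m))) (shift-zero (base r))
  }

Translation⇒translate : {f : Pt n → Pt n} {m : ℤ} (T : Translation m f) →
  ∀ r → f (base r) ≡ translate (Translation.right T) (Translation.left T) m (base r)
Translation⇒translate {f = f} {m} T r = by-cases (r ≟ right) (r ≟ left)
  where
  open Translation T
  module T' = Translation (translate-Translation right≢left m)
  by-cases : Dec (r ≡ right) → Dec (r ≡ left) → f (base r) ≡ translate right left m (base r)
  by-cases (yes refl) _ = trans right-moves (sym T'.right-moves)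
  by-cases (no _) (yes refl) = trans left-moves (sym T'.left-moves)
  by-cases (no r≢p) (no r≢q) = trans (fixed r r≢p r≢q) (sym (T'.fixed r r≢p r≢q))

-- The translation by one is the product of two reflections whose roots E b - E a and
-- E (a + c) - E b add up to c.
swap-swap : {p q : Fin n} → p ≢ q → (j : ℤ) → ∀ x →
            swap (shift j (base q)) (shift 1ℤ (base p)) (swap (base p) (shift j (base q)) x) ≡ translate p q 1ℤ x
swap-swap {p = p} {q} p≢q j x = by-cases (p ≟ res x) (q ≟ res x)
  where
  a = base p
  b = shift j (base q)
  a⁺ = shift 1ℤ a
  by-cases : Dec (p ≡ res x) → Dec (q ≡ res x) → swap b a⁺ (swap a b x) ≡ translate p q 1ℤ x
  by-cases (yes p≡x) _ = begin
    swap b a⁺ (swap a b x)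
      ≡⟨ cong (swap b a⁺) (swap-source a b (sym p≡x)) ⟩
    swap b a⁺ (shift (proj₂ x - 0ℤ) b)
      ≡⟨ trans (swap-shift (p≢q ∘ sym) (proj₂ x - 0ℤ) b) (cong (shift (proj₂ x - 0ℤ)) (swap-a b a⁺)) ⟩
    shift (proj₂ x - 0ℤ) a⁺
      ≡⟨ cong₂ _,_ p≡x (lemma (proj₂ x)) ⟩
    shift (1ℤ * 1ℤ) x
      ≡⟨ cong (λ z → shift (1ℤ * z) x) (trans (sym (weight-right p≢q)) (cong (weight p q) p≡x)) ⟩
    translate p q 1ℤ x ∎
    where
    open ≡-Reasoning
    lemma : ∀ x → 0ℤ + 1ℤ + (x - 0ℤ) ≡ x + 1ℤ * 1ℤ
    lemma = solve-∀
  by-cases (no p≢x) (yes q≡x) = begin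
    swap b a⁺ (swap a b x)
      ≡⟨ cong (swap b a⁺) (swap-target {a = a} {b} p≢q (sym q≡x)) ⟩
    swap b a⁺ (shift (proj₂ x - (0ℤ + j)) a)
      ≡⟨ swap-target {a = b} {a⁺} (p≢q ∘ sym) refl ⟩
    shift (0ℤ + (proj₂ x - (0ℤ + j)) - (0ℤ + 1ℤ)) b
      ≡⟨ cong₂ _,_ q≡x (lemma (proj₂ x) j) ⟩
    shift (1ℤ * -1ℤ) x
      ≡⟨ cong (λ z → shift (1ℤ * z) x) (trans (sym (weight-left p≢q)) (cong (weight p q) q≡x)) ⟩
    translate p q 1ℤ x ∎
    where
    open ≡-Reasoning
    lemma : ∀ x j → 0ℤ + j + (0ℤ + (x - (0ℤ + j)) - (0ℤ + 1ℤ)) ≡ x + 1ℤ * -1ℤ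
    lemma = solve-∀
  by-cases (no p≢x) (no q≢x) = begin
    swap b a⁺ (swap a b x)
      ≡⟨ cong (swap b a⁺) (swap-fixed a b (p≢x ∘ sym) (q≢x ∘ sym)) ⟩
    swap b a⁺ x
      ≡⟨ swap-fixed b a⁺ (q≢x ∘ sym) (p≢x ∘ sym) ⟩
    x
      ≡⟨ shift-zero x ⟨
    shift (1ℤ * 0ℤ) x
      ≡⟨ cong (λ z → shift (1ℤ * z) x) (sym (weight-other p≢x q≢x)) ⟩
    translate p q 1ℤ x ∎
    where open ≡-Reasoning

opaque
  unfolding N

  -- The pair of `p` and `q` contributes 2m, and each of them contributes m with each of the other n
  -- - 2 classes. That makes 2m(n - 1), doubled because `N` runs over ordered pairs.
  N-translate : {m : ℕ} {p q : Fin n} → p ≢ q → N (translate p q (+ m)) ≡ + (2 ℕ.* (2 ℕ.* m ℕ.* (n ℕ.∸ 1)))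
  N-translate {n@(ℕ.suc n')} {m} {p} {q} p≢q = begin
    N (translate p q (+ m))
      ≡⟨ sum-cong-≗ (λ r → sum-cong-≗ (λ r' → pointwise r r')) ⟩
    sum {n} (λ r → sum {n} (λ r' → + m * (A r + (B r * α p r' + C r * α q r'))))
      ≡⟨ sum-cong-≗ (λ r → trans (sym (*-distribˡ-sum (+ m) (λ r' → A r + (B r * α p r' + C r * α q r')))) (cong (_*_ (+ m)) (row r))) ⟩
    sum {n} (λ r → + m * (+ n * A r + (B r + C r)))
      ≡⟨ *-distribˡ-sum (+ m) (λ r → + n * A r + (B r + C r)) ⟨
    + m * sum {n} (λ r → + n * A r + (B r + C r))
      ≡⟨ cong (_*_ (+ m)) (trans (sum-cong-≗ (λ r → collect (+ n) (α p r) (α q r))) total) ⟩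
    + m * (+ n * + 2 + ((+ n - + 2) + (+ n - + 2)))
      ≡⟨ cong (_*_ (+ m)) (lemma (+ n')) ⟩
    + m * (+ 4 * + n')
      ≡⟨ trans (lemma' (+ m) (+ n')) (cong (_*_ (+ 2)) (trans (cong (_* + n') (sym (pos-* 2 m))) (sym (pos-* (2 ℕ.* m) n')))) ⟩
    + 2 * + (2 ℕ.* m ℕ.* n')
      ≡⟨ pos-* 2 (2 ℕ.* m ℕ.* n') ⟨
    + (2 ℕ.* (2 ℕ.* m ℕ.* n')) ∎
    where
    open ≡-Reasoning
    A B C : Fin n → ℤ
    A r = α p r + α q r
    B r = 1ℤ - (α p r + α p r)
    C r = 1ℤ - (α q r + α q r)
    lemma : ∀ n' → (1ℤ + n') * + 2 + (((1ℤ + n') - + 2) + ((1ℤ + n') - + 2)) ≡ + 4 * n'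
    lemma = solve-∀
    lemma' : ∀ m n' → m * (+ 4 * n') ≡ + 2 * (+ 2 * m * n')
    lemma' = solve-∀
    collect : ∀ n p q → n * (p + q) + ((1ℤ - (p + p)) + (1ℤ - (q + q))) ≡ + 2 + ((n - + 2) * p + (n - + 2) * q)
    collect = solve-∀
    row : ∀ r → sum (λ r' → A r + (B r * α p r' + C r * α q r')) ≡ + n * A r + (B r + C r)
    row r = trans (∑-distrib-+ {n} (λ _ → A r) (λ r' → B r * α p r' + C r * α q r'))
      (cong₂ _+_ (sum-const n (A r)) (trans (∑-distrib-+ (λ r' → B r * α p r') (λ r' → C r * α q r'))
        (cong₂ _+_ (sum-α (λ _ → B r) p) (sum-α (λ _ → C r) q))))
    total : sum {n} (λ r → + 2 + ((+ n - + 2) * α p r + (+ n - + 2) * α q r)) ≡ + n * + 2 + ((+ n - + 2) + (+ n - + 2))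
    total = trans (∑-distrib-+ {n} (λ _ → + 2) (λ r → (+ n - + 2) * α p r + (+ n - + 2) * α q r))
      (cong₂ _+_ (sum-const n (+ 2)) (trans (∑-distrib-+ (λ r → (+ n - + 2) * α p r) (λ r → (+ n - + 2) * α q r))
        (cong₂ _+_ (sum-α (λ _ → + n - + 2) p) (sum-α (λ _ → + n - + 2) q))))
    -- Interpolation in `r'`: `A r` is the value away from `p` and `q`, while `B r` and `C r` are
    -- the corrections at `p` and at `q`.
    difference : ∀ r r' → + ∣ weight p q r' - weight p q r ∣ ≡ A r + (B r * α p r' + C r * α q r')
    difference r r' with p ≟ r | q ≟ r | p ≟ r' | q ≟ r'
    ... | yes p≡r | yes q≡r | _ | _ = contradiction (trans p≡r (sym q≡r)) p≢q
    ... | _ | _ | yes p≡r' | yes q≡r' = contradiction (trans p≡r' (sym q≡r')) p≢q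
    ... | yes _ | no _  | yes _ | no _  = refl
    ... | yes _ | no _  | no _  | yes _ = refl
    ... | yes _ | no _  | no _  | no _  = refl
    ... | no _  | yes _ | yes _ | no _  = refl
    ... | no _  | yes _ | no _  | yes _ = refl
    ... | no _  | yes _ | no _  | no _  = refl
    ... | no _  | no _  | yes _ | no _  = refl
    ... | no _  | no _  | no _  | yes _ = refl
    ... | no _  | no _  | no _  | no _  = refl
    pointwise : ∀ r r' → + ∣ Ψ (translate p q (+ m)) (base r) (base r') ∣ ≡ + m * (A r + (B r * α p r' + C r * α q r'))
    pointwise r r' = trans (cong (+_ ∘ ∣_∣) (trans (cong (_- φ (base r) (base r')) (trans (φ-shiftˡ (+ m * weight p q r) (base r) (shift (+ m * weight p q r') (base r')))
        (cong (_- + m * weight p q r) (φ-shiftʳ (+ m * weight p q r') (base r) (base r')))))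
        (factor (φ (base r) (base r')) (+ m) (weight p q r') (weight p q r))))
      (trans (cong +_ (∣i*j∣≡∣i∣*∣j∣ (+ m) (weight p q r' - weight p q r)))
        (trans (pos-* m ∣ weight p q r' - weight p q r ∣) (cong (_*_ (+ m)) (difference r r'))))
      where
      factor : ∀ f m x y → f + m * x - m * y - f ≡ m * (x - y)
      factor = solve-∀

module _ (3≤n : 3 ℕ.≤ n) where

  form-scale : (m : ℤ) (γ μ : Qaff n) → ⟨ m · γ , μ ⟩ ≡ m * ⟨ γ , μ ⟩
  form-scale m γ μ = trans (form-ε 3≤n (m · γ) μ) (trans (sum-cong-≗ λ r → lemma m (γ r) (γ (next r)) (ε μ r))
    (trans (sym (*-distribˡ-sum m (λ r → ε γ r * ε μ r))) (cong (_*_ m) (sym (form-ε 3≤n γ μ)))))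
    where
    lemma : ∀ m a b e → (m * a - m * b) * e ≡ m * ((a - b) * e)
    lemma = solve-∀

  form-root : (p q : Fin n) (μ : Qaff n) → ⟨ E (base q) ⊖ E (base p) , μ ⟩ ≡ ε μ q - ε μ p
  form-root p q μ = trans (form-ε 3≤n (E (base q) ⊖ E (base p)) μ)
    (trans (sum-cong-≗ λ r → *-comm (ε (E (base q) ⊖ E (base p)) r) (ε μ r)) (sum-root (ε μ) (base p) (base q)))

  opaque
    unfolding act

    -- Since `t μ` subtracts a multiple of `c`, the class moving right is the one that the root
    -- counts negatively, its source `p`.
    translate-t : (p q : Fin n) (m : ℤ) → act (translate p q m) ≈ t (m · (E (base q) ⊖ E (base p)))
    translate-t p q m μ k = begin
      μ k + sum (λ r → ε μ r * (E (translate p q m (base r)) k - E (base r) k))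
        ≡⟨ cong (_+_ (μ k)) (sum-cong-≗ λ r → trans (cong (λ z → ε μ r * (z - E (base r) k)) (E-shift (m * weight p q r) (base r) k))
             (expand (ε μ r) (E (base r) k) m (α p r) (α q r))) ⟩
      μ k + sum (λ r → m * ε μ r * α p r - m * ε μ r * α q r)
        ≡⟨ cong (_+_ (μ k)) (trans (sum-sub (λ r → m * ε μ r * α p r) (λ r → m * ε μ r * α q r))
             (cong₂ _-_ (sum-α (λ r → m * ε μ r) p) (sum-α (λ r → m * ε μ r) q))) ⟩
      μ k + (m * ε μ p - m * ε μ q)
        ≡⟨ lemma (μ k) m (ε μ p) (ε μ q) ⟩
      μ k - m * (ε μ q - ε μ p) * 1ℤ
        ≡⟨ cong (λ z → μ k - z * 1ℤ) (sym (trans (form-scale m (E (base q) ⊖ E (base p)) μ) (cong (_*_ m) (form-root p q μ)))) ⟩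
      t (m · (E (base q) ⊖ E (base p))) μ k ∎
      where
      open ≡-Reasoning
      expand : ∀ e x m a b → e * (x + m * (a - b) - x) ≡ m * e * a - m * e * b
      expand = solve-∀
      lemma : ∀ μ m a b → μ + (m * a - m * b) ≡ μ - m * (b - a) * 1ℤ
      lemma = solve-∀

  -- A translate b of `q` lies between a = p and a + n, so `E (a + c) - E b` and `E b - E a` are
  -- both positive roots, with sum `c`. Edges multiply on the right, which is why the outer factor
  -- of `swap-swap` is the first edge.
  chain-translate : {p q : Fin n} → p ≢ q → (l : ℕ) (v : List (Fin n)) →
    ∃[ w ] perm w ≗ perm v ∘ translate p q (+ l) × Σ[ C ∈ Chain (word v) (word w) ] (∀ k → degree C k ≡ + l)
  chain-translate {p} {q} p≢q ℕ.zero v = v , (λ x → cong (perm v) (sym (translate-zero p q x))) , [] (word∈Waff v) ≈-refl , λ _ → refl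
  chain-translate {p} {q} p≢q (ℕ.suc l) v with between {x = base p} {base q} p≢q
  ... | j , a≺b , b≺a⁺ with extend 3≤n v b≺a⁺ (p≢q ∘ sym)
  ...   | v₁ , v₁≗ with extend 3≤n v₁ a≺b p≢q
  ...     | v₂ , v₂≗ with chain-translate p≢q l v₂
  ...       | w , w≗ , C , degree-C =
    w , perm-w ,
    (word∈Waff v , word∈Waff v₁ , RealRoot⇒Πaff⁺ 3≤n b≺a⁺ (p≢q ∘ sym) , word-s 3≤n v v₁ ≈-refl (p≢q ∘ sym) (λ _ → refl) v₁≗) ∷
    (word∈Waff v₁ , word∈Waff v₂ , RealRoot⇒Πaff⁺ 3≤n a≺b p≢q , word-s 3≤n v₁ v₂ ≈-refl p≢q (λ _ → refl) v₂≗) ∷ C ,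
    λ k → trans (cong₂ (λ x y → x - E b k + (E b k - E a k + y)) (E-shift 1ℤ a k) (degree-C k)) (lemma (E a k) (E b k) (+ l))
    where
    a = base p
    b = shift j (base q)
    lemma : ∀ a b l → a + 1ℤ - b + (b - a + l) ≡ 1ℤ + l
    lemma = solve-∀
    perm-w : ∀ x → perm w x ≡ perm v (translate p q (+ ℕ.suc l) x)
    perm-w x = begin
      perm w x
        ≡⟨ trans (w≗ x) (trans (v₂≗ (translate p q (+ l) x)) (v₁≗ (swap a b (translate p q (+ l) x)))) ⟩
      perm v (swap b (shift 1ℤ a) (swap a b (translate p q (+ l) x)))
        ≡⟨ cong (perm v) (swap-swap p≢q j (translate p q (+ l) x)) ⟩
      perm v (translate p q 1ℤ (translate p q (+ l) x))
        ≡⟨ cong (perm v) (trans (translate-+ p q 1ℤ (+ l) x) (cong (λ z → translate p q z x) (+-comm (+ l) 1ℤ))) ⟩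
      perm v (translate p q (+ ℕ.suc l) x) ∎
      where open ≡-Reasoning

-- The curve neighborhood of the identity

finite-root : Fin n → Fin n → Qaff n
finite-root p q = E (base q) ⊖ E (base p)

module _ (3≤n : 3 ℕ.≤ n) {m : ℕ} (2≤m : 2 ℕ.≤ m) where

  private
    instance
      m-nonZero : ℕ.NonZero m
      m-nonZero = ℕ.>-nonZero (ℕₚ.<⇒≤ 2≤m)

    0<m : 0ℤ < + m
    0<m = +<+ (ℕₚ.<⇒≤ 2≤m)

    d : Degree n
    d = replicate n m

  tᵐ : Qaff n → Map n
  tᵐ γ = t (+ m · γ)

  tᵐ-cong : {γ γ' : Qaff n} → γ ≗ γ' → tᵐ γ ≈ tᵐ γ'
  tᵐ-cong γ≗γ' μ = t-cong (λ k → cong (_*_ (+ m)) (γ≗γ' k)) {μ} {μ} (λ _ → refl)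

  act-tᵐ : (p q : Fin n) (w : List (Fin n)) → (∀ r → perm w (base r) ≡ translate p q (+ m) (base r)) →
           word w ≈ tᵐ (finite-root p q)
  act-tᵐ p q w w≡ μ k = trans (word-act 3≤n w μ k)
    (trans (act-cong {f = perm w} {translate p q (+ m)} w≡ μ k) (translate-t 3≤n p q (+ m) μ k))

  reachable-resp : {v w : Map n} → v ≈ w → v ∈ Reachable d id → w ∈ Reachable d id
  reachable-resp {v} {w} v≈w (u , u≤id , C , degree≤) = replace-end (Chain-resp C v≈w)
    where
    replace-end : Σ[ C' ∈ Chain u w ] degree C' ≗ degree C → w ∈ Reachable d id
    replace-end (C' , degree≗) = u , u≤id , C' , λ k → ≤-trans (≤-reflexive (degree≗ k)) (degree≤ k)

  tᵐ-finite : {p q : Fin n} → p ≢ q →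
              tᵐ (finite-root p q) ∈ Reachable d id × Length (tᵐ (finite-root p q)) (2 ℕ.* m ℕ.* (n ℕ.∸ 1))
  tᵐ-finite {p} {q} p≢q = reached (chain-translate 3≤n p≢q m [])
    where
    reached : ∃[ w ] perm w ≗ translate p q (+ m) × Σ[ C ∈ Chain id (word w) ] (∀ k → degree C k ≡ + m) →
              tᵐ (finite-root p q) ∈ Reachable d id × Length (tᵐ (finite-root p q)) (2 ℕ.* m ℕ.* (n ℕ.∸ 1))
    reached (w , w≗ , C , degree≡) =
      reachable-resp {word w} {tᵐ (finite-root p q)} w≈t
        (id , reflexive (word∈Waff []) (λ _ _ → refl) , C , λ k → ≤-reflexive (degree≡ k)) ,
      N⇒Length 3≤n {tᵐ (finite-root p q)} w (≈-sym {f = word w} {tᵐ (finite-root p q)} w≈t) (trans (N-cong w≗) (N-translate {m = m} p≢q))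
      where
      w≈t : word w ≈ tᵐ (finite-root p q)
      w≈t = act-tᵐ p q w (w≗ ∘ base)

  opaque
    tᵐ-reachable-Length : {γ : Qaff n} → γ ∈ Π → {w : Map n} → w ≈ tᵐ γ →
                          w ∈ Reachable d id × Length w (2 ℕ.* m ℕ.* (n ℕ.∸ 1))
    tᵐ-reachable-Length {γ} γ∈Π {w} w≈ = from-root (Π⇒FiniteRoot 3≤n γ∈Π)
      where
      from-root : FiniteRoot γ → w ∈ Reachable d id × Length w (2 ℕ.* m ℕ.* (n ℕ.∸ 1))
      from-root R = reachable-resp {tᵐ β} {w} t≈w (proj₁ (tᵐ-finite source≢target)) ,
        Length-resp {f = tᵐ β} {w} t≈w (proj₂ (tᵐ-finite source≢target))
        where
        open FiniteRoot R
        β : Qaff n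
        β = finite-root source target
        t≈w : tᵐ (finite-root source target) ≈ w
        t≈w μ k = sym (trans (w≈ μ k) (tᵐ-cong {γ} {finite-root source target} root μ k))

    reachable-word : {v : Map n} → v ∈ Reachable d id → ∃[ w ] v ≈ word w × (∀ k → crossing (perm w) k ≤ + m)
    reachable-word {v} (u , u≤id , C , degree≤) = bounded (chain-crossing 3≤n C [] (≤ᴮ-id u≤id))
      where
      bounded : ∃[ w ] v ≈ word w × (∀ k → crossing (perm w) k ≤ crossing id k + degree C k) →
                ∃[ w ] v ≈ word w × (∀ k → crossing (perm w) k ≤ + m)
      bounded (w , v≈w , crossing≤) = w , v≈w , λ k → ≤-trans (crossing≤ k)
        (≤-trans (≤-reflexive (trans (cong (_+ degree C k) (crossing-id k)) (+-identityˡ (degree C k)))) (degree≤ k))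

    reachable≤tᵐ : {v : Map n} → v ∈ Reachable d id → ∃[ γ ] γ ∈ Π × v ≤ᴮ tᵐ γ
    reachable≤tᵐ {v} v∈ = represent (reachable-word v∈)
      where
      represent : ∃[ w ] v ≈ word w × (∀ k → crossing (perm w) k ≤ + m) → ∃[ γ ] γ ∈ Π × v ≤ᴮ tᵐ γ
      represent (w , v≈w , crossing≤m) = dominate (dominated-by-translation 3≤n 0<m w crossing≤m)
        where
        dominate : ∃[ w' ] word w ≤ᴮ word w' × Translation (+ m) (perm w') → ∃[ γ ] γ ∈ Π × v ≤ᴮ tᵐ γ
        dominate (w' , w≤w' , T) = finite-root right left , root⇒Π 3≤n right≢left (λ _ → refl) ,
          ≤ᴮ-respˡ (Waff-resp {f = word w} {v} (≈-sym {f = v} {word w} v≈w) (word∈Waff w)) v≈w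
            (≤ᴮ-resp (act-tᵐ right left w' (Translation⇒translate T)) w≤w')
          where open Translation T

    Γ⇒t : {w : Map n} → w ∈ Γ d id → ∃[ γ ] γ ∈ Π × w ≈ tᵐ γ
    Γ⇒t {w} (w∈ , maximal) = conclude (reachable≤tᵐ w∈)
      where
      conclude : ∃[ γ ] γ ∈ Π × w ≤ᴮ tᵐ γ → ∃[ γ ] γ ∈ Π × w ≈ tᵐ γ
      conclude (γ , γ∈Π , w≤t) = γ , γ∈Π , maximal (tᵐ γ) (proj₁ (tᵐ-reachable-Length γ∈Π {tᵐ γ} λ _ _ → refl)) w≤t

    t⇒Γ : {w : Map n} → ∃[ γ ] γ ∈ Π × w ≈ tᵐ γ → w ∈ Γ d id
    t⇒Γ {w} (γ , γ∈Π , w≈t) = proj₁ (tᵐ-reachable-Length γ∈Π w≈t) ,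
      λ v v∈ w≤v → maximal v w≤v (reachable-word v∈) (reachable≤tᵐ v∈)
      where
      L : ℕ
      L = 2 ℕ.* m ℕ.* (n ℕ.∸ 1)
      length-w : Length w L
      length-w = proj₂ (tᵐ-reachable-Length γ∈Π w≈t)
      maximal : ∀ v → w ≤ᴮ v → ∃[ u ] v ≈ word u × (∀ k → crossing (perm u) k ≤ + m) →
                ∃[ γ' ] γ' ∈ Π × v ≤ᴮ tᵐ γ' → w ≈ v
      maximal v w≤v (u , v≈u , _) (γ' , γ'∈Π , v≤t) = compare (Length-exists 3≤n {v} u v≈u)
        where
        length-t : Length (tᵐ γ') L
        length-t = proj₂ (tᵐ-reachable-Length γ'∈Π {tᵐ γ'} λ _ _ → refl)
        -- Both `w` and the translation above `v` have length `L`, so `v` has no room to be strictly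
        -- longer than `w`.
        squeeze : ∀ {l} → Length v l → w ≈ v ⊎ L ℕ.< l → v ≈ tᵐ γ' ⊎ l ℕ.< L → w ≈ v
        squeeze _ (inj₁ w≈v) _ = w≈v
        squeeze length-v (inj₂ L<l) (inj₁ v≈t) = contradiction
          (Length-unique {f = v} length-v (Length-resp {f = tᵐ γ'} {v} (≈-sym {f = v} {tᵐ γ'} v≈t) length-t)) (ℕₚ.<⇒≢ L<l ∘ sym)
        squeeze _ (inj₂ L<l) (inj₂ l<L) = contradiction l<L (ℕₚ.<-asym L<l)
        compare : ∃[ l ] Length v l × N (perm u) ≡ + (2 ℕ.* l) → w ≈ v
        compare (l , length-v , _) = squeeze length-v (≤ᴮ-length w≤v length-w length-v) (≤ᴮ-length v≤t length-v length-t)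

  -- The form takes the value 2 on two finite roots only when they are equal.
  finite-root-injective : {p q p' q' : Fin n} → p ≢ q →
    tᵐ (finite-root p q) ≈ tᵐ (finite-root p' q') → p ≡ p' × q ≡ q'
  finite-root-injective {p} {q} {p'} {q'} p≢q t≈t' = equal (p ≟ p') (q ≟ q')
    where
    γ γ' : Qaff n
    γ  = finite-root p q
    γ' = finite-root p' q'
    cancel-form : ∀ {x y z} → z - x * 1ℤ ≡ z - y * 1ℤ → x ≡ y
    cancel-form {x} {y} {z} eq = ≤-antisym (linear₁ (≤-reflexive (sym eq)) (lemma x y z)) (linear₁ (≤-reflexive eq) (lemma y x z))
      where
      lemma : ∀ x y z → y - x ≡ (z - x * 1ℤ) - (z - y * 1ℤ)
      lemma = solve-∀
    pairing : ∀ a b → ⟨ finite-root a b , γ ⟩ ≡ (α q b - α p b) - (α q a - α p a)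
    pairing a b = trans (form-root 3≤n a b γ) (cong₂ _-_ (ε-root (base p) (base q) b) (ε-root (base p) (base q) a))
    -- Both translations are applied to `γ`. Each changes every coordinate by minus its form with
    -- `γ`, so one coordinate suffices, and the factor `m` cancels. The form of `γ` with itself is
    -- 2.
    two : (α q q' - α p q') - (α q p' - α p p') ≡ + 2
    two = trans (sym (pairing p' q')) (trans (sym (*-cancelˡ-≡ (+ m) ⟨ γ , γ ⟩ ⟨ γ' , γ ⟩
        (trans (sym (form-scale 3≤n (+ m) γ γ)) (trans (cancel-form {z = γ p} (t≈t' γ p)) (form-scale 3≤n (+ m) γ' γ)))))
      (trans (pairing p q) (cong₂ _-_ (cong₂ _-_ (α-refl q) (α-≢ p≢q)) (cong₂ _-_ (α-≢ (p≢q ∘ sym)) (α-refl p)))))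
    α≤1 : ∀ (i j : Fin n) → α i j ≤ 1ℤ
    α≤1 i j with i ≟ j
    ... | yes _ = ≤-refl
    ... | no _  = +≤+ ℕ.z≤n
    not-two : ∀ x y z w → x + w ≤ 1ℤ → 0ℤ ≤ y → 0ℤ ≤ z → (x - y) - (z - w) ≢ + 2
    not-two x y z w x+w≤1 0≤y 0≤z eq = contradiction
      (subst (_≤ 1ℤ) eq (linear₃ x+w≤1 0≤y 0≤z (lemma x y z w))) λ { (+≤+ (ℕ.s≤s ())) }
      where
      lemma : ∀ x y z w → 1ℤ - ((x - y) - (z - w)) ≡ (1ℤ - (x + w)) + (y - 0ℤ) + (z - 0ℤ)
      lemma = solve-∀
    equal : Dec (p ≡ p') → Dec (q ≡ q') → p ≡ p' × q ≡ q'
    equal (yes p≡p') (yes q≡q') = p≡p' , q≡q'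
    equal (no p≢p') _ = contradiction two (not-two (α q q') (α p q') (α q p') (α p p')
      (subst (λ z → α q q' + z ≤ 1ℤ) (sym (α-≢ p≢p')) (subst (_≤ 1ℤ) (sym (+-identityʳ (α q q'))) (α≤1 q q')))
      (α-nonNegative p q') (α-nonNegative q p'))
    equal (yes _) (no q≢q') = contradiction two (not-two (α q q') (α p q') (α q p') (α p p')
      (subst (λ z → z + α p p' ≤ 1ℤ) (sym (α-≢ q≢q')) (subst (_≤ 1ℤ) (sym (+-identityˡ (α p p'))) (α≤1 p p')))
      (α-nonNegative p q') (α-nonNegative q p'))

-- Finite roots are ordered pairs of distinct residues, and `punchIn p` enumerates the residues
-- other than `p`; this turns the pairs into `Fin n × Fin (n - 1)`.
Γ-card : 3 ℕ.≤ n → {m : ℕ} → 2 ℕ.≤ m → HasCard (Γ {n} (replicate n m) id) (n ℕ.* (n ℕ.∸ 1))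
Γ-card {n@(ℕ.suc n')} 3≤n {m} 2≤m = record
  { to        = λ i → element (remQuot n' i)
  ; cong      = λ { {i} refl μ k → refl }
  ; bijective = injective , λ (w , w∈Γ) → surjective w (Γ⇒t 3≤n 2≤m w∈Γ)
  }
  where
  element : Fin n × Fin n' → ∃[ w ] w ∈ Γ {n} (replicate n m) id
  element (p , j) = t (+ m · γ) , t⇒Γ 3≤n 2≤m {t (+ m · γ)} (γ , root⇒Π 3≤n (punchInᵢ≢i p j ∘ sym) (λ _ → refl) , λ _ _ → refl)
    where
    γ : Qaff n
    γ = finite-root p (punchIn p j)
  element-injective : ∀ x y → proj₁ (element x) ≈ proj₁ (element y) → x ≡ y
  element-injective (p , j) (p' , j') eq = equal (finite-root-injective 3≤n 2≤m {p} {punchIn p j} {p'} {punchIn p' j'} (punchInᵢ≢i p j ∘ sym) eq)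
    where
    equal : p ≡ p' × punchIn p j ≡ punchIn p' j' → (p , j) ≡ (p' , j')
    equal (refl , eq') = cong (p ,_) (punchIn-injective p j j' eq')
  injective : ∀ {i j} → proj₁ (element (remQuot n' i)) ≈ proj₁ (element (remQuot n' j)) → i ≡ j
  injective {i} {j} eq = trans (sym (combine-remQuot {n} n' i))
    (trans (cong (λ x → combine (proj₁ x) (proj₂ x)) (element-injective (remQuot n' i) (remQuot n' j) eq)) (combine-remQuot {n} n' j))
  surjective : ∀ w → ∃[ γ ] γ ∈ Π × w ≈ t (+ m · γ) →
               ∃[ i ] (∀ {j} → j ≡ i → proj₁ (element (remQuot n' j)) ≈ w)
  surjective w (γ , γ∈Π , w≈t) = index (Π⇒FiniteRoot 3≤n γ∈Π)
    where
    index : FiniteRoot γ → ∃[ i ] (∀ {j} → j ≡ i → proj₁ (element (remQuot n' j)) ≈ w)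
    index R = combine source (punchOut source≢target) , λ { refl μ k → begin
        proj₁ (element (remQuot n' (combine source (punchOut source≢target)))) μ k
          ≡⟨ cong (λ x → proj₁ (element x) μ k) (remQuot-combine source (punchOut source≢target)) ⟩
        t (+ m · finite-root source (punchIn source (punchOut source≢target))) μ k
          ≡⟨ cong (λ q → t (+ m · finite-root source q) μ k) (punchIn-punchOut source≢target) ⟩
        t (+ m · finite-root source target) μ k
          ≡⟨ tᵐ-cong 3≤n 2≤m {γ} {finite-root source target} root μ k ⟨
        t (+ m · γ) μ k
          ≡⟨ w≈t μ k ⟨
        w μ k ∎ }
      where
      open FiniteRoot R
      open ≡-Reasoning

theorem1p8 : (n m : ℕ) → 3 ℕ.≤ n → 2 ℕ.≤ m →
    (Γ {n} (replicate n m) id ≐ (λ w → ∃[ γ ] γ ∈ Π × w ≈ t (+ m · γ)))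
    × HasCard (Γ {n} (replicate n m) id) (n ℕ.* (n ℕ.∸ 1))
    × (∀ w → w ∈ Γ {n} (replicate n m) id → Length w (2 ℕ.* m ℕ.* (n ℕ.∸ 1)))
theorem1p8 n m 3≤n 2≤m =
  ((λ {w} → Γ⇒t 3≤n 2≤m {w}) , (λ {w} → t⇒Γ 3≤n 2≤m {w})) ,
  Γ-card 3≤n 2≤m ,
  λ w w∈Γ → length-of w (Γ⇒t 3≤n 2≤m {w} w∈Γ)
  where
  length-of : ∀ w → ∃[ γ ] γ ∈ Π × w ≈ t (+ m · γ) → Length w (2 ℕ.* m ℕ.* (n ℕ.∸ 1))
  length-of w (γ , γ∈Π , w≈t) = proj₂ (tᵐ-reachable-Length 3≤n 2≤m γ∈Π {w} w≈t)
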